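{- Let $v_0$ be an arbitrary vertex in $K_n$. Given an edge ordering $f$ of the edges of $K_n$, let the greedy $f$-increasing path from $v_0$ be the path $v_0v_1v_2\ldots v_t$ with the following properties: (i) $v_0v_1$ is the lowest-labeled edge incident to $v_0$; (ii) for each $1\le i\le t-1$, $v_{i+1}$ is the vertex $x$ which minimizes the label of $v_ix$ over all $x\notin\{v_0,v_1,\ldots,v_i\}$ such that the label of $v_ix$ exceeds the label of $v_{i-1}v_i$; and (iii) every vertex $x\notin\{v_0,\ldots,v_t\}$ has $v_tx$ labeled below $v_{t-1}v_t$. Then, if $f$ is chosen uniformly at random, the length of the greedy $f$-increasing path from $v_0$ is $(1-\frac1e+o(1))n$ asymptotically almost surely.
   Context: An edge ordering of $K_n$ is a bijection $f:E(K_n)\to\{1,2,\dots,\binom n2\}$; $f(e)$ is the label of $e$. The length of a path is its number of edges. "Asymptotically almost surely" means with probability $1-o(1)$ as $n\to\infty$. -}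

module Defs where

open import Data.Empty using (⊥-elim-irr)
open import Data.Fin as Fin using (Fin; zero; suc; toℕ; inject₁; fromℕ)
import Data.Fin.Properties as Fin
open import Data.Fin.Subset using (Subset; _∈_) renaming (∣_∣ to card)
open import Data.Integer as ℤ using (+_; +[1+_])
import Data.Integer.Properties as ℤ
open import Data.Nat as ℕ using (ℕ; zero; suc; _!; z≤n; s≤s)
open import Data.Nat.Combinatorics using (_C_)
import Data.Nat.Properties as ℕ
open import Data.Product using (∃-syntax; _,_)
open import Data.Rational hiding (_⊔_)
open import Data.Rational.Properties
open import Data.Rational.Solver using (module +-*-Solver)
import Data.Rational.Unnormalised as ℚᵘ
import Data.Rational.Unnormalised.Properties as ℚᵘ
open import Data.Sum using (inj₁; inj₂)
open import Function.Bundles using (_↔_; Inverse)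
open import Function.Definitions using (Injective)
open import Level using (Level; 0ℓ; _⊔_)
open import Relation.Binary using (Setoid; tri<; tri≈; tri>)
import Relation.Binary.Construct.On as On
open import Relation.Binary.PropositionalEquality
open import Relation.Unary using (Pred)

------------------------------------------------------------------------
-- Real numbers, as Cauchy sequences of rationals up to the equivalence induced
-- by _≤ᴿ_

Cauchy : (ℕ → ℚ) → Set
Cauchy x = ∀ ε → 0ℚ < ε →
  ∃[ N ] (∀ m n → N ℕ.≤ m → N ℕ.≤ n → ∣ x m - x n ∣ < ε)

record ℝ : Set where
  constructor mkℝ
  field
    approx : ℕ → ℚ
    cauchy : Cauchy approx

open ℝ public

infix 4 _≤ᴿ_

_≤ᴿ_ : ℝ → ℝ → Set
x ≤ᴿ y = ∀ ε → 0ℚ < ε → ∃[ N ] (∀ m → N ℕ.≤ m → approx x m ≤ approx y m + ε)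

half-positive : ∀ {ε} → 0ℚ < ε → 0ℚ < ½ * ε
half-positive {ε} 0<ε = subst (_< ½ * ε) (*-zeroʳ ½) (*-monoʳ-<-pos ½ 0<ε)

half+half : ∀ ε → ½ * ε + ½ * ε ≡ ε
half+half ε = trans (sym (*-distribʳ-+ ε ½ ½)) (*-identityˡ ε)

∣-∣-comm : ∀ p q → ∣ p - q ∣ ≡ ∣ q - p ∣
∣-∣-comm p q = trans (cong ∣_∣ eq) (∣-p∣≡∣p∣ (q - p))
  where
  open +-*-Solver
  eq : p - q ≡ - (q - p)
  eq = solve 2 (λ p q → p :- q := :- (q :- p)) refl p q

∣p∣≤ : ∀ {p q} → p ≤ q → - p ≤ q → ∣ p ∣ ≤ q
∣p∣≤ {p} p≤q -p≤q with ∣p∣≡p∨∣p∣≡-p p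
... | inj₁ eq = subst (_≤ _) (sym eq) p≤q
... | inj₂ eq = subst (_≤ _) (sym eq) -p≤q

∣∣-lipschitz : ∀ p q → ∣ ∣ p ∣ - ∣ q ∣ ∣ ≤ ∣ p - q ∣
∣∣-lipschitz p q =
  ∣p∣≤ (bound p q)
       (subst₂ _≤_ (neg-sub ∣ q ∣ ∣ p ∣) (∣-∣-comm q p) (bound q p))
  where
  open +-*-Solver
  neg-sub : ∀ a b → a - b ≡ - (b - a)
  neg-sub = solve 2 (λ a b → a :- b := :- (b :- a)) refl
  split : ∀ p q → p ≡ (p - q) + q
  split = solve 2 (λ p q → p := (p :- q) :+ q) refl
  cancel : ∀ a b → (a + b) - b ≡ a
  cancel = solve 2 (λ a b → (a :+ b) :- b := a) refl
  bound : ∀ p q → ∣ p ∣ - ∣ q ∣ ≤ ∣ p - q ∣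
  bound p q = begin
    ∣ p ∣ - ∣ q ∣                 ≡⟨ cong (λ r → ∣ r ∣ - ∣ q ∣) (split p q) ⟩
    ∣ (p - q) + q ∣ - ∣ q ∣       ≤⟨ +-monoˡ-≤ (- ∣ q ∣) (∣p+q∣≤∣p∣+∣q∣ (p - q) q) ⟩
    (∣ p - q ∣ + ∣ q ∣) - ∣ q ∣   ≡⟨ cancel ∣ p - q ∣ ∣ q ∣ ⟩
    ∣ p - q ∣                     ∎
    where open ≤-Reasoning

fromℚ : ℚ → ℝ
fromℚ q = mkℝ (λ _ → q) λ ε 0<ε → 0 , λ _ _ _ _ →
  subst (λ r → ∣ r ∣ < ε) (sym (+-inverseʳ q)) 0<ε

infixl 6 _-ᴿ_

_-ᴿ_ : ℝ → ℝ → ℝ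
approx (x -ᴿ y) m = approx x m - approx y m
cauchy (x -ᴿ y) ε 0<ε
  with cauchy x (½ * ε) (half-positive 0<ε) | cauchy y (½ * ε) (half-positive 0<ε)
... | M , closeˣ | N , closeʸ = M ℕ.⊔ N , close
  where
  open +-*-Solver
  regroup : ∀ a b c d → (a - b) - (c - d) ≡ (a - c) - (b - d)
  regroup = solve 4 (λ a b c d → (a :- b) :- (c :- d) := (a :- c) :- (b :- d)) refl
  open ≤-Reasoning
  close : ∀ m n → M ℕ.⊔ N ℕ.≤ m → M ℕ.⊔ N ℕ.≤ n →
          ∣ (approx x m - approx y m) - (approx x n - approx y n) ∣ < ε
  close m n m≥ n≥ = begin-strict
    ∣ (approx x m - approx y m) - (approx x n - approx y n) ∣
      ≡⟨ cong ∣_∣ (regroup (approx x m) (approx y m) (approx x n) (approx y n)) ⟩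
    ∣ (approx x m - approx x n) - (approx y m - approx y n) ∣
      ≤⟨ ∣p-q∣≤∣p∣+∣q∣ (approx x m - approx x n) (approx y m - approx y n) ⟩
    ∣ approx x m - approx x n ∣ + ∣ approx y m - approx y n ∣
      <⟨ +-mono-< (closeˣ m n (ℕ.m⊔n≤o⇒m≤o M N m≥) (ℕ.m⊔n≤o⇒m≤o M N n≥))
                  (closeʸ m n (ℕ.m⊔n≤o⇒n≤o M N m≥) (ℕ.m⊔n≤o⇒n≤o M N n≥)) ⟩
    ½ * ε + ½ * ε
      ≡⟨ half+half ε ⟩
    ε ∎

∣_∣ᴿ : ℝ → ℝ
approx ∣ x ∣ᴿ m = ∣ approx x m ∣
cauchy ∣ x ∣ᴿ ε 0<ε with cauchy x ε 0<ε
... | N , close = N , λ m n m≥ n≥ →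
  ≤-<-trans (∣∣-lipschitz (approx x m) (approx x n)) (close m n m≥ n≥)

infixr 7 _·ᴿ_

_·ᴿ_ : ℚ → ℝ → ℝ
approx (q ·ᴿ x) m = q * approx x m
cauchy (q ·ᴿ x) ε 0<ε with cauchy x (r * ε) 0<r*ε
  where
  instance
    _ : NonNegative ∣ q ∣
    _ = ∣-∣-nonNeg q
    c-pos : Positive (∣ q ∣ + 1ℚ)
    c-pos = nonNeg+pos⇒pos ∣ q ∣ 1ℚ
    c≢0 : NonZero (∣ q ∣ + 1ℚ)
    c≢0 = pos⇒nonZero (∣ q ∣ + 1ℚ)
  r = 1/ (∣ q ∣ + 1ℚ)
  0<r*ε : 0ℚ < r * ε
  0<r*ε = subst (_< r * ε) (*-zeroʳ r)
            (*-monoʳ-<-pos r {{1/pos⇒pos (∣ q ∣ + 1ℚ)}} 0<ε)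
... | N , close = N , λ m n m≥ n≥ → scaled m n (close m n m≥ n≥)
  where
  instance
    _ : NonNegative ∣ q ∣
    _ = ∣-∣-nonNeg q
    c-pos : Positive (∣ q ∣ + 1ℚ)
    c-pos = nonNeg+pos⇒pos ∣ q ∣ 1ℚ
    c≢0 : NonZero (∣ q ∣ + 1ℚ)
    c≢0 = pos⇒nonZero (∣ q ∣ + 1ℚ)
  open +-*-Solver
  factor : ∀ q a b → q * a - q * b ≡ q * (a - b)
  factor = solve 3 (λ q a b → q :* a :- q :* b := q :* (a :- b)) refl
  open ≤-Reasoning
  scaled : ∀ m n → ∣ approx x m - approx x n ∣ < 1/ (∣ q ∣ + 1ℚ) * ε →
           ∣ q * approx x m - q * approx x n ∣ < ε
  scaled m n d< = begin-strict
    ∣ q * approx x m - q * approx x n ∣     ≡⟨ cong ∣_∣ (factor q (approx x m) (approx x n)) ⟩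
    ∣ q * (approx x m - approx x n) ∣       ≡⟨ ∣p*q∣≡∣p∣*∣q∣ q (approx x m - approx x n) ⟩
    ∣ q ∣ * d                               ≤⟨ *-monoʳ-≤-nonNeg d {{∣-∣-nonNeg (approx x m - approx x n)}}
                                                 (subst (_≤ ∣ q ∣ + 1ℚ) (+-identityʳ ∣ q ∣)
                                                   (+-monoʳ-≤ ∣ q ∣ (nonNegative⁻¹ 1ℚ))) ⟩
    (∣ q ∣ + 1ℚ) * d                        <⟨ *-monoʳ-<-pos (∣ q ∣ + 1ℚ) d< ⟩
    (∣ q ∣ + 1ℚ) * (1/ (∣ q ∣ + 1ℚ) * ε)    ≡⟨ *-assoc (∣ q ∣ + 1ℚ) (1/ (∣ q ∣ + 1ℚ)) ε ⟨
    ((∣ q ∣ + 1ℚ) * 1/ (∣ q ∣ + 1ℚ)) * ε    ≡⟨ cong (_* ε) (*-inverseʳ (∣ q ∣ + 1ℚ)) ⟩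
    1ℚ * ε                                  ≡⟨ *-identityˡ ε ⟩
    ε ∎
    where d = ∣ approx x m - approx x n ∣

1≤⇒pos : ∀ {p} → 1ℚ ≤ p → Positive p
1≤⇒pos 1≤p = positive (<-≤-trans (positive⁻¹ 1ℚ) 1≤p)

-- The bound away from 0 is what makes the reciprocals Cauchy; bound 1 suffices for e.
1/ᴿ : (x : ℝ) → (∀ m → 1ℚ ≤ approx x m) → ℝ
approx (1/ᴿ x 1≤x) m = (1/ approx x m) {{pos⇒nonZero (approx x m) {{1≤⇒pos (1≤x m)}}}}
cauchy (1/ᴿ x 1≤x) ε 0<ε with cauchy x ε 0<ε
... | N , close = N , λ m n m≥ n≥ →
  ≤-<-trans (lipschitz (approx x m) (approx x n) (1≤x m) (1≤x n)) (close m n m≥ n≥)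
  where
  lipschitz : ∀ a b (1≤a : 1ℚ ≤ a) (1≤b : 1ℚ ≤ b) →
    ∣ (1/ a) {{pos⇒nonZero a {{1≤⇒pos 1≤a}}}} -
      (1/ b) {{pos⇒nonZero b {{1≤⇒pos 1≤b}}}} ∣ ≤ ∣ a - b ∣
  lipschitz a b 1≤a 1≤b = begin
    ∣ a⁻¹ - b⁻¹ ∣                      ≡⟨ cong ∣_∣ difference ⟩
    ∣ (a⁻¹ * b⁻¹) * (b - a) ∣          ≡⟨ ∣p*q∣≡∣p∣*∣q∣ (a⁻¹ * b⁻¹) (b - a) ⟩
    ∣ a⁻¹ * b⁻¹ ∣ * ∣ b - a ∣          ≡⟨ cong (_* ∣ b - a ∣) (0≤p⇒∣p∣≡p (nonNegative⁻¹ (a⁻¹ * b⁻¹))) ⟩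
    (a⁻¹ * b⁻¹) * ∣ b - a ∣            ≤⟨ *-monoʳ-≤-nonNeg ∣ b - a ∣ product≤1 ⟩
    1ℚ * ∣ b - a ∣                     ≡⟨ *-identityˡ ∣ b - a ∣ ⟩
    ∣ b - a ∣                          ≡⟨ ∣-∣-comm b a ⟩
    ∣ a - b ∣                          ∎
    where
    instance
      a-pos : Positive a
      a-pos = 1≤⇒pos 1≤a
      b-pos : Positive b
      b-pos = 1≤⇒pos 1≤b
      a≢0 : NonZero a
      a≢0 = pos⇒nonZero a
      b≢0 : NonZero b
      b≢0 = pos⇒nonZero b
    a⁻¹ = 1/ a
    b⁻¹ = 1/ b
    instance
      a⁻¹-nonNeg : NonNegative a⁻¹
      a⁻¹-nonNeg = pos⇒nonNeg a⁻¹ {{1/pos⇒pos a}}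
      b⁻¹-nonNeg : NonNegative b⁻¹
      b⁻¹-nonNeg = pos⇒nonNeg b⁻¹ {{1/pos⇒pos b}}
      product-nonNeg : NonNegative (a⁻¹ * b⁻¹)
      product-nonNeg = nonNeg*nonNeg⇒nonNeg a⁻¹ b⁻¹
      abs-nonNeg : NonNegative ∣ b - a ∣
      abs-nonNeg = ∣-∣-nonNeg (b - a)
    open ≤-Reasoning
    a⁻¹≤1 : a⁻¹ ≤ 1ℚ
    a⁻¹≤1 = subst₂ _≤_ (*-identityʳ a⁻¹) (*-inverseˡ a) (*-monoˡ-≤-nonNeg a⁻¹ 1≤a)
    b⁻¹≤1 : b⁻¹ ≤ 1ℚ
    b⁻¹≤1 = subst₂ _≤_ (*-identityʳ b⁻¹) (*-inverseˡ b) (*-monoˡ-≤-nonNeg b⁻¹ 1≤b)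
    product≤1 : a⁻¹ * b⁻¹ ≤ 1ℚ
    product≤1 = ≤-trans (*-monoʳ-≤-nonNeg b⁻¹ a⁻¹≤1)
                        (subst (_≤ 1ℚ) (sym (*-identityˡ b⁻¹)) b⁻¹≤1)
    open +-*-Solver
    expand : ∀ a b r s → (r * s) * (b - a) ≡ r * (b * s) - s * (a * r)
    expand = solve 4 (λ a b r s → (r :* s) :* (b :- a) :=
                                   r :* (b :* s) :- s :* (a :* r)) refl
    difference : a⁻¹ - b⁻¹ ≡ (a⁻¹ * b⁻¹) * (b - a)
    difference = sym (trans (expand a b a⁻¹ b⁻¹)
      (cong₂ _-_ (trans (cong (a⁻¹ *_) (*-inverseʳ b)) (*-identityʳ a⁻¹))
                 (trans (cong (b⁻¹ *_) (*-inverseʳ a)) (*-identityʳ b⁻¹))))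

------------------------------------------------------------------------
-- e = Σ 1/k!

1/_! : ℕ → ℚ
1/ k ! = (+ 1 / (k !)) {{k ℕ.!≢0}}

e-sum : ℕ → ℚ
e-sum zero    = 1/ 0 !
e-sum (suc m) = e-sum m + 1/ suc m !

recip : ∀ k → .{{ℕ.NonZero k}} → ℚ
recip k = + 1 / k

toℚᵘ-recip : ∀ k → ℚᵘ._≃_ (toℚᵘ (recip (suc k))) (ℚᵘ.mkℚᵘ (+ 1) k)
toℚᵘ-recip k = toℚᵘ-fromℚᵘ (ℚᵘ.mkℚᵘ (+ 1) k)

recip-nonNeg : ∀ k → .{{_ : ℕ.NonZero k}} → 0ℚ ≤ recip k
recip-nonNeg k = nonNegative⁻¹ (recip k) {{normalize-nonNeg 1 k}}

recip-double : ∀ a b → .{{_ : ℕ.NonZero a}} → .{{_ : ℕ.NonZero b}} →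
               b ℕ.+ b ℕ.≤ a → recip a + recip a ≤ recip b
recip-double (suc a) (suc b) 2b≤a = toℚᵘ-cancel-≤ (begin
  toℚᵘ (recip (suc a) + recip (suc a))
    ≃⟨ toℚᵘ-homo-+ (recip (suc a)) (recip (suc a)) ⟩
  toℚᵘ (recip (suc a)) ℚᵘ.+ toℚᵘ (recip (suc a))
    ≃⟨ ℚᵘ.+-cong (toℚᵘ-recip a) (toℚᵘ-recip a) ⟩
  ℚᵘ.mkℚᵘ (+ 1) a ℚᵘ.+ ℚᵘ.mkℚᵘ (+ 1) a
    ≤⟨ ℚᵘ.*≤* (subst₂ ℤ._≤_ lhs rhs (ℤ.+≤+ (ℕ.*-monoˡ-≤ (suc a) 2b≤a))) ⟩
  ℚᵘ.mkℚᵘ (+ 1) b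
    ≃⟨ toℚᵘ-recip b ⟨
  toℚᵘ (recip (suc b)) ∎)
  where
  open ℚᵘ.≤-Reasoning
  lhs : + ((suc b ℕ.+ suc b) ℕ.* suc a) ≡
        (+ 1 ℤ.* + suc a ℤ.+ + 1 ℤ.* + suc a) ℤ.* + suc b
  lhs = trans (cong +_ nat) (trans (ℤ.pos-* (suc a ℕ.+ suc a) (suc b))
          (cong (ℤ._* + suc b)
            (sym (cong₂ ℤ._+_ (ℤ.*-identityˡ (+ suc a)) (ℤ.*-identityˡ (+ suc a))))))
    where
    nat : (suc b ℕ.+ suc b) ℕ.* suc a ≡ (suc a ℕ.+ suc a) ℕ.* suc b
    nat = trans (ℕ.*-distribʳ-+ (suc a) (suc b) (suc b))
           (trans (cong₂ ℕ._+_ (ℕ.*-comm (suc b) (suc a)) (ℕ.*-comm (suc b) (suc a)))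
             (sym (ℕ.*-distribʳ-+ (suc b) (suc a) (suc a))))
  rhs : + (suc a ℕ.* suc a) ≡ + 1 ℤ.* + (suc a ℕ.* suc a)
  rhs = sym (ℤ.*-identityˡ (+ (suc a ℕ.* suc a)))

recip-small : ∀ ε → 0ℚ < ε → ∃[ N ] (∀ k → .{{_ : ℕ.NonZero k}} → N ℕ.≤ k → recip k < ε)
recip-small (mkℚ (+ 0)    d c) 0<ε with () ← positive 0<ε
recip-small (mkℚ ℤ.-[1+ a ] d c) 0<ε with () ← positive 0<ε
recip-small (mkℚ +[1+ a ] d c) 0<ε = suc (suc d) , small
  where
  small : ∀ k → .{{_ : ℕ.NonZero k}} → suc (suc d) ℕ.≤ k → recip k < mkℚ +[1+ a ] d c
  small (suc k) d<k = toℚᵘ-cancel-< (ℚᵘ.<-respˡ-≃ (ℚᵘ.≃-sym (toℚᵘ-recip k))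
    (ℚᵘ.*<* (subst (ℤ._< +[1+ a ] ℤ.* + suc k) (sym (ℤ.*-identityˡ (+ suc d)))
      (ℤ.+<+ (ℕ.≤-trans d<k (ℕ.m≤m+n (suc k) (a ℕ.* suc k)))))))

n≤n! : ∀ n → n ℕ.≤ n !
n≤n! zero    = z≤n
n≤n! (suc n) = subst (ℕ._≤ suc n !) (ℕ.*-identityʳ (suc n))
                 (ℕ.*-monoʳ-≤ (suc n) (ℕ.1≤n! n))

e-sum-increases : ∀ m j → e-sum m ≤ e-sum (j ℕ.+ m)
e-sum-increases m zero    = ≤-refl
e-sum-increases m (suc j) = ≤-trans (e-sum-increases m j)
  (subst (_≤ e-sum (suc j ℕ.+ m)) (+-identityʳ _)
    (+-monoʳ-≤ (e-sum (j ℕ.+ m)) (recip-nonNeg (suc (j ℕ.+ m) !) {{suc (j ℕ.+ m) ℕ.!≢0}})))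

e-upper : ℕ → ℚ
e-upper m = e-sum m + 1/ m !

e-upper-decreases : ∀ m j → e-upper (j ℕ.+ suc m) ≤ e-upper (suc m)
e-upper-decreases m zero    = ≤-refl
e-upper-decreases m (suc j) = ≤-trans (step (j ℕ.+ suc m) (ℕ.m≤n⇒m≤o+n j (s≤s z≤n)))
                                      (e-upper-decreases m j)
  where
  step : ∀ k → 1 ℕ.≤ k → e-upper (suc k) ≤ e-upper k
  step k 1≤k = subst (_≤ e-upper k) (sym (+-assoc (e-sum k) (1/ suc k !) (1/ suc k !)))
    (+-monoʳ-≤ (e-sum k) (recip-double (suc k !) (k !) {{suc k ℕ.!≢0}} {{k ℕ.!≢0}}
      (ℕ.+-monoʳ-≤ (k !) (ℕ.≤-trans (ℕ.≤-reflexive (sym (ℕ.*-identityˡ (k !))))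
                            (ℕ.*-monoˡ-≤ (k !) 1≤k)))))

e-sum-gap : ∀ m n → suc m ℕ.≤ n → ∣ e-sum n - e-sum (suc m) ∣ ≤ 1/ suc m !
e-sum-gap m n m<n = subst (λ k → ∣ e-sum k - e-sum (suc m) ∣ ≤ 1/ suc m !)
                      (ℕ.m∸n+n≡m m<n) (gap (n ℕ.∸ suc m))
  where
  open +-*-Solver
  cancel : ∀ a b → (a + b) - a ≡ b
  cancel = solve 2 (λ a b → (a :+ b) :- a := b) refl
  gap : ∀ j → ∣ e-sum (j ℕ.+ suc m) - e-sum (suc m) ∣ ≤ 1/ suc m !
  gap j = subst (_≤ 1/ suc m !) (sym (0≤p⇒∣p∣≡p gap≥0)) (begin
    e-sum (j ℕ.+ suc m) - e-sum (suc m)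
      ≡⟨ cong (_- e-sum (suc m)) (+-identityʳ (e-sum (j ℕ.+ suc m))) ⟨
    (e-sum (j ℕ.+ suc m) + 0ℚ) - e-sum (suc m)
      ≤⟨ +-monoˡ-≤ (- e-sum (suc m)) (+-monoʳ-≤ (e-sum (j ℕ.+ suc m))
           (recip-nonNeg ((j ℕ.+ suc m) !) {{(j ℕ.+ suc m) ℕ.!≢0}})) ⟩
    e-upper (j ℕ.+ suc m) - e-sum (suc m)
      ≤⟨ +-monoˡ-≤ (- e-sum (suc m)) (e-upper-decreases m j) ⟩
    e-upper (suc m) - e-sum (suc m)
      ≡⟨ cancel (e-sum (suc m)) (1/ suc m !) ⟩
    1/ suc m ! ∎)
    where
    open ≤-Reasoning
    gap≥0 : 0ℚ ≤ e-sum (j ℕ.+ suc m) - e-sum (suc m)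
    gap≥0 = subst (_≤ e-sum (j ℕ.+ suc m) - e-sum (suc m)) (+-inverseʳ (e-sum (suc m)))
               (+-monoˡ-≤ (- e-sum (suc m)) (e-sum-increases (suc m) j))

e-sum-cauchy : Cauchy e-sum
e-sum-cauchy ε 0<ε with recip-small ε 0<ε
... | N , small = suc N , close
  where
  ordered : ∀ m n → suc N ℕ.≤ m → m ℕ.≤ n → ∣ e-sum n - e-sum m ∣ < ε
  ordered (suc m) n (s≤s N≤m) m≤n = ≤-<-trans (e-sum-gap m n m≤n)
    (small (suc m !) {{suc m ℕ.!≢0}}
      (ℕ.≤-trans (ℕ.m≤n⇒m≤1+n N≤m) (n≤n! (suc m))))
  close : ∀ m n → suc N ℕ.≤ m → suc N ℕ.≤ n → ∣ e-sum m - e-sum n ∣ < ε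
  close m n m≥ n≥ with ℕ.≤-total m n
  ... | inj₁ m≤n = subst (_< ε) (∣-∣-comm (e-sum n) (e-sum m)) (ordered m n m≥ m≤n)
  ... | inj₂ n≤m = ordered n m n≥ n≤m

e : ℝ
e = mkℝ e-sum e-sum-cauchy

1≤e : ∀ m → 1ℚ ≤ approx e m
1≤e m = subst (λ k → 1ℚ ≤ e-sum k) (ℕ.+-identityʳ m) (e-sum-increases 0 m)

1/e : ℝ
1/e = 1/ᴿ e 1≤e

fromℕℚ : ℕ → ℚ
fromℕℚ n = + n / 1

------------------------------------------------------------------------
-- Uniform probability on a finite set

-- "A uniformly random element of Ω satisfies A with probability at least p."
-- The inequality is witnessed by a set of favourable outcomes, so that A
-- need not be decidable.
record ProbAtLeast {c ℓ a : Level} (Ω : Setoid c ℓ)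
                   (A : Pred (Setoid.Carrier Ω) a) (p : ℚ) : Set (c ⊔ ℓ ⊔ a) where
  field
    size         : ℕ
    {{nonEmpty}} : ℕ.NonZero size
    enumeration  : Inverse (setoid (Fin size)) Ω
    favourable   : Subset size
    sound        : ∀ {i} → i ∈ favourable → A (Inverse.to enumeration i)
    bound        : p ≤ + card favourable / size

------------------------------------------------------------------------
-- Edge orderings of Kₙ

record Edge (n : ℕ) : Set where
  constructor mkEdge
  field
    lower upper : Fin n
    .lower<upper : lower Fin.< upper

-- The edge xy, whichever of x and y is smaller.
edge : ∀ {n} (x y : Fin n) → .(x ≢ y) → Edge n
edge x y x≢y with Fin.<-cmp x y
... | tri< x<y _ _ = mkEdge x y x<y
... | tri≈ _ x≡y _ = ⊥-elim-irr (x≢y x≡y)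
... | tri> _ _ y<x = mkEdge y x y<x

EdgeOrdering : ℕ → Set
EdgeOrdering n = Edge n ↔ Fin (n C 2)

-- Labels are 1, …, n C 2.
label : ∀ {n} → EdgeOrdering n → Edge n → ℕ
label f xy = suc (toℕ (Inverse.to f xy))

-- Orderings are identified when they label every edge alike; without function
-- extensionality this is coarser than propositional equality.
edgeOrderings : ℕ → Setoid 0ℓ 0ℓ
edgeOrderings n = On.setoid {B = EdgeOrdering n} (Edge n →-setoid Fin (n C 2)) Inverse.to

------------------------------------------------------------------------
-- Greedy increasing paths

inject₁≢suc : ∀ {n} (i : Fin n) → inject₁ i ≢ suc i
inject₁≢suc i eq = ℕ.1+n≢n (sym (trans (sym (Fin.toℕ-inject₁ i)) (cong toℕ eq)))

-- A path v₀ v₁ … vₜ in Kₙ, of length t.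
record Path (n t : ℕ) : Set where
  field
    vertex   : Fin (suc t) → Fin n
    distinct : Injective _≡_ _≡_ vertex

  -- The edge vᵢ vᵢ₊₁.
  step : Fin t → Edge n
  step i = edge (vertex (inject₁ i)) (vertex (suc i)) (λ eq → inject₁≢suc i (distinct eq))

-- The greedy f-increasing path from v₀. Labels being distinct, there is at most
-- one, and v₀ v₁ exists only if n ≥ 2. Its length t ≥ 1 is suc t-1.
record GreedyPath {n} (f : EdgeOrdering n) (v₀ : Fin n) : Set where
  field
    t-1  : ℕ
    path : Path n (suc t-1)

  open Path path public

  field
    start : vertex zero ≡ v₀

    first-lowest : ∀ x → .(v₀≢x : v₀ ≢ x) → label f (step zero) ℕ.≤ label f (edge v₀ x v₀≢x)

    -- With i counted from 0, step (inject₁ i) enters the vertex vᵢ₊₁ and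
    -- step (suc i) leaves it.
    increasing : ∀ i → label f (step (inject₁ i)) ℕ.< label f (step (suc i))

    next-lowest : ∀ (i : Fin t-1) x →
      let k = suc (inject₁ i) in
      (x∉ : ∀ j → j Fin.≤ k → vertex j ≢ x) →
      let xy = edge (vertex k) x (x∉ k ℕ.≤-refl) in
      label f (step (inject₁ i)) ℕ.< label f xy → label f (step (suc i)) ℕ.≤ label f xy

    stuck : ∀ x → (x∉ : ∀ j → vertex j ≢ x) →
      let last = fromℕ (suc t-1) in
      label f (edge (vertex last) x (x∉ last)) ℕ.< label f (step (fromℕ t-1))

  length : ℕ
  length = suc t-1

module Submission where

-- A fresh vertex of the path sees fresh labels. Give the edges independent labels below L
-- instead of distinct ones; then the wait between two steps, measured cyclically, is the
-- minimum of a row of independent uniform distances, and reading the labels row by row as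
-- the path is explored is an injective encoding of labellings by arrays with independent
-- rows. An ordering of the M edges lifts to a labelling along each of the L choose M
-- increasing maps, and (L choose M) M! is at least half of L^M, so it suffices to bound
-- the number of bad arrays. The path has at least k edges iff the first k waits add up to
-- at most L. Their sum has mean about L (1/n + … + 1/(n-k+1)) and standard deviation
-- O (L / √n), so by Chebyshev's inequality the length is near n - a, where a is such that
-- 1/(a+1) + … + 1/n crosses 1. Comparing the products of 1 + 1/j and of (1 - 1/j)⁻¹ with
-- the exponential series gives |a - n/e| = O (1).

-- In a uniform ordering labels are drawn without replacement, so what the path meets next depends
-- on what it has met, and the number of vertices it explores is random. Conditioning is avoided
-- altogether: probabilities become counts, and since only the number of bad objects has to be
-- bounded from above, an injection into arrays is enough. Cyclic distances make each row an image
-- of the labels under a rotation, injective at every time and also on labels that have become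
-- unusable. Such a label merely produces a wait running past `L`, and that is how the end of the
-- path is recognised. Reading continues after the end, because the array must determine the whole
-- labelling. `L` exceeds both 2 M² and 2 n²: the first makes repeated labels cost only a factor 2,
-- the second makes the rounding in the mean waits negligible. As e enters only through its partial
-- sums, every estimate stays in ℕ or ℚ and holds for all late approximants at once.

open import Defs

-- Natural numbers and unit fractions inside ℚ.

module Rationals where

  open import Data.Integer as ℤ using (+_)
  import Data.Integer.Properties as ℤ
  open import Data.Nat as ℕ using (ℕ; suc; z≤n; s≤s)
  import Data.Nat.Properties as ℕ
  open import Data.Rational
  open import Data.Rational.Properties
  import Data.Rational.Unnormalised as ℚᵘ
  import Data.Rational.Unnormalised.Properties as ℚᵘ
  open import Data.Sum using (inj₁; inj₂)
  open import Relation.Binary.PropositionalEquality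
  open import Data.Rational.Solver using (module +-*-Solver)

  opaque
    -- Opaque, so that unification does not look inside the normalised fractions.
    ι : ℕ → ℚ
    ι = fromℕℚ

    -- inv k is 1/(k+1).
    inv : ℕ → ℚ
    inv k = recip (suc k)

    fromℕℚ≡ι : ∀ n → fromℕℚ n ≡ ι n
    fromℕℚ≡ι n = refl

    recip≡inv : ∀ k → recip (suc k) ≡ inv k
    recip≡inv k = refl

    0≡ι0 : 0ℚ ≡ ι 0
    0≡ι0 = refl

    1≡ι1 : 1ℚ ≡ ι 1
    1≡ι1 = refl

    toℚᵘ-ι : ∀ n → toℚᵘ (ι n) ℚᵘ.≃ ℚᵘ.mkℚᵘ (+ n) 0
    toℚᵘ-ι n = toℚᵘ-fromℚᵘ (ℚᵘ.mkℚᵘ (+ n) 0)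

    toℚᵘ-inv : ∀ k → toℚᵘ (inv k) ℚᵘ.≃ ℚᵘ.mkℚᵘ (+ 1) k
    toℚᵘ-inv k = toℚᵘ-recip k

  ι-+ : ∀ m n → ι (m ℕ.+ n) ≡ ι m + ι n
  ι-+ m n = toℚᵘ-injective (begin
    toℚᵘ (ι (m ℕ.+ n))                     ≈⟨ toℚᵘ-ι (m ℕ.+ n) ⟩
    ℚᵘ.mkℚᵘ (+ (m ℕ.+ n)) 0                ≈⟨ ℚᵘ.*≡* (cong (ℤ._* + 1) (cong₂ ℤ._+_
                                                (sym (ℤ.*-identityʳ (+ m))) (sym (ℤ.*-identityʳ (+ n))))) ⟩
    ℚᵘ.mkℚᵘ (+ m) 0 ℚᵘ.+ ℚᵘ.mkℚᵘ (+ n) 0   ≈⟨ ℚᵘ.+-cong (toℚᵘ-ι m) (toℚᵘ-ι n) ⟨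
    toℚᵘ (ι m) ℚᵘ.+ toℚᵘ (ι n)             ≈⟨ toℚᵘ-homo-+ (ι m) (ι n) ⟨
    toℚᵘ (ι m + ι n)                        ∎)
    where open ℚᵘ.≃-Reasoning

  ι-* : ∀ m n → ι (m ℕ.* n) ≡ ι m * ι n
  ι-* m n = toℚᵘ-injective (begin
    toℚᵘ (ι (m ℕ.* n))                     ≈⟨ toℚᵘ-ι (m ℕ.* n) ⟩
    ℚᵘ.mkℚᵘ (+ (m ℕ.* n)) 0                ≈⟨ ℚᵘ.*≡* (cong (ℤ._* + 1) (ℤ.pos-* m n)) ⟩
    ℚᵘ.mkℚᵘ (+ m) 0 ℚᵘ.* ℚᵘ.mkℚᵘ (+ n) 0   ≈⟨ ℚᵘ.*-cong (toℚᵘ-ι m) (toℚᵘ-ι n) ⟨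
    toℚᵘ (ι m) ℚᵘ.* toℚᵘ (ι n)             ≈⟨ toℚᵘ-homo-* (ι m) (ι n) ⟨
    toℚᵘ (ι m * ι n)                        ∎)
    where open ℚᵘ.≃-Reasoning

  ι-suc : ∀ n → ι (suc n) ≡ 1ℚ + ι n
  ι-suc n = trans (ι-+ 1 n) (cong (_+ ι n) (sym 1≡ι1))

  ι-mono-≤ : ∀ {m n} → m ℕ.≤ n → ι m ≤ ι n
  ι-mono-≤ {m} {n} m≤n = toℚᵘ-cancel-≤ (begin
    toℚᵘ (ι m)        ≃⟨ toℚᵘ-ι m ⟩
    ℚᵘ.mkℚᵘ (+ m) 0   ≤⟨ ℚᵘ.*≤* (ℤ.*-monoʳ-≤-nonNeg (+ 1) (ℤ.+≤+ m≤n)) ⟩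
    ℚᵘ.mkℚᵘ (+ n) 0   ≃⟨ toℚᵘ-ι n ⟨
    toℚᵘ (ι n)        ∎)
    where open ℚᵘ.≤-Reasoning

  ι-cancel-≤ : ∀ {m n} → ι m ≤ ι n → m ℕ.≤ n
  ι-cancel-≤ {m} {n} p = ℤ.drop‿+≤+ (subst₂ ℤ._≤_ (ℤ.*-identityʳ (+ m)) (ℤ.*-identityʳ (+ n))
    (ℚᵘ.drop-*≤* (ℚᵘ.≤-respˡ-≃ (toℚᵘ-ι m) (ℚᵘ.≤-respʳ-≃ (toℚᵘ-ι n) (toℚᵘ-mono-≤ p)))))

  0≤ι : ∀ n → 0ℚ ≤ ι n
  0≤ι n = subst (_≤ ι n) (sym 0≡ι0) (ι-mono-≤ z≤n)

  inv-* : ∀ k → inv k * ι (suc k) ≡ 1ℚ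
  inv-* k = toℚᵘ-injective (begin
    toℚᵘ (inv k * ι (suc k))                    ≈⟨ toℚᵘ-homo-* (inv k) (ι (suc k)) ⟩
    toℚᵘ (inv k) ℚᵘ.* toℚᵘ (ι (suc k))          ≈⟨ ℚᵘ.*-cong (toℚᵘ-inv k) (toℚᵘ-ι (suc k)) ⟩
    ℚᵘ.mkℚᵘ (+ 1) k ℚᵘ.* ℚᵘ.mkℚᵘ (+ suc k) 0    ≈⟨ ℚᵘ.*≡* (ℤ.*-assoc (+ 1) (+ suc k) (+ 1)) ⟩
    ℚᵘ.1ℚᵘ                                       ∎)
    where open ℚᵘ.≃-Reasoning

  0≤inv : ∀ k → 0ℚ ≤ inv k
  0≤inv k = subst (0ℚ ≤_) (recip≡inv k) (recip-nonNeg (suc k))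

  0≤-+ : ∀ {p q} → 0ℚ ≤ p → 0ℚ ≤ q → 0ℚ ≤ p + q
  0≤-+ = +-mono-≤

  0≤-* : ∀ {p q} → 0ℚ ≤ p → 0ℚ ≤ q → 0ℚ ≤ p * q
  0≤-* {p} {q} 0≤p 0≤q = nonNegative⁻¹ (p * q)
      {{nonNeg*nonNeg⇒nonNeg p {{nonNegative 0≤p}} q {{nonNegative 0≤q}}}}

  0≤-square : ∀ p → 0ℚ ≤ p * p
  0≤-square p with ≤-total 0ℚ p
  ... | inj₁ 0≤p = 0≤-* 0≤p 0≤p
  ... | inj₂ p≤0 = subst (0ℚ ≤_) (solve 1 (λ p → (:- p) :* (:- p) := p :* p) refl p)
                     (0≤-* (neg-antimono-≤ p≤0) (neg-antimono-≤ p≤0))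
    where open +-*-Solver

  -- Reduces an inequality to exhibiting the difference as a manifestly
  -- nonnegative expression, up to a ring identity.
  ≤-from-gap : ∀ {p q r} → 0ℚ ≤ r → q ≡ p + r → p ≤ q
  ≤-from-gap {p} {q} {r} 0≤r eq = subst₂ _≤_ (+-identityʳ p) (sym eq) (+-monoʳ-≤ p 0≤r)

  *-mono-≤-nonNeg : ∀ {p q r s} → 0ℚ ≤ p → 0ℚ ≤ s → p ≤ q → r ≤ s → p * r ≤ q * s
  *-mono-≤-nonNeg {p} {q} {r} {s} 0≤p 0≤s p≤q r≤s = ≤-trans
    (*-monoˡ-≤-nonNeg p {{nonNegative 0≤p}} r≤s) (*-monoʳ-≤-nonNeg s {{nonNegative 0≤s}} p≤q)

  *-monoˡ-≤ : ∀ {p q} r → 0ℚ ≤ r → p ≤ q → r * p ≤ r * q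
  *-monoˡ-≤ r 0≤r p≤q = *-monoˡ-≤-nonNeg r {{nonNegative 0≤r}} p≤q

  *-monoʳ-≤ : ∀ {p q} r → 0ℚ ≤ r → p ≤ q → p * r ≤ q * r
  *-monoʳ-≤ r 0≤r p≤q = *-monoʳ-≤-nonNeg r {{nonNegative 0≤r}} p≤q

  ι-pos : ∀ k → Positive (ι (suc k))
  ι-pos k = positive (<-≤-trans (positive⁻¹ 1ℚ) (subst (_≤ ι (suc k)) (sym 1≡ι1) (ι-mono-≤ (s≤s z≤n))))

  inv-antimono : ∀ {j k} → j ℕ.≤ k → inv k ≤ inv j
  inv-antimono {j} {k} j≤k = *-cancelʳ-≤-pos (ι (suc k)) {{ι-pos k}} (begin
    inv k * ι (suc k)   ≡⟨ inv-* k ⟩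
    1ℚ                  ≡⟨ inv-* j ⟨
    inv j * ι (suc j)   ≤⟨ *-monoˡ-≤ (inv j) (0≤inv j) (ι-mono-≤ (s≤s j≤k)) ⟩
    inv j * ι (suc k)   ∎)
    where open ≤-Reasoning

-- Harmonic sums compared with the partial sums of the exponential series.

module HarmonicSums where

  open Rationals
  open import Data.Nat as ℕ using (ℕ; zero; suc; s≤s; _!)
  import Data.Nat.Properties as ℕ
  open import Data.Product using (∃-syntax; _,_; _×_)
  open import Data.Rational
  open import Data.Rational.Properties
  open import Relation.Nullary using (yes; no)
  open import Relation.Binary.PropositionalEquality
  open import Data.Rational.Solver using (module +-*-Solver)
  open +-*-Solver using (solve; _:+_; _:*_; _:-_; _:=_; con)

  -- σ a d is 1/(a+1) + … + 1/(a+d).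
  σ : ℕ → ℕ → ℚ
  σ a zero    = 0ℚ
  σ a (suc d) = inv (d ℕ.+ a) + σ a d

  0≤σ : ∀ a d → 0ℚ ≤ σ a d
  0≤σ a zero    = ≤-refl
  0≤σ a (suc d) = 0≤-+ (0≤inv (d ℕ.+ a)) (0≤σ a d)

  σ-split : ∀ a d c → σ a (c ℕ.+ d) ≡ σ (d ℕ.+ a) c + σ a d
  σ-split a d zero    = sym (+-identityˡ (σ a d))
  σ-split a d (suc c) = trans
    (cong₂ _+_ (cong inv (ℕ.+-assoc c d a)) (σ-split a d c))
    (sym (+-assoc (inv (c ℕ.+ (d ℕ.+ a))) (σ (d ℕ.+ a) c) (σ a d)))

  σ-lower : ∀ a d n → d ℕ.+ a ℕ.≤ suc n → ι d * inv n ≤ σ a d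
  σ-lower a zero    n _ = ≤-reflexive (trans (cong (_* inv n) (sym 0≡ι0)) (*-zeroˡ (inv n)))
  σ-lower a (suc d) n (s≤s d+a≤n) = begin
    ι (suc d) * inv n           ≡⟨ cong (_* inv n) (ι-suc d) ⟩
    (1ℚ + ι d) * inv n          ≡⟨ solve 2 (λ x y → (con 1ℚ :+ x) :* y := y :+ x :* y) refl (ι d) (inv n) ⟩
    inv n + ι d * inv n         ≤⟨ +-mono-≤ (inv-antimono d+a≤n) (σ-lower a d n (ℕ.m≤n⇒m≤1+n d+a≤n)) ⟩
    inv (d ℕ.+ a) + σ a d       ∎
    where open ≤-Reasoning

  σ-bottom : ∀ d → 1ℚ ≤ σ 0 (suc d)
  σ-bottom d = begin
    1ℚ                                ≡⟨ solve 2 (λ x y → x := con 0ℚ :+ (x :+ con 0ℚ)) refl 1ℚ 1ℚ ⟩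
    0ℚ + (1ℚ + 0ℚ)                    ≤⟨ +-mono-≤ (0≤σ 1 d) (≤-reflexive (cong (_+ 0ℚ) 1≡inv0)) ⟩
    σ 1 d + σ 0 1                     ≡⟨ σ-split 0 1 d ⟨
    σ 0 (d ℕ.+ 1)                     ≡⟨ cong (σ 0) (ℕ.+-comm d 1) ⟩
    σ 0 (suc d)                       ∎
    where
    open ≤-Reasoning
    1≡inv0 : 1ℚ ≡ inv 0
    1≡inv0 = trans (sym (inv-* 0)) (trans (cong (inv 0 *_) (sym 1≡ι1)) (*-identityʳ (inv 0)))

  -- Terms are added at the lower end until the sum reaches 1, at the latest with the term 1/1 by
  -- `σ-bottom`. The upper end stays fixed because `d + suc a` is invariant.
  crossing : ∀ a d → σ (suc a) d < 1ℚ →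
    ∃[ a′ ] ∃[ d′ ] (d′ ℕ.+ suc a′ ≡ d ℕ.+ suc a × σ (suc a′) d′ < 1ℚ × 1ℚ ≤ σ a′ (suc d′))
  crossing a d below with 1ℚ ≤? σ a (suc d)
  ... | yes above = a , d , refl , below , above
  crossing zero    d below | no ¬above with () ← ¬above (σ-bottom d)
  crossing (suc a) d below | no ¬above with crossing a (suc d) (≰⇒> ¬above)
  ... | a′ , d′ , eq , rest = a′ , d′ , trans eq (sym (ℕ.+-suc d (suc a))) , rest

  harmonic-crossing : ∀ n →
    ∃[ a ] ∃[ d ] (d ℕ.+ suc a ≡ suc n × σ (suc a) d < 1ℚ × 1ℚ ≤ σ a (suc d))
  harmonic-crossing n = crossing n 0 (positive⁻¹ 1ℚ)

  -- term k s is sᵏ/k!.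
  term : ℕ → ℚ → ℚ
  term zero    s = 1ℚ
  term (suc k) s = inv k * (s * term k s)

  exp-sum : ℕ → ℚ → ℚ
  exp-sum zero    s = 1ℚ
  exp-sum (suc m) s = exp-sum m s + term (suc m) s

  0≤term : ∀ k {s} → 0ℚ ≤ s → 0ℚ ≤ term k s
  0≤term zero    0≤s = nonNegative⁻¹ 1ℚ
  0≤term (suc k) 0≤s = 0≤-* (0≤inv k) (0≤-* 0≤s (0≤term k 0≤s))

  0≤exp-sum : ∀ m {s} → 0ℚ ≤ s → 0ℚ ≤ exp-sum m s
  0≤exp-sum zero    0≤s = nonNegative⁻¹ 1ℚ
  0≤exp-sum (suc m) 0≤s = 0≤-+ (0≤exp-sum m 0≤s) (0≤term (suc m) 0≤s)

  term-mono : ∀ k {s t} → 0ℚ ≤ s → s ≤ t → term k s ≤ term k t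
  term-mono zero    0≤s s≤t = ≤-refl
  term-mono (suc k) 0≤s s≤t = *-monoˡ-≤ (inv k) (0≤inv k)
    (*-mono-≤-nonNeg 0≤s (0≤term k (≤-trans 0≤s s≤t)) s≤t (term-mono k 0≤s s≤t))

  exp-sum-mono : ∀ m {s t} → 0ℚ ≤ s → s ≤ t → exp-sum m s ≤ exp-sum m t
  exp-sum-mono zero    0≤s s≤t = ≤-refl
  exp-sum-mono (suc m) 0≤s s≤t = +-mono-≤ (exp-sum-mono m 0≤s s≤t) (term-mono (suc m) 0≤s s≤t)

  term-suc : ∀ k s → s * term k s ≡ ι (suc k) * term (suc k) s
  term-suc k s = sym (trans
    (solve 3 (λ i v x → i :* (v :* x) := (v :* i) :* x) refl (ι (suc k)) (inv k) (s * term k s))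
    (trans (cong (_* (s * term k s)) (inv-* k)) (*-identityˡ (s * term k s))))

  module _ {s y : ℚ} (0≤s : 0ℚ ≤ s) (0≤y : 0ℚ ≤ y) where

    private
      t = y + s

      0≤t : 0ℚ ≤ t
      0≤t = 0≤-+ 0≤y 0≤s

      s≤t : s ≤ t
      s≤t = ≤-from-gap 0≤y (+-comm y s)


      regroup : ∀ k x z → inv (suc k) * (x + (1ℚ + ι (suc k)) * (y * z)) ≡ inv (suc k) * x + y * z
      regroup k x z = begin
        inv (suc k) * (x + (1ℚ + ι (suc k)) * (y * z))
          ≡⟨ cong (λ w → inv (suc k) * (x + w * (y * z))) (ι-suc (suc k)) ⟨
        inv (suc k) * (x + ι (suc (suc k)) * (y * z))
          ≡⟨ solve 4 (λ v x i y → v :* (x :+ i :* y) := v :* x :+ (v :* i) :* y) refl (inv (suc k)) x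
              (ι (suc (suc k))) (y * z) ⟩
        inv (suc k) * x + (inv (suc k) * ι (suc (suc k))) * (y * z)
          ≡⟨ cong (λ w → inv (suc k) * x + w * (y * z)) (inv-* (suc k)) ⟩
        inv (suc k) * x + 1ℚ * (y * z)
          ≡⟨ cong (inv (suc k) * x +_) (*-identityˡ (y * z)) ⟩
        inv (suc k) * x + y * z ∎
        where open ≡-Reasoning

    -- The derivative of sᵏ⁺¹/(k+1)! is sᵏ/k!, which is monotone for nonnegative s. This and
    -- `term-increment-≤` are the mean value bounds with the slope taken at the two ends of [s, t].
    term-increment-≥ : ∀ k → term (suc k) s + y * term k s ≤ term (suc k) t
    term-increment-≥ zero = ≤-reflexive (begin
      inv 0 * (s * 1ℚ) + y * 1ℚ            ≡⟨ cong (λ z → inv 0 * (s * 1ℚ) + y * z)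
          (trans (sym (inv-* 0)) (cong (inv 0 *_) (sym 1≡ι1))) ⟩
      inv 0 * (s * 1ℚ) + y * (inv 0 * 1ℚ)  ≡⟨ solve 3
          (λ v s y → v :* (s :* con 1ℚ) :+ y :* (v :* con 1ℚ) := v :* ((y :+ s) :* con 1ℚ)) refl (inv 0) s y ⟩
      inv 0 * (t * 1ℚ)                     ∎)
      where open ≡-Reasoning
    term-increment-≥ (suc k) = begin
      inv (suc k) * (s * term (suc k) s) + y * term (suc k) s
        ≡⟨ regroup k (s * term (suc k) s) (term (suc k) s) ⟨
      inv (suc k) * (s * term (suc k) s + (1ℚ + ι (suc k)) * (y * term (suc k) s))
        ≡⟨ cong (inv (suc k) *_) (solve 4 (λ s y u i → s :* u :+ (con 1ℚ :+ i) :* (y :* u)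
            := (y :+ s) :* u :+ y :* (i :* u)) refl
             s y (term (suc k) s) (ι (suc k))) ⟩
      inv (suc k) * (t * term (suc k) s + y * (ι (suc k) * term (suc k) s))
        ≡⟨ cong (λ z → inv (suc k) * (t * term (suc k) s + y * z)) (term-suc k s) ⟨
      inv (suc k) * (t * term (suc k) s + y * (s * term k s))
        ≤⟨ *-monoˡ-≤ (inv (suc k)) (0≤inv (suc k)) (≤-from-gap (0≤-* (0≤-* 0≤y 0≤y) (0≤term k 0≤s))
             (solve 4 (λ s y u w → (y :+ s) :* (u :+ y :* w)
                 := ((y :+ s) :* u :+ y :* (s :* w)) :+ y :* y :* w) refl
               s y (term (suc k) s) (term k s))) ⟩
      inv (suc k) * (t * (term (suc k) s + y * term k s))
        ≤⟨ *-monoˡ-≤ (inv (suc k)) (0≤inv (suc k)) (*-monoˡ-≤ t 0≤t (term-increment-≥ k)) ⟩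
      inv (suc k) * (t * term (suc k) t) ∎
      where open ≤-Reasoning

    term-increment-≤ : ∀ k → term (suc k) t ≤ term (suc k) s + y * term k t
    term-increment-≤ zero = ≤-reflexive (begin
      inv 0 * (t * 1ℚ)                     ≡⟨ solve 3
          (λ v s y → v :* (s :* con 1ℚ) :+ y :* (v :* con 1ℚ) := v :* ((y :+ s) :* con 1ℚ)) refl (inv 0) s y ⟨
      inv 0 * (s * 1ℚ) + y * (inv 0 * 1ℚ)  ≡⟨ cong (λ z → inv 0 * (s * 1ℚ) + y * z)
          (trans (sym (inv-* 0)) (cong (inv 0 *_) (sym 1≡ι1))) ⟨
      inv 0 * (s * 1ℚ) + y * 1ℚ            ∎)
      where open ≡-Reasoning
    term-increment-≤ (suc k) = begin
      inv (suc k) * (t * term (suc k) t)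
        ≡⟨ cong (inv (suc k) *_) (solve 3 (λ s y u → (y :+ s) :* u := s :* u :+ y :* u) refl s y
            (term (suc k) t)) ⟩
      inv (suc k) * (s * term (suc k) t + y * term (suc k) t)
        ≤⟨ *-monoˡ-≤ (inv (suc k)) (0≤inv (suc k)) (+-monoˡ-≤ (y * term (suc k) t) (begin
             s * term (suc k) t
               ≤⟨ *-monoˡ-≤ s 0≤s (term-increment-≤ k) ⟩
             s * (term (suc k) s + y * term k t)
               ≡⟨ solve 4 (λ s y u w → s :* (u :+ y :* w) := s :* u :+ y :* (s :* w)) refl s y (term (suc k) s)
                   (term k t) ⟩
             s * term (suc k) s + y * (s * term k t)
               ≤⟨ +-monoʳ-≤ (s * term (suc k) s) (*-monoˡ-≤ y 0≤y (*-monoʳ-≤ (term k t) (0≤term k 0≤t) s≤t)) ⟩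
             s * term (suc k) s + y * (t * term k t)
               ≡⟨ cong (λ z → s * term (suc k) s + y * z) (term-suc k t) ⟩
             s * term (suc k) s + y * (ι (suc k) * term (suc k) t) ∎)) ⟩
      inv (suc k) * (s * term (suc k) s + y * (ι (suc k) * term (suc k) t) + y * term (suc k) t)
        ≡⟨ cong (inv (suc k) *_) (solve 4 (λ x y i u → x :+ y :* (i :* u) :+ y :* u
            := x :+ (con 1ℚ :+ i) :* (y :* u)) refl
             (s * term (suc k) s) y (ι (suc k)) (term (suc k) t)) ⟩
      inv (suc k) * (s * term (suc k) s + (1ℚ + ι (suc k)) * (y * term (suc k) t))
        ≡⟨ regroup k (s * term (suc k) s) (term (suc k) t) ⟩
      inv (suc k) * (s * term (suc k) s) + y * term (suc k) t ∎
      where open ≤-Reasoning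

    -- The growth of the term of degree k + 1 pays for y times the term of degree k, so the
    -- truncation degree rises by one with each factor 1 + y.
    exp-sum-increment-≥ : ∀ m → (1ℚ + y) * exp-sum m s ≤ exp-sum (suc m) t
    exp-sum-increment-≥ m = begin
      (1ℚ + y) * exp-sum m s                     ≤⟨ ≤-from-gap (0≤term (suc m) 0≤s)
        (solve 3 (λ y p u → p :+ u :+ y :* p := (con 1ℚ :+ y) :* p :+ u) refl y (exp-sum m s)
            (term (suc m) s)) ⟩
      exp-sum (suc m) s + y * exp-sum m s        ≤⟨ go m ⟩
      exp-sum (suc m) t                          ∎
      where
      open ≤-Reasoning
      go : ∀ m → exp-sum (suc m) s + y * exp-sum m s ≤ exp-sum (suc m) t
      go zero    = ≤-trans (≤-reflexive (+-assoc 1ℚ (term 1 s) (y * 1ℚ))) (+-monoʳ-≤ 1ℚ (term-increment-≥ 0))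
      go (suc m) = begin
        (exp-sum (suc m) s + term (suc (suc m)) s) + y * (exp-sum m s + term (suc m) s)
          ≡⟨ solve 5 (λ p u y q v → (p :+ u) :+ y :* (q :+ v) := (p :+ y :* q) :+ (u :+ y :* v)) refl
               (exp-sum (suc m) s) (term (suc (suc m)) s) y (exp-sum m s) (term (suc m) s) ⟩
        (exp-sum (suc m) s + y * exp-sum m s) + (term (suc (suc m)) s + y * term (suc m) s)
          ≤⟨ +-mono-≤ (go m) (term-increment-≥ (suc m)) ⟩
        exp-sum (suc (suc m)) t ∎

    -- This is (1 - y) exp t ≤ exp s with the subtraction moved across. The degree does not change
    -- here, so `exp-sum-≤-product` can hold for every truncation.
    exp-sum-increment-≤ : ∀ m → exp-sum m t ≤ exp-sum m s + y * exp-sum m t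
    exp-sum-increment-≤ zero    = ≤-from-gap 0≤y (cong (1ℚ +_) (*-identityʳ y))
    exp-sum-increment-≤ (suc m) = ≤-trans (go m) (+-monoʳ-≤ (exp-sum (suc m) s) (*-monoˡ-≤ y 0≤y
      (≤-from-gap (0≤term (suc m) 0≤t) refl)))
      where
      open ≤-Reasoning
      go : ∀ m → exp-sum (suc m) t ≤ exp-sum (suc m) s + y * exp-sum m t
      go zero    = ≤-trans (+-monoʳ-≤ 1ℚ (term-increment-≤ 0))
          (≤-reflexive (sym (+-assoc 1ℚ (term 1 s) (y * 1ℚ))))
      go (suc m) = begin
        exp-sum (suc (suc m)) t
          ≤⟨ +-mono-≤ (go m) (term-increment-≤ (suc m)) ⟩
        (exp-sum (suc m) s + y * exp-sum m t) + (term (suc (suc m)) s + y * term (suc m) t)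
          ≡⟨ solve 5 (λ p u y q v → (p :+ u) :+ y :* (q :+ v) := (p :+ y :* q) :+ (u :+ y :* v)) refl
               (exp-sum (suc m) s) (term (suc (suc m)) s) y (exp-sum m t) (term (suc m) t) ⟨
        (exp-sum (suc m) s + term (suc (suc m)) s) + y * (exp-sum m t + term (suc m) t) ∎

  recip-* : ∀ k → .{{_ : ℕ.NonZero k}} → recip k * ι k ≡ 1ℚ
  recip-* (suc k) = trans (cong (_* ι (suc k)) (recip≡inv k)) (inv-* k)

  inverse-unique : ∀ {p q r} → p * r ≡ 1ℚ → q * r ≡ 1ℚ → p ≡ q
  inverse-unique {p} {q} {r} pr≡1 qr≡1 = begin
    p            ≡⟨ *-identityʳ p ⟨
    p * 1ℚ       ≡⟨ cong (p *_) qr≡1 ⟨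
    p * (q * r)  ≡⟨ solve 3 (λ p q r → p :* (q :* r) := q :* (p :* r)) refl p q r ⟩
    q * (p * r)  ≡⟨ cong (q *_) pr≡1 ⟩
    q * 1ℚ       ≡⟨ *-identityʳ q ⟩
    q            ∎
    where open ≡-Reasoning

  term-1-! : ∀ k → term k 1ℚ * ι (k !) ≡ 1ℚ
  term-1-! zero    = trans (cong (1ℚ *_) (sym 1≡ι1)) refl
  term-1-! (suc k) = begin
    inv k * (1ℚ * term k 1ℚ) * ι (suc k ℕ.* k !)
        ≡⟨ cong (inv k * (1ℚ * term k 1ℚ) *_) (ι-* (suc k) (k !)) ⟩
    inv k * (1ℚ * term k 1ℚ) * (ι (suc k) * ι (k !))
        ≡⟨ solve 4 (λ v u i j → v :* (con 1ℚ :* u) :* (i :* j) := (v :* i) :* (u :* j)) refl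
                                                           (inv k) (term k 1ℚ) (ι (suc k)) (ι (k !)) ⟩
    (inv k * ι (suc k)) * (term k 1ℚ * ι (k !))        ≡⟨ cong₂ _*_ (inv-* k) (term-1-! k) ⟩
    1ℚ * 1ℚ                                             ≡⟨⟩
    1ℚ                                                  ∎
    where open ≡-Reasoning

  term-1 : ∀ k → term k 1ℚ ≡ 1/ k !
  term-1 k = inverse-unique (term-1-! k) (recip-* (k !) {{k ℕ.!≢0}})

  exp-sum-1 : ∀ m → exp-sum m 1ℚ ≡ e-sum m
  exp-sum-1 zero    = term-1 0
  exp-sum-1 (suc m) = cong₂ _+_ (exp-sum-1 m) (term-1 (suc m))

  -- (d + a + 1)/(a + 1) = ∏ (1 + 1/j) ≤ exp (Σ 1/j), the sum being over a < j ≤ d + a.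
  product-≤-exp-sum : ∀ a d → ι (d ℕ.+ suc a) ≤ ι (suc a) * exp-sum d (σ a d)
  product-≤-exp-sum a zero    = ≤-reflexive (sym (*-identityʳ (ι (suc a))))
  product-≤-exp-sum a (suc d) = begin
    ι (suc d ℕ.+ suc a)                               ≡⟨ ι-suc (d ℕ.+ suc a) ⟩
    1ℚ + ι (d ℕ.+ suc a)                              ≡⟨ cong₂ (λ u w → u + w) (sym (inv-* (d ℕ.+ a))) refl ⟩
    inv (d ℕ.+ a) * ι (suc (d ℕ.+ a)) + ι (d ℕ.+ suc a)
        ≡⟨ cong (λ k → inv (d ℕ.+ a) * ι k + ι (d ℕ.+ suc a)) (ℕ.+-suc d a) ⟨
    y * ι (d ℕ.+ suc a) + ι (d ℕ.+ suc a)
        ≡⟨ solve 2 (λ y x → y :* x :+ x := (con 1ℚ :+ y) :* x) refl y (ι (d ℕ.+ suc a)) ⟩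
    (1ℚ + y) * ι (d ℕ.+ suc a)
        ≤⟨ *-monoˡ-≤ (1ℚ + y) (0≤-+ (nonNegative⁻¹ 1ℚ) (0≤inv (d ℕ.+ a))) (product-≤-exp-sum a d) ⟩
    (1ℚ + y) * (ι (suc a) * exp-sum d (σ a d))
        ≡⟨ solve 3 (λ y i p → (con 1ℚ :+ y) :* (i :* p) := i :* ((con 1ℚ :+ y) :* p)) refl y (ι (suc a))
        (exp-sum d (σ a d)) ⟩
    ι (suc a) * ((1ℚ + y) * exp-sum d (σ a d))
        ≤⟨ *-monoˡ-≤ (ι (suc a)) (0≤ι (suc a)) (exp-sum-increment-≥ (0≤σ a d) (0≤inv (d ℕ.+ a)) d) ⟩
    ι (suc a) * exp-sum (suc d) (σ a (suc d))         ∎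
    where
    open ≤-Reasoning
    y = inv (d ℕ.+ a)

  exp-sum-0 : ∀ m → exp-sum m 0ℚ ≡ 1ℚ
  exp-sum-0 zero    = refl
  exp-sum-0 (suc m) = trans (cong₂ _+_ (exp-sum-0 m)
      (trans (cong (inv m *_) (*-zeroˡ (term m 0ℚ))) (*-zeroʳ (inv m)))) refl

  -- exp (Σ 1/j) ≤ ∏ (1 - 1/j)⁻¹ = (d + a)/a, again over a < j ≤ d + a.
  exp-sum-≤-product : ∀ a d m → ι a * exp-sum m (σ a d) ≤ ι (d ℕ.+ a)
  exp-sum-≤-product zero    d       m = subst (_≤ ι (d ℕ.+ 0))
      (sym (trans (cong (_* exp-sum m (σ 0 d)) (sym 0≡ι0)) (*-zeroˡ (exp-sum m (σ 0 d))))) (0≤ι (d ℕ.+ 0))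
  exp-sum-≤-product (suc a) zero    m = ≤-reflexive
      (trans (cong (ι (suc a) *_) (exp-sum-0 m)) (*-identityʳ (ι (suc a))))
  exp-sum-≤-product (suc a) (suc d) m = *-cancelʳ-≤-pos (ι x) {{x-pos}} (begin
    q * ι x                        ≡⟨ solve 2 (λ q i → q :* i := (con 1ℚ :+ i) :* q :- q) refl q (ι x) ⟩
    (1ℚ + ι x) * q - q             ≡⟨ cong (λ z → z * q - q) (ι-suc x) ⟨
    ι (suc x) * q - q              ≤⟨ +-monoˡ-≤ (- q) (*-monoˡ-≤ (ι (suc x)) (0≤ι (suc x)) bound) ⟩
    ι (suc x) * (ι x + y * q) - q  ≡⟨ solve 4
        (λ j i y q → j :* (i :+ y :* q) :- q := j :* i :+ (y :* j) :* q :- q) refl (ι (suc x)) (ι x) y q ⟩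
    ι (suc x) * ι x + (y * ι (suc x)) * q - q   ≡⟨ cong (λ z → ι (suc x) * ι x + z * q - q) (inv-* x) ⟩
    ι (suc x) * ι x + 1ℚ * q - q   ≡⟨ solve 3 (λ j i q → j :* i :+ con 1ℚ :* q :- q := j :* i) refl (ι (suc x))
        (ι x) q ⟩
    ι (suc x) * ι x                ∎)
    where
    open ≤-Reasoning
    x = d ℕ.+ suc a
    y = inv x
    q = ι (suc a) * exp-sum m (σ (suc a) (suc d))
    x-pos : Positive (ι x)
    x-pos = subst (λ k → Positive (ι k)) (sym (ℕ.+-suc d a)) (ι-pos (d ℕ.+ a))
    -- With y = 1/(x + 1) this says q x/(x + 1) ≤ x. The chain above multiplies by x + 1, and x
    -- cancels since it is positive.
    bound : q ≤ ι x + y * q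
    bound = begin
      q
        ≤⟨ *-monoˡ-≤ (ι (suc a)) (0≤ι (suc a)) (exp-sum-increment-≤ (0≤σ (suc a) d) (0≤inv x) m) ⟩
      ι (suc a) * (exp-sum m (σ (suc a) d) + y * exp-sum m (σ (suc a) (suc d)))
        ≡⟨ solve 4 (λ i p y r → i :* (p :+ y :* r) := i :* p :+ y :* (i :* r)) refl (ι (suc a))
            (exp-sum m (σ (suc a) d)) y (exp-sum m (σ (suc a) (suc d))) ⟩
      ι (suc a) * exp-sum m (σ (suc a) d) + y * q
        ≤⟨ +-monoˡ-≤ (y * q) (exp-sum-≤-product (suc a) d m) ⟩
      ι x + y * q ∎

  σ≤1⇒≤e : ∀ a d → σ a d ≤ 1ℚ → ι (d ℕ.+ suc a) ≤ ι (suc a) * e-sum d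
  σ≤1⇒≤e a d σ≤1 = subst (λ p → ι (d ℕ.+ suc a) ≤ ι (suc a) * p) (exp-sum-1 d)
    (≤-trans (product-≤-exp-sum a d) (*-monoˡ-≤ (ι (suc a)) (0≤ι (suc a)) (exp-sum-mono d (0≤σ a d) σ≤1)))

  1≤σ⇒e≤ : ∀ a d m → 1ℚ ≤ σ a d → ι a * e-sum m ≤ ι (d ℕ.+ a)
  1≤σ⇒e≤ a d m 1≤σ = subst (λ p → ι a * p ≤ ι (d ℕ.+ a)) (exp-sum-1 m)
    (≤-trans (*-monoˡ-≤ (ι a) (0≤ι a) (exp-sum-mono m (nonNegative⁻¹ 1ℚ) 1≤σ)) (exp-sum-≤-product a d m))

  e-sum-mono : ∀ {m n} → m ℕ.≤ n → e-sum m ≤ e-sum n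
  e-sum-mono {m} {n} m≤n = subst (λ k → e-sum m ≤ e-sum k) (ℕ.m∸n+n≡m m≤n) (e-sum-increases m (n ℕ.∸ m))

  ι3 : 1ℚ + (1ℚ + 1ℚ) ≡ ι 3
  ι3 = sym (trans (ι-suc 2) (cong (1ℚ +_) (trans (ι-suc 1) (cong (1ℚ +_) (sym 1≡ι1)))))

  e-sum≤3 : ∀ m → e-sum m ≤ ι 3
  e-sum≤3 m = begin
    e-sum m                 ≤⟨ e-sum-mono (ℕ.m≤m+n m 1) ⟩
    e-sum (m ℕ.+ 1)         ≤⟨ ≤-from-gap (recip-nonNeg ((m ℕ.+ 1) !) {{(m ℕ.+ 1) ℕ.!≢0}}) refl ⟩
    e-upper (m ℕ.+ 1)       ≤⟨ e-upper-decreases 0 m ⟩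
    1ℚ + (1ℚ + 1ℚ)          ≡⟨ ι3 ⟩
    ι 3                     ∎
    where open ≤-Reasoning

  -- In effect a e ≤ n + 1 ≤ (a + 2) e, phrased through partial sums. They approach e from below, so
  -- the first bound holds for all of them, whereas the second needs a truncation degree at least
  -- the number of factors in the product.
  e-threshold : ∀ n → ∃[ a ] ∃[ d ] (
    d ℕ.+ suc a ≡ suc n × σ (suc a) d < 1ℚ × 1ℚ ≤ σ a (suc d) ×
    (∀ m → ι a * e-sum m ≤ ι (suc n)) ×
    (∀ m → suc n ℕ.≤ m → ι (suc n) ≤ ι (2 ℕ.+ a) * e-sum m))
  e-threshold n with harmonic-crossing n
  ... | a , d , eq , below , above = a , d , eq , below , above , lower , upper d eq below
    where
    lower : ∀ m → ι a * e-sum m ≤ ι (suc n)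
    lower m = subst (λ k → ι a * e-sum m ≤ ι k) (trans (sym (ℕ.+-suc d a)) eq) (1≤σ⇒e≤ a (suc d) m above)
    upper : ∀ d → d ℕ.+ suc a ≡ suc n → σ (suc a) d < 1ℚ → ∀ m → suc n ℕ.≤ m → ι (suc n) ≤ ι (2 ℕ.+ a) * e-sum m
    upper zero    eq below m n≤m = begin
      ι (suc n)                ≡⟨ cong ι eq ⟨
      ι (suc a)                ≤⟨ ι-mono-≤ (ℕ.n≤1+n (suc a)) ⟩
      ι (2 ℕ.+ a)              ≡⟨ *-identityʳ (ι (2 ℕ.+ a)) ⟨
      ι (2 ℕ.+ a) * 1ℚ         ≤⟨ *-monoˡ-≤ (ι (2 ℕ.+ a)) (0≤ι (2 ℕ.+ a)) (1≤e m) ⟩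
      ι (2 ℕ.+ a) * e-sum m    ∎
      where open ≤-Reasoning
    -- The top term 1/(n + 1) of the sum is dropped: the product of 1 + 1/j over a + 2 ≤ j ≤ n
    -- telescopes to exactly (n + 1)/(a + 2).
    upper (suc d) eq below m n≤m = begin
      ι (suc n)                     ≡⟨ cong ι (trans (sym eq) (sym (ℕ.+-suc d (suc a)))) ⟩
      ι (d ℕ.+ suc (suc a))         ≤⟨ σ≤1⇒≤e (suc a) d
          (≤-trans (≤-from-gap (0≤inv (d ℕ.+ suc a)) (+-comm (inv (d ℕ.+ suc a)) (σ (suc a) d))) (<⇒≤ below)) ⟩
      ι (2 ℕ.+ a) * e-sum d         ≤⟨ *-monoˡ-≤ (ι (2 ℕ.+ a)) (0≤ι (2 ℕ.+ a)) (e-sum-mono d≤m) ⟩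
      ι (2 ℕ.+ a) * e-sum m         ∎
      where
      open ≤-Reasoning
      d≤m : d ℕ.≤ m
      d≤m = ℕ.≤-trans (ℕ.n≤1+n d) (ℕ.≤-trans (ℕ.m≤m+n (suc d) (suc a)) (ℕ.≤-trans (ℕ.≤-reflexive eq) n≤m))

-- Finite sums, layer-cake formulas and power sums.

module Moments where

  open Rationals
  open HarmonicSums
  open import Data.Fin using (Fin; zero; suc; toℕ)
  open import Data.List using (List; []; _∷_; _++_; map; length; allFin; filter; cartesianProductWith)
  import Data.List.Properties as List
  open import Data.Nat as ℕ using (ℕ; zero; suc; z≤n; s≤s)
  import Data.Nat.Properties as ℕ
  open import Data.Nat.Tactic.RingSolver using (solve-∀)
  open import Data.Rational
  open import Data.Rational.Properties
  open import Data.Vec using ([]; _∷_)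
  open import Function using (_∘_; id)
  open import Relation.Nullary using (yes; no)
  open import Relation.Unary using (Decidable)
  open import Relation.Binary.PropositionalEquality
  open import Data.Rational.Solver using (module +-*-Solver)
  open +-*-Solver using (solve; _:+_; _:*_; _:-_; _:=_; con)

  module _ {A : Set} where

    ∑ : List A → (A → ℚ) → ℚ
    ∑ []       F = 0ℚ
    ∑ (x ∷ xs) F = F x + ∑ xs F

    ∑-cong : ∀ xs {F G : A → ℚ} → (∀ x → F x ≡ G x) → ∑ xs F ≡ ∑ xs G
    ∑-cong []       eq = refl
    ∑-cong (x ∷ xs) eq = cong₂ _+_ (eq x) (∑-cong xs eq)

    ∑-mono : ∀ xs {F G : A → ℚ} → (∀ x → F x ≤ G x) → ∑ xs F ≤ ∑ xs G
    ∑-mono []       le = ≤-refl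
    ∑-mono (x ∷ xs) le = +-mono-≤ (le x) (∑-mono xs le)

    ∑-+ : ∀ xs (F G : A → ℚ) → ∑ xs (λ x → F x + G x) ≡ ∑ xs F + ∑ xs G
    ∑-+ []       F G = refl
    ∑-+ (x ∷ xs) F G = trans (cong (F x + G x +_) (∑-+ xs F G))
      (solve 4 (λ a b c d → (a :+ b) :+ (c :+ d) := (a :+ c) :+ (b :+ d)) refl (F x) (G x) (∑ xs F) (∑ xs G))

    ∑-*ˡ : ∀ xs c (F : A → ℚ) → ∑ xs (λ x → c * F x) ≡ c * ∑ xs F
    ∑-*ˡ []       c F = sym (*-zeroʳ c)
    ∑-*ˡ (x ∷ xs) c F = trans (cong (c * F x +_) (∑-*ˡ xs c F)) (sym (*-distribˡ-+ c (F x) (∑ xs F)))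

    ∑-*ʳ : ∀ xs c (F : A → ℚ) → ∑ xs (λ x → F x * c) ≡ ∑ xs F * c
    ∑-*ʳ xs c F = trans (∑-cong xs (λ x → *-comm (F x) c)) (trans (∑-*ˡ xs c F) (*-comm c (∑ xs F)))

    ∑-const : ∀ xs c → ∑ xs (λ _ → c) ≡ ι (length xs) * c
    ∑-const []       c = trans (sym (*-zeroˡ c)) (cong (_* c) 0≡ι0)
    ∑-const (x ∷ xs) c = trans (cong (c +_) (∑-const xs c))
      (trans (solve 2 (λ c l → c :+ l :* c := (con 1ℚ :+ l) :* c) refl c (ι (length xs)))
        (cong (_* c) (sym (ι-suc (length xs)))))

    ∑-zero : ∀ xs → ∑ xs (λ _ → 0ℚ) ≡ 0ℚ
    ∑-zero xs = trans (∑-const xs 0ℚ) (*-zeroʳ (ι (length xs)))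

    ∑-++ : ∀ xs ys (F : A → ℚ) → ∑ (xs ++ ys) F ≡ ∑ xs F + ∑ ys F
    ∑-++ []       ys F = sym (+-identityˡ (∑ ys F))
    ∑-++ (x ∷ xs) ys F = trans (cong (F x +_) (∑-++ xs ys F)) (sym (+-assoc (F x) (∑ xs F) (∑ ys F)))

    markov : ∀ {P : A → Set} (P? : Decidable P) {F : A → ℚ} {c} → (∀ x → 0ℚ ≤ F x) → (∀ x → P x → c ≤ F x) →
             ∀ xs → ι (length (filter P? xs)) * c ≤ ∑ xs F
    markov P? {F} {c} 0≤F c≤F []       = ≤-reflexive (trans (cong (_* c) (sym 0≡ι0)) (*-zeroˡ c))
    markov P? {F} {c} 0≤F c≤F (x ∷ xs) with P? x
    ... | no  _  = ≤-trans (markov P? 0≤F c≤F xs) (≤-from-gap (0≤F x) (+-comm (F x) (∑ xs F)))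
    ... | yes px = subst (_≤ F x + ∑ xs F)
      (trans (solve 2 (λ c l → c :+ l :* c := (con 1ℚ :+ l) :* c) refl c (ι (length (filter P? xs))))
        (cong (_* c) (sym (ι-suc (length (filter P? xs))))))
      (+-mono-≤ (c≤F x px) (markov P? 0≤F c≤F xs))

  ∑-map : ∀ {A B : Set} (f : A → B) xs F → ∑ (map f xs) F ≡ ∑ xs (F ∘ f)
  ∑-map f []       F = refl
  ∑-map f (x ∷ xs) F = cong (F (f x) +_) (∑-map f xs F)

  ∑-cartesian : ∀ {A B C : Set} (f : A → B → C) xs ys F →
    ∑ (cartesianProductWith f xs ys) F ≡ ∑ xs (λ x → ∑ ys (λ y → F (f x y)))
  ∑-cartesian f []       ys F = refl
  ∑-cartesian f (x ∷ xs) ys F = trans (∑-++ (map (f x) ys) (cartesianProductWith f xs ys) F)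
    (cong₂ _+_ (∑-map (f x) ys F) (∑-cartesian f xs ys F))

  ∑-swap : ∀ {A B : Set} (xs : List A) (ys : List B) (F : A → B → ℚ) →
    ∑ xs (λ x → ∑ ys (F x)) ≡ ∑ ys (λ y → ∑ xs (λ x → F x y))
  ∑-swap []       ys F = sym (∑-zero ys)
  ∑-swap (x ∷ xs) ys F = trans (cong (∑ ys (F x) +_) (∑-swap xs ys F))
    (sym (∑-+ ys (F x) (λ y → ∑ xs (λ x → F x y))))

  ∑-allFin-suc : ∀ n (F : Fin (suc n) → ℚ) → ∑ (allFin (suc n)) F ≡ F zero + ∑ (allFin n) (F ∘ suc)
  ∑-allFin-suc n F = cong (F zero +_) (trans (cong (λ xs → ∑ xs F) (sym (List.map-tabulate id suc)))
      (∑-map suc (allFin n) F))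

  -- The indicator of d ≤ k, valued in ℚ so that `ge-⊓` turns the minimum of a row into a product
  -- over its entries.
  ge : ℕ → ℕ → ℚ
  ge zero    k       = 1ℚ
  ge (suc d) zero    = 0ℚ
  ge (suc d) (suc k) = ge d k

  ge-⊓ : ∀ d j k → ge d (j ℕ.⊓ k) ≡ ge d j * ge d k
  ge-⊓ zero    j       k       = refl
  ge-⊓ (suc d) zero    k       = sym (*-zeroˡ (ge (suc d) k))
  ge-⊓ (suc d) (suc j) zero    = sym (*-zeroʳ (ge d j))
  ge-⊓ (suc d) (suc j) (suc k) = ge-⊓ d j k

  ∑-ge : ∀ n d → ∑ (allFin n) (λ y → ge d (toℕ y)) ≡ ι (n ℕ.∸ d)
  ∑-ge zero    zero    = 0≡ι0
  ∑-ge zero    (suc d) = 0≡ι0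
  ∑-ge (suc n) zero    = trans (∑-const (allFin (suc n)) 1ℚ)
      (trans (*-identityʳ _) (cong (ι ∘ suc) (List.length-tabulate suc)))
  ∑-ge (suc n) (suc d) = trans (∑-allFin-suc n (λ y → ge (suc d) (toℕ y))) (trans (+-identityˡ _) (∑-ge n d))

  -- Layer-cake formula; it reduces the mean of a wait to counting the rows whose minimum is at
  -- least d.
  layers : ∀ n k → k ℕ.< n → ∑ (allFin n) (λ d → ge (toℕ d) k) ≡ ι (suc k)
  layers (suc n) zero    _         = trans (∑-allFin-suc n (λ d → ge (toℕ d) zero))
    (trans (cong (1ℚ +_) (trans (∑-zero (allFin n)) 0≡ι0)) (sym (ι-suc 0)))
  layers (suc n) (suc k) (s≤s k<n) = trans (∑-allFin-suc n (λ d → ge (toℕ d) (suc k)))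
    (trans (cong (1ℚ +_) (layers n k k<n)) (sym (ι-suc (suc k))))

  -- Layer-cake bound for the second moment: the right side is (k + 1)(k + 2). The exact weights
  -- would be 2 d + 1 in place of 2 (d + 1).
  square-≤-layers : ∀ n k → k ℕ.< n →
    ι (suc k) * ι (suc k) ≤ (1ℚ + 1ℚ) * ∑ (allFin n) (λ d → ι (suc (toℕ d)) * ge (toℕ d) k)
  square-≤-layers (suc n) zero    _ = begin
    ι 1 * ι 1                              ≡⟨ cong₂ _*_ (sym 1≡ι1) (sym 1≡ι1) ⟩
    1ℚ                                      ≤⟨ ≤-from-gap {r = 1ℚ} (nonNegative⁻¹ 1ℚ) refl ⟩
    (1ℚ + 1ℚ) * (1ℚ * 1ℚ + 0ℚ)            ≡⟨ cong₂ (λ x y → (1ℚ + 1ℚ) * (x * 1ℚ + y)) 1≡ι1 (sym zeros) ⟩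
    (1ℚ + 1ℚ) * (ι 1 * 1ℚ + ∑ (allFin n) (λ d → ι (suc (suc (toℕ d))) * 0ℚ))
      ≡⟨ cong ((1ℚ + 1ℚ) *_) (∑-allFin-suc n (λ d → ι (suc (toℕ d)) * ge (toℕ d) zero)) ⟨
    (1ℚ + 1ℚ) * ∑ (allFin (suc n)) (λ d → ι (suc (toℕ d)) * ge (toℕ d) zero) ∎
    where
    open ≤-Reasoning
    zeros : ∑ (allFin n) (λ d → ι (suc (suc (toℕ d))) * 0ℚ) ≡ 0ℚ
    zeros = trans (∑-cong (allFin n) (λ d → *-zeroʳ (ι (suc (suc (toℕ d)))))) (∑-zero (allFin n))
  square-≤-layers (suc n) (suc k) (s≤s k<n) = begin
    ι (suc (suc k)) * ι (suc (suc k))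
      ≡⟨ cong₂ _*_ (ι-suc (suc k)) (ι-suc (suc k)) ⟩
    (1ℚ + x) * (1ℚ + x)
      ≤⟨ ≤-from-gap {r = 1ℚ} (nonNegative⁻¹ 1ℚ)
          (solve 1 (λ x → x :* x :+ (con 1ℚ :+ con 1ℚ) :* (con 1ℚ :+ x)
          := (con 1ℚ :+ x) :* (con 1ℚ :+ x) :+ con 1ℚ) refl x) ⟩
    x * x + (1ℚ + 1ℚ) * (1ℚ + x)
      ≤⟨ +-monoˡ-≤ ((1ℚ + 1ℚ) * (1ℚ + x)) (square-≤-layers n k k<n) ⟩
    (1ℚ + 1ℚ) * g + (1ℚ + 1ℚ) * (1ℚ + x)
      ≡⟨ solve 2 (λ g x → (con 1ℚ :+ con 1ℚ) :* g :+ (con 1ℚ :+ con 1ℚ) :* (con 1ℚ :+ x)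
          := (con 1ℚ :+ con 1ℚ) :* (con 1ℚ :* con 1ℚ :+ (x :+ g))) refl g x ⟩
    (1ℚ + 1ℚ) * (1ℚ * 1ℚ + (x + g))
      ≡⟨ cong₂ (λ y z → (1ℚ + 1ℚ) * (y * 1ℚ + z)) 1≡ι1 tail ⟩
    (1ℚ + 1ℚ) * (ι 1 * 1ℚ + ∑ (allFin n) (λ d → ι (suc (suc (toℕ d))) * ge (toℕ d) k))
      ≡⟨ cong ((1ℚ + 1ℚ) *_) (∑-allFin-suc n (λ d → ι (suc (toℕ d)) * ge (toℕ d) (suc k))) ⟨
    (1ℚ + 1ℚ) * ∑ (allFin (suc n)) (λ d → ι (suc (toℕ d)) * ge (toℕ d) (suc k)) ∎
    where
    open ≤-Reasoning
    x = ι (suc k)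
    g = ∑ (allFin n) (λ d → ι (suc (toℕ d)) * ge (toℕ d) k)
    tail : x + g ≡ ∑ (allFin n) (λ d → ι (suc (suc (toℕ d))) * ge (toℕ d) k)
    tail = sym (trans
      (∑-cong (allFin n) (λ d → trans (cong (_* ge (toℕ d) k) (ι-suc (suc (toℕ d))))
        (solve 2 (λ i g → (con 1ℚ :+ i) :* g := g :+ i :* g) refl (ι (suc (toℕ d))) (ge (toℕ d) k))))
      (trans (∑-+ (allFin n) (λ d → ge (toℕ d) k) (λ d → ι (suc (toℕ d)) * ge (toℕ d) k))
        (cong (_+ g) (layers n k k<n))))

  power-sum : ℕ → ℕ → ℕ
  power-sum zero    m = 0
  power-sum (suc n) m = suc n ℕ.^ m ℕ.+ power-sum n m

  -- Here jᵐ is counted once for each i with j ≤ i ≤ n. For j = n - d this gives the weight d + 1 of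
  -- `∑-weighted-powers`.
  power-sum₂ : ℕ → ℕ → ℕ
  power-sum₂ zero    m = 0
  power-sum₂ (suc n) m = power-sum (suc n) m ℕ.+ power-sum₂ n m

  ∑-powers : ∀ n m → ∑ (allFin n) (λ d → ι ((n ℕ.∸ toℕ d) ℕ.^ m)) ≡ ι (power-sum n m)
  ∑-powers zero    m = 0≡ι0
  ∑-powers (suc n) m = trans (∑-allFin-suc n (λ d → ι ((suc n ℕ.∸ toℕ d) ℕ.^ m)))
    (trans (cong (ι (suc n ℕ.^ m) +_) (∑-powers n m)) (sym (ι-+ (suc n ℕ.^ m) (power-sum n m))))

  ∑-weighted-powers : ∀ n m → ∑ (allFin n) (λ d → ι (suc (toℕ d)) * ι ((n ℕ.∸ toℕ d) ℕ.^ m))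
      ≡ ι (power-sum₂ n m)
  ∑-weighted-powers zero    m = 0≡ι0
  ∑-weighted-powers (suc n) m = begin
    ∑ (allFin (suc n)) (λ d → ι (suc (toℕ d)) * ι ((suc n ℕ.∸ toℕ d) ℕ.^ m))
      ≡⟨ ∑-cong (allFin (suc n)) (λ d → trans (cong (_* ι ((suc n ℕ.∸ toℕ d) ℕ.^ m)) (ι-suc (toℕ d)))
           (solve 2 (λ i g → (con 1ℚ :+ i) :* g := g :+ i :* g) refl (ι (toℕ d))
               (ι ((suc n ℕ.∸ toℕ d) ℕ.^ m)))) ⟩
    ∑ (allFin (suc n)) (λ d → ι ((suc n ℕ.∸ toℕ d) ℕ.^ m) + ι (toℕ d) * ι ((suc n ℕ.∸ toℕ d) ℕ.^ m))
      ≡⟨ ∑-+ (allFin (suc n)) (λ d → ι ((suc n ℕ.∸ toℕ d) ℕ.^ m))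
          (λ d → ι (toℕ d) * ι ((suc n ℕ.∸ toℕ d) ℕ.^ m)) ⟩
    ∑ (allFin (suc n)) (λ d → ι ((suc n ℕ.∸ toℕ d) ℕ.^ m)) + ∑ (allFin (suc n))
        (λ d → ι (toℕ d) * ι ((suc n ℕ.∸ toℕ d) ℕ.^ m))
      ≡⟨ cong₂ _+_ (∑-powers (suc n) m) (begin
           ∑ (allFin (suc n)) (λ d → ι (toℕ d) * ι ((suc n ℕ.∸ toℕ d) ℕ.^ m))
             ≡⟨ ∑-allFin-suc n (λ d → ι (toℕ d) * ι ((suc n ℕ.∸ toℕ d) ℕ.^ m)) ⟩
           ι 0 * ι (suc n ℕ.^ m) + ∑ (allFin n) (λ d → ι (suc (toℕ d)) * ι ((n ℕ.∸ toℕ d) ℕ.^ m))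
             ≡⟨ cong₂ _+_ (trans (cong (_* ι (suc n ℕ.^ m)) (sym 0≡ι0)) (*-zeroˡ (ι (suc n ℕ.^ m))))
                 (∑-weighted-powers n m) ⟩
           0ℚ + ι (power-sum₂ n m)
             ≡⟨ +-identityˡ _ ⟩
           ι (power-sum₂ n m) ∎) ⟩
    ι (power-sum (suc n) m) + ι (power-sum₂ n m)
      ≡⟨ ι-+ (power-sum (suc n) m) (power-sum₂ n m) ⟨
    ι (power-sum₂ (suc n) m) ∎
    where open ≡-Reasoning

  -- Mean value bound for the power m + 1 between n and n + 1, as is `suc-power-≥` from the other
  -- side. Telescoped, the two compare `power-sum n m` with the integral nᵐ⁺¹/(m + 1).
  suc-power-≤ : ∀ n m → suc n ℕ.^ suc m ℕ.≤ n ℕ.^ suc m ℕ.+ suc m ℕ.* suc n ℕ.^ m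
  suc-power-≤ n zero    = ℕ.≤-reflexive (ring n)
    where
    ring : ∀ n → suc n ℕ.* 1 ≡ n ℕ.* 1 ℕ.+ 1
    ring = solve-∀
  suc-power-≤ n (suc m) = begin
    suc n ℕ.* suc n ℕ.^ suc m
      ≤⟨ ℕ.+-monoʳ-≤ (suc n ℕ.^ suc m) (ℕ.*-monoʳ-≤ n (suc-power-≤ n m)) ⟩
    suc n ℕ.^ suc m ℕ.+ n ℕ.* (n ℕ.^ suc m ℕ.+ suc m ℕ.* suc n ℕ.^ m)
      ≤⟨ ℕ.m≤m+n _ (suc m ℕ.* suc n ℕ.^ m) ⟩
    suc n ℕ.^ suc m ℕ.+ n ℕ.* (n ℕ.^ suc m ℕ.+ suc m ℕ.* suc n ℕ.^ m) ℕ.+ suc m ℕ.* suc n ℕ.^ m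
      ≡⟨ ring n m (n ℕ.^ suc m) (suc n ℕ.^ m) ⟩
    n ℕ.* n ℕ.^ suc m ℕ.+ suc (suc m) ℕ.* (suc n ℕ.^ suc m) ∎
    where
    open ℕ.≤-Reasoning
    ring : ∀ n m x y → suc n ℕ.* y ℕ.+ n ℕ.* (x ℕ.+ suc m ℕ.* y) ℕ.+ suc m ℕ.* y
        ≡ n ℕ.* x ℕ.+ suc (suc m) ℕ.* (suc n ℕ.* y)
    ring = solve-∀

  suc-power-≥ : ∀ n m → n ℕ.^ suc m ℕ.+ suc m ℕ.* n ℕ.^ m ℕ.≤ suc n ℕ.^ suc m
  suc-power-≥ n zero    = ℕ.≤-reflexive (ring n)
    where
    ring : ∀ n → n ℕ.* 1 ℕ.+ 1 ≡ suc n ℕ.* 1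
    ring = solve-∀
  suc-power-≥ n (suc m) = begin
    n ℕ.* (n ℕ.* x) ℕ.+ suc (suc m) ℕ.* (n ℕ.* x)   ≤⟨ ℕ.m≤m+n _ (suc m ℕ.* x) ⟩
    n ℕ.* (n ℕ.* x) ℕ.+ suc (suc m) ℕ.* (n ℕ.* x) ℕ.+ suc m ℕ.* x   ≡⟨ ring n m x ⟩
    suc n ℕ.* (n ℕ.* x ℕ.+ suc m ℕ.* x)             ≤⟨ ℕ.*-monoʳ-≤ (suc n) (suc-power-≥ n m) ⟩
    suc n ℕ.* suc n ℕ.^ suc m                       ∎
    where
    open ℕ.≤-Reasoning
    x = n ℕ.^ m
    ring : ∀ n m x → n ℕ.* (n ℕ.* x) ℕ.+ suc (suc m) ℕ.* (n ℕ.* x) ℕ.+ suc m ℕ.* x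
        ≡ suc n ℕ.* (n ℕ.* x ℕ.+ suc m ℕ.* x)
    ring = solve-∀

  power-sum-≥ : ∀ n m → n ℕ.^ suc m ℕ.≤ suc m ℕ.* power-sum n m
  power-sum-≥ zero    m = z≤n
  power-sum-≥ (suc n) m = begin
    suc n ℕ.^ suc m                                  ≤⟨ suc-power-≤ n m ⟩
    n ℕ.^ suc m ℕ.+ suc m ℕ.* suc n ℕ.^ m            ≤⟨ ℕ.+-monoˡ-≤ _ (power-sum-≥ n m) ⟩
    suc m ℕ.* power-sum n m ℕ.+ suc m ℕ.* suc n ℕ.^ m ≡⟨ ℕ.+-comm (suc m ℕ.* power-sum n m) _ ⟩
    suc m ℕ.* suc n ℕ.^ m ℕ.+ suc m ℕ.* power-sum n m ≡⟨ ℕ.*-distribˡ-+ (suc m) (suc n ℕ.^ m) (power-sum n m) ⟨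
    suc m ℕ.* power-sum (suc n) m                    ∎
    where open ℕ.≤-Reasoning

  power-sum-≤ : ∀ n m → suc m ℕ.* power-sum n m ℕ.≤ n ℕ.^ suc m ℕ.+ suc m ℕ.* n ℕ.^ m
  power-sum-≤ zero    m = ℕ.≤-trans (ℕ.≤-reflexive (ℕ.*-zeroʳ (suc m))) z≤n
  power-sum-≤ (suc n) m = begin
    suc m ℕ.* (suc n ℕ.^ m ℕ.+ power-sum n m)
        ≡⟨ ℕ.*-distribˡ-+ (suc m) (suc n ℕ.^ m) (power-sum n m) ⟩
    suc m ℕ.* suc n ℕ.^ m ℕ.+ suc m ℕ.* power-sum n m
        ≤⟨ ℕ.+-monoʳ-≤ (suc m ℕ.* suc n ℕ.^ m) (power-sum-≤ n m) ⟩
    suc m ℕ.* suc n ℕ.^ m ℕ.+ (n ℕ.^ suc m ℕ.+ suc m ℕ.* n ℕ.^ m)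
        ≤⟨ ℕ.+-monoʳ-≤ (suc m ℕ.* suc n ℕ.^ m) (suc-power-≥ n m) ⟩
    suc m ℕ.* suc n ℕ.^ m ℕ.+ suc n ℕ.^ suc m                ≡⟨ ℕ.+-comm (suc m ℕ.* suc n ℕ.^ m) _ ⟩
    suc n ℕ.^ suc m ℕ.+ suc m ℕ.* suc n ℕ.^ m                ∎
    where open ℕ.≤-Reasoning

  power-sum₂-≤-power-sum : ∀ n m → suc m ℕ.* power-sum₂ n m ℕ.≤ power-sum n (suc m) ℕ.+ suc m ℕ.* power-sum n m
  power-sum₂-≤-power-sum zero    m = ℕ.≤-trans (ℕ.≤-reflexive (ℕ.*-zeroʳ (suc m))) z≤n
  power-sum₂-≤-power-sum (suc n) m = begin
    suc m ℕ.* (power-sum (suc n) m ℕ.+ power-sum₂ n m)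
      ≡⟨ ℕ.*-distribˡ-+ (suc m) (power-sum (suc n) m) (power-sum₂ n m) ⟩
    suc m ℕ.* power-sum (suc n) m ℕ.+ suc m ℕ.* power-sum₂ n m
      ≤⟨ ℕ.+-mono-≤ (power-sum-≤ (suc n) m) (power-sum₂-≤-power-sum n m) ⟩
    (suc n ℕ.^ suc m ℕ.+ suc m ℕ.* suc n ℕ.^ m) ℕ.+ (power-sum n (suc m) ℕ.+ suc m ℕ.* power-sum n m)
      ≡⟨ ring m (suc n ℕ.^ suc m) (suc n ℕ.^ m) (power-sum n (suc m)) (power-sum n m) ⟩
    power-sum (suc n) (suc m) ℕ.+ suc m ℕ.* power-sum (suc n) m ∎
    where
    open ℕ.≤-Reasoning
    ring : ∀ m x y u v → (x ℕ.+ suc m ℕ.* y) ℕ.+ (u ℕ.+ suc m ℕ.* v) ≡ (x ℕ.+ u) ℕ.+ suc m ℕ.* (y ℕ.+ v)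
    ring = solve-∀

  -- The square (m + 1)² is relaxed to (m + 2)(m + 1) to fit two summations, with exponents m + 1
  -- and m. The 4 counts four terms, each at most nᵐ⁺² because m + 2 ≤ n.
  power-sum₂-≤ : ∀ n m → suc (suc m) ℕ.≤ n → suc m ℕ.* suc m ℕ.* power-sum₂ n m ℕ.≤ 4 ℕ.* (n ℕ.* n ℕ.* n ℕ.^ m)
  power-sum₂-≤ n m m+2≤n = begin
    suc m ℕ.* suc m ℕ.* power-sum₂ n m
      ≤⟨ ℕ.*-monoˡ-≤ (power-sum₂ n m) (ℕ.*-monoˡ-≤ (suc m) (ℕ.n≤1+n (suc m))) ⟩
    suc (suc m) ℕ.* suc m ℕ.* power-sum₂ n m
      ≡⟨ ℕ.*-assoc (suc (suc m)) (suc m) (power-sum₂ n m) ⟩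
    suc (suc m) ℕ.* (suc m ℕ.* power-sum₂ n m)
      ≤⟨ ℕ.*-monoʳ-≤ (suc (suc m)) (power-sum₂-≤-power-sum n m) ⟩
    suc (suc m) ℕ.* (power-sum n (suc m) ℕ.+ suc m ℕ.* power-sum n m)
      ≡⟨ ℕ.*-distribˡ-+ (suc (suc m)) (power-sum n (suc m)) (suc m ℕ.* power-sum n m) ⟩
    suc (suc m) ℕ.* power-sum n (suc m) ℕ.+ suc (suc m) ℕ.* (suc m ℕ.* power-sum n m)
      ≤⟨ ℕ.+-mono-≤ (power-sum-≤ n (suc m)) (ℕ.*-mono-≤ m+2≤n (power-sum-≤ n m)) ⟩
    (n ℕ.* (n ℕ.* x) ℕ.+ suc (suc m) ℕ.* (n ℕ.* x)) ℕ.+ n ℕ.* (n ℕ.* x ℕ.+ suc m ℕ.* x)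
      ≤⟨ ℕ.+-mono-≤ (ℕ.+-monoʳ-≤ (n ℕ.* (n ℕ.* x)) (ℕ.*-monoˡ-≤ (n ℕ.* x) m+2≤n))
           (ℕ.*-monoʳ-≤ n (ℕ.+-monoʳ-≤ (n ℕ.* x) (ℕ.*-monoˡ-≤ x (ℕ.≤-trans (ℕ.n≤1+n (suc m)) m+2≤n)))) ⟩
    (n ℕ.* (n ℕ.* x) ℕ.+ n ℕ.* (n ℕ.* x)) ℕ.+ n ℕ.* (n ℕ.* x ℕ.+ n ℕ.* x)
      ≡⟨ ring n x ⟩
    4 ℕ.* (n ℕ.* n ℕ.* x) ∎
    where
    open ℕ.≤-Reasoning
    x = n ℕ.^ m
    ring : ∀ n x → (n ℕ.* (n ℕ.* x) ℕ.+ n ℕ.* (n ℕ.* x)) ℕ.+ n ℕ.* (n ℕ.* x ℕ.+ n ℕ.* x) ≡ 4 ℕ.* (n ℕ.* n ℕ.* x)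
    ring = solve-∀

-- Arrays of independent rows: mean and variance of the total wait.

module Arrays where

  open Rationals
  open HarmonicSums
  open Moments
  open import Data.Fin using (Fin; zero; suc; toℕ)
  import Data.Fin.Properties as Fin
  open import Data.List using (List; []; _∷_; length; allFin; cartesianProductWith; cartesianProduct)
  import Data.List.Properties as List
  open import Data.Nat as ℕ using (ℕ; zero; suc; s≤s)
  import Data.Nat.Properties as ℕ
  open import Data.Product using (_,_; _×_)
  open import Data.Rational
  open import Data.Rational.Properties
  open import Data.Unit using (⊤; tt)
  open import Data.Vec using (Vec; []; _∷_)
  open import Function using (_∘_; id)
  open import Relation.Binary.PropositionalEquality
  open import Data.Rational.Solver using (module +-*-Solver)
  open +-*-Solver using (solve; _:+_; _:*_; _:-_; _:=_; con)

  triangle : ℕ → ℕ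
  triangle zero    = 0
  triangle (suc m) = suc m ℕ.+ triangle m

  Row : ℕ → ℕ → Set
  Row L m = Vec (Fin L) m

  -- Row i of an array holds, for each vertex still unvisited at the i-th step of the
  -- greedy path, how far ahead of the current time the label of the edge to it lies.
  Array : ℕ → ℕ → Set
  Array L zero    = ⊤
  Array L (suc m) = Row L (suc m) × Array L m

  rows : ∀ L m → List (Row L m)
  rows L zero    = [] ∷ []
  rows L (suc m) = cartesianProductWith _∷_ (allFin L) (rows L m)

  arrays : ∀ L m → List (Array L m)
  arrays L zero    = tt ∷ []
  arrays L (suc m) = cartesianProduct (rows L (suc m)) (arrays L m)

  length-cartesianProduct : ∀ {A B C : Set} (f : A → B → C) xs ys →
    length (cartesianProductWith f xs ys) ≡ length xs ℕ.* length ys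
  length-cartesianProduct f []       ys = refl
  length-cartesianProduct f (x ∷ xs) ys = trans (List.length-++ (Data.List.map (f x) ys))
    (cong₂ ℕ._+_ (List.length-map (f x) ys) (length-cartesianProduct f xs ys))

  length-rows : ∀ L m → length (rows L m) ≡ L ℕ.^ m
  length-rows L zero    = refl
  length-rows L (suc m) = trans (length-cartesianProduct _∷_ (allFin L) (rows L m))
    (cong₂ ℕ._*_ (List.length-tabulate {n = L} id) (length-rows L m))

  length-arrays : ∀ L m → length (arrays L m) ≡ L ℕ.^ triangle m
  length-arrays L zero    = refl
  length-arrays L (suc m) = trans (length-cartesianProduct _,_ (rows L (suc m)) (arrays L m))
    (trans (cong₂ ℕ._*_ (length-rows L (suc m)) (length-arrays L m))
      (sym (ℕ.^-distribˡ-+-* L (suc m) (triangle m))))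

  module _ {ℓ : ℕ} where

    private L = suc ℓ

    -- An empty row gets ℓ, the largest possible entry.
    minimum : ∀ {m} → Row L m → ℕ
    minimum []       = ℓ
    minimum (y ∷ ys) = toℕ y ℕ.⊓ minimum ys

    minimum<L : ∀ {m} (r : Row L m) → minimum r ℕ.< L
    minimum<L []       = ℕ.≤-refl
    minimum<L (y ∷ ys) = ℕ.≤-<-trans (ℕ.m⊓n≤m (toℕ y) (minimum ys)) (Fin.toℕ<n y)

    -- The extra 1 carries the clock past the label just used, so that labels increase strictly
    -- along the path.
    wait : ∀ {m} → Row L m → ℕ
    wait r = suc (minimum r)

    waits : ℕ → ∀ {m} → Array L m → ℕ
    waits zero    _                 = 0
    waits (suc k) {zero}  _         = 0
    waits (suc k) {suc m} (r , ω)   = wait r ℕ.+ waits k ω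

    -- The minimum is at least d iff every entry is, so the count factors into L - d choices per
    -- entry. The bound on d takes care of the empty row, whose minimum is `ℓ`.
    ∑-rows-ge : ∀ m d → d ℕ.< L → ∑ (rows L m) (ge d ∘ minimum) ≡ ι ((L ℕ.∸ d) ℕ.^ m)
    ∑-rows-ge zero    d (s≤s d≤ℓ) = trans (+-identityʳ _) (trans (ge-≤ d ℓ d≤ℓ) 1≡ι1)
      where
      ge-≤ : ∀ d k → d ℕ.≤ k → ge d k ≡ 1ℚ
      ge-≤ zero    k       _         = refl
      ge-≤ (suc d) (suc k) (s≤s d≤k) = ge-≤ d k d≤k
    ∑-rows-ge (suc m) d d<L = begin
      ∑ (rows L (suc m)) (ge d ∘ minimum)
        ≡⟨ ∑-cartesian _∷_ (allFin L) (rows L m) (ge d ∘ minimum) ⟩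
      ∑ (allFin L) (λ y → ∑ (rows L m) (λ r → ge d (toℕ y ℕ.⊓ minimum r)))
        ≡⟨ ∑-cong (allFin L) (λ y → trans (∑-cong (rows L m) (λ r → ge-⊓ d (toℕ y) (minimum r)))
             (∑-*ˡ (rows L m) (ge d (toℕ y)) (ge d ∘ minimum))) ⟩
      ∑ (allFin L) (λ y → ge d (toℕ y) * ∑ (rows L m) (ge d ∘ minimum))
        ≡⟨ ∑-*ʳ (allFin L) (∑ (rows L m) (ge d ∘ minimum)) (λ y → ge d (toℕ y)) ⟩
      ∑ (allFin L) (λ y → ge d (toℕ y)) * ∑ (rows L m) (ge d ∘ minimum)
        ≡⟨ cong₂ _*_ (∑-ge L d) (∑-rows-ge m d d<L) ⟩
      ι (L ℕ.∸ d) * ι ((L ℕ.∸ d) ℕ.^ m)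
        ≡⟨ ι-* (L ℕ.∸ d) ((L ℕ.∸ d) ℕ.^ m) ⟨
      ι ((L ℕ.∸ d) ℕ.^ suc m) ∎
      where open ≡-Reasoning

    ∑-wait : ∀ m → ∑ (rows L m) (ι ∘ wait) ≡ ι (power-sum L m)
    ∑-wait m = begin
      ∑ (rows L m) (ι ∘ wait)
        ≡⟨ ∑-cong (rows L m) (λ r → sym (layers L (minimum r) (minimum<L r))) ⟩
      ∑ (rows L m) (λ r → ∑ (allFin L) (λ d → ge (toℕ d) (minimum r)))
        ≡⟨ ∑-swap (rows L m) (allFin L) (λ r d → ge (toℕ d) (minimum r)) ⟩
      ∑ (allFin L) (λ d → ∑ (rows L m) (λ r → ge (toℕ d) (minimum r)))
        ≡⟨ ∑-cong (allFin L) (λ d → ∑-rows-ge m (toℕ d) (Fin.toℕ<n d)) ⟩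
      ∑ (allFin L) (λ d → ι ((L ℕ.∸ toℕ d) ℕ.^ m))
        ≡⟨ ∑-powers L m ⟩
      ι (power-sum L m) ∎
      where open ≡-Reasoning

    ∑-wait² : ∀ m → ∑ (rows L m) (λ r → ι (wait r) * ι (wait r)) ≤ (1ℚ + 1ℚ) * ι (power-sum₂ L m)
    ∑-wait² m = begin
      ∑ (rows L m) (λ r → ι (wait r) * ι (wait r))
        ≤⟨ ∑-mono (rows L m) (λ r → square-≤-layers L (minimum r) (minimum<L r)) ⟩
      ∑ (rows L m) (λ r → (1ℚ + 1ℚ) * ∑ (allFin L) (λ d → ι (suc (toℕ d)) * ge (toℕ d) (minimum r)))
        ≡⟨ ∑-*ˡ (rows L m) (1ℚ + 1ℚ) (λ r → ∑ (allFin L) (λ d → ι (suc (toℕ d)) * ge (toℕ d) (minimum r))) ⟩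
      (1ℚ + 1ℚ) * ∑ (rows L m) (λ r → ∑ (allFin L) (λ d → ι (suc (toℕ d)) * ge (toℕ d) (minimum r)))
        ≡⟨ cong ((1ℚ + 1ℚ) *_) (∑-swap (rows L m) (allFin L)
            (λ r d → ι (suc (toℕ d)) * ge (toℕ d) (minimum r))) ⟩
      (1ℚ + 1ℚ) * ∑ (allFin L) (λ d → ∑ (rows L m) (λ r → ι (suc (toℕ d)) * ge (toℕ d) (minimum r)))
        ≡⟨ cong ((1ℚ + 1ℚ) *_) (∑-cong (allFin L) (λ d →
             trans (∑-*ˡ (rows L m) (ι (suc (toℕ d))) (λ r → ge (toℕ d) (minimum r)))
               (cong (ι (suc (toℕ d)) *_) (∑-rows-ge m (toℕ d) (Fin.toℕ<n d))))) ⟩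
      (1ℚ + 1ℚ) * ∑ (allFin L) (λ d → ι (suc (toℕ d)) * ι ((L ℕ.∸ toℕ d) ℕ.^ m))
        ≡⟨ cong ((1ℚ + 1ℚ) *_) (∑-weighted-powers L m) ⟩
      (1ℚ + 1ℚ) * ι (power-sum₂ L m) ∎
      where open ≤-Reasoning

    private
      w : ℕ → ℚ
      w m = ι (L ℕ.^ m)

      w⁻¹ : ℕ → ℚ
      w⁻¹ m = inv (ℕ.pred (L ℕ.^ m))

      w⁻¹*w : ∀ m → w⁻¹ m * w m ≡ 1ℚ
      w⁻¹*w m = trans (cong (λ k → w⁻¹ m * ι k) (sym (ℕ.suc-pred (L ℕ.^ m) {{ℕ.m^n≢0 L m}})))
          (inv-* (ℕ.pred (L ℕ.^ m)))

      0≤w⁻¹ : ∀ m → 0ℚ ≤ w⁻¹ m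
      0≤w⁻¹ m = 0≤inv (ℕ.pred (L ℕ.^ m))

    mean : ℕ → ℚ
    mean m = w⁻¹ m * ι (power-sum L m)

    w*mean : ∀ m → w m * mean m ≡ ι (power-sum L m)
    w*mean m = trans (solve 3 (λ w v p → w :* (v :* p) := (v :* w) :* p) refl (w m) (w⁻¹ m) (ι (power-sum L m)))
      (trans (cong (_* ι (power-sum L m)) (w⁻¹*w m)) (*-identityˡ _))

    -- The minimum of m independent uniform points of an interval of length L has mean L/(m + 1).
    -- The extra 1 in `mean-≤` is the error of discretisation.
    mean-≥ : ∀ m → ι L * inv m ≤ mean m
    mean-≥ m = begin
      ι L * inv m
        ≡⟨ trans (solve 2 (λ l v → l :* v := (l :* v) :* con 1ℚ) refl (ι L) (inv m))
            (cong (ι L * inv m *_) (sym (w⁻¹*w m))) ⟩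
      ι L * inv m * (w⁻¹ m * w m)
        ≡⟨ solve 4 (λ l v u w → l :* v :* (u :* w) := (u :* v) :* (l :* w)) refl (ι L) (inv m) (w⁻¹ m) (w m) ⟩
      w⁻¹ m * inv m * (ι L * w m)
        ≡⟨ cong (w⁻¹ m * inv m *_) (sym (ι-* L (L ℕ.^ m))) ⟩
      w⁻¹ m * inv m * ι (L ℕ.^ suc m)
        ≤⟨ *-monoˡ-≤ (w⁻¹ m * inv m) (0≤-* (0≤w⁻¹ m) (0≤inv m)) (ι-mono-≤ (power-sum-≥ L m)) ⟩
      w⁻¹ m * inv m * ι (suc m ℕ.* power-sum L m)
        ≡⟨ cong (w⁻¹ m * inv m *_) (ι-* (suc m) (power-sum L m)) ⟩
      w⁻¹ m * inv m * (ι (suc m) * ι (power-sum L m))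
        ≡⟨ solve 4 (λ u v i p → u :* v :* (i :* p) := (v :* i) :* (u :* p)) refl (w⁻¹ m) (inv m) (ι (suc m))
            (ι (power-sum L m)) ⟩
      (inv m * ι (suc m)) * mean m
        ≡⟨ trans (cong (_* mean m) (inv-* m)) (*-identityˡ (mean m)) ⟩
      mean m ∎
      where open ≤-Reasoning

    mean-≤ : ∀ m → mean m ≤ ι L * inv m + 1ℚ
    mean-≤ m = begin
      mean m
        ≡⟨ trans (cong (_* mean m) (inv-* m)) (*-identityˡ (mean m)) ⟨
      (inv m * ι (suc m)) * mean m
        ≡⟨ solve 4 (λ u v i p → u :* v :* (i :* p) := (v :* i) :* (u :* p)) refl (w⁻¹ m) (inv m) (ι (suc m))
            (ι (power-sum L m)) ⟨
      w⁻¹ m * inv m * (ι (suc m) * ι (power-sum L m))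
        ≡⟨ cong (w⁻¹ m * inv m *_) (ι-* (suc m) (power-sum L m)) ⟨
      w⁻¹ m * inv m * ι (suc m ℕ.* power-sum L m)
        ≤⟨ *-monoˡ-≤ (w⁻¹ m * inv m) (0≤-* (0≤w⁻¹ m) (0≤inv m)) (ι-mono-≤ (power-sum-≤ L m)) ⟩
      w⁻¹ m * inv m * ι (L ℕ.^ suc m ℕ.+ suc m ℕ.* L ℕ.^ m)
        ≡⟨ cong (w⁻¹ m * inv m *_) (trans (ι-+ (L ℕ.^ suc m) (suc m ℕ.* L ℕ.^ m))
            (cong₂ _+_ (ι-* L (L ℕ.^ m)) (ι-* (suc m) (L ℕ.^ m)))) ⟩
      w⁻¹ m * inv m * (ι L * w m + ι (suc m) * w m)
        ≡⟨ solve 5 (λ u v l i w → u :* v :* (l :* w :+ i :* w)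
            := (l :* v) :* (u :* w) :+ (v :* i) :* (u :* w)) refl
             (w⁻¹ m) (inv m) (ι L) (ι (suc m)) (w m) ⟩
      ι L * inv m * (w⁻¹ m * w m) + inv m * ι (suc m) * (w⁻¹ m * w m)
        ≡⟨ cong₂ (λ x y → ι L * inv m * x + y * x) (w⁻¹*w m) (inv-* m) ⟩
      ι L * inv m * 1ℚ + 1ℚ * 1ℚ
        ≡⟨ cong (_+ 1ℚ) (*-identityʳ (ι L * inv m)) ⟩
      ι L * inv m + 1ℚ ∎
      where open ≤-Reasoning

    -- Only an upper bound for the variance, by way of the second moment. The 8 is the 2 of
    -- `∑-wait²` times the 4 of `power-sum₂-≤`.
    variance : ℕ → ℚ
    variance m = ι 8 * (ι L * ι L) * (inv m * inv m)

    second-moment : ∀ m → suc (suc m) ℕ.≤ L →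
      ∑ (rows L m) (λ r → ι (wait r) * ι (wait r)) ≤ w m * variance m
    second-moment m m+2≤L = begin
      ∑ (rows L m) (λ r → ι (wait r) * ι (wait r))
        ≤⟨ ∑-wait² m ⟩
      (1ℚ + 1ℚ) * p
        ≡⟨ trans (solve 1 (λ p → p := (con 1ℚ :* con 1ℚ) :* p) refl ((1ℚ + 1ℚ) * p))
            (cong (λ z → z * z * ((1ℚ + 1ℚ) * p)) (sym (inv-* m))) ⟩
      (v * i) * (v * i) * ((1ℚ + 1ℚ) * p)
        ≡⟨ solve 3 (λ v i p → (v :* i) :* (v :* i) :* ((con 1ℚ :+ con 1ℚ) :* p)
            := (v :* v) :* (con 1ℚ :+ con 1ℚ) :* (i :* i :* p)) refl v i p ⟩
      (v * v) * (1ℚ + 1ℚ) * (i * i * p)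
        ≤⟨ *-monoˡ-≤ ((v * v) * (1ℚ + 1ℚ)) (0≤-* (0≤-* (0≤inv m) (0≤inv m)) (nonNegative⁻¹ (1ℚ + 1ℚ))) bound ⟩
      (v * v) * (1ℚ + 1ℚ) * (ι 4 * (ι L * ι L * w m))
        ≡⟨ cong (λ z → (v * v) * z * (ι 4 * (ι L * ι L * w m))) (trans (cong₂ _+_ 1≡ι1 1≡ι1) (sym (ι-+ 1 1))) ⟩
      (v * v) * ι 2 * (ι 4 * (ι L * ι L * w m))
        ≡⟨ solve 5 (λ v t f l w → (v :* v) :* t :* (f :* (l :* l :* w))
            := w :* ((t :* f) :* (l :* l) :* (v :* v))) refl v (ι 2) (ι 4) (ι L) (w m) ⟩
      w m * ((ι 2 * ι 4) * (ι L * ι L) * (v * v))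
        ≡⟨ cong (λ z → w m * (z * (ι L * ι L) * (v * v))) (sym (ι-* 2 4)) ⟩
      w m * variance m ∎
      where
      open ≤-Reasoning
      v = inv m
      i = ι (suc m)
      p = ι (power-sum₂ L m)
      bound : i * i * p ≤ ι 4 * (ι L * ι L * w m)
      bound = subst₂ _≤_
        (trans (ι-* (suc m ℕ.* suc m) (power-sum₂ L m)) (cong (_* p) (ι-* (suc m) (suc m))))
        (trans (ι-* 4 (L ℕ.* L ℕ.* L ℕ.^ m)) (cong (ι 4 *_)
            (trans (ι-* (L ℕ.* L) (L ℕ.^ m)) (cong (_* w m) (ι-* L L)))))
        (ι-mono-≤ (power-sum₂-≤ L m m+2≤L))

    -- The k rows read from an array with k + a rows have lengths k + a down to a + 1. A row of
    -- length j has mean wait about L/(j + 1), hence the sums σ from `suc a` in the bounds below.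
    total-mean : ℕ → ℕ → ℚ
    total-mean a zero    = 0ℚ
    total-mean a (suc k) = mean (suc (k ℕ.+ a)) + total-mean a k

    total-variance : ℕ → ℕ → ℚ
    total-variance a zero    = 0ℚ
    total-variance a (suc k) = variance (suc (k ℕ.+ a)) + total-variance a k

    total-mean-≥ : ∀ a k → ι L * σ (suc a) k ≤ total-mean a k
    total-mean-≥ a zero    = ≤-reflexive (*-zeroʳ (ι L))
    total-mean-≥ a (suc k) = begin
      ι L * (inv (k ℕ.+ suc a) + σ (suc a) k)
          ≡⟨ cong (λ j → ι L * (inv j + σ (suc a) k)) (ℕ.+-suc k a) ⟩
      ι L * (inv (suc (k ℕ.+ a)) + σ (suc a) k)           ≡⟨ *-distribˡ-+ (ι L) _ _ ⟩
      ι L * inv (suc (k ℕ.+ a)) + ι L * σ (suc a) k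
          ≤⟨ +-mono-≤ (mean-≥ (suc (k ℕ.+ a))) (total-mean-≥ a k) ⟩
      total-mean a (suc k)                                ∎
      where open ≤-Reasoning

    total-mean-≤ : ∀ a k → total-mean a k ≤ ι L * σ (suc a) k + ι k
    total-mean-≤ a zero    = ≤-reflexive (sym (trans (cong₂ _+_ (*-zeroʳ (ι L)) (sym 0≡ι0)) (+-identityʳ 0ℚ)))
    total-mean-≤ a (suc k) = begin
      total-mean a (suc k)
        ≤⟨ +-mono-≤ (mean-≤ (suc (k ℕ.+ a))) (total-mean-≤ a k) ⟩
      (ι L * inv (suc (k ℕ.+ a)) + 1ℚ) + (ι L * σ (suc a) k + ι k)
        ≡⟨ solve 4 (λ l v s i → (l :* v :+ con 1ℚ) :+ (l :* s :+ i) := l :* (v :+ s) :+ (con 1ℚ :+ i)) refl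
             (ι L) (inv (suc (k ℕ.+ a))) (σ (suc a) k) (ι k) ⟩
      ι L * (inv (suc (k ℕ.+ a)) + σ (suc a) k) + (1ℚ + ι k)
        ≡⟨ cong₂ (λ j x → ι L * (inv j + σ (suc a) k) + x) (sym (ℕ.+-suc k a)) (sym (ι-suc k)) ⟩
      ι L * σ (suc a) (suc k) + ι (suc k) ∎
      where open ≤-Reasoning

    -- Each row is charged 1/(a + 1)², more than any of them needs. This loses only a constant
    -- factor as long as a is proportional to n.
    total-variance-≤ : ∀ a k → total-variance a k ≤ ι k * (ι 8 * (ι L * ι L) * (inv a * inv a))
    total-variance-≤ a zero    = ≤-reflexive (sym
        (trans (cong (_* (ι 8 * (ι L * ι L) * (inv a * inv a))) (sym 0≡ι0))
        (*-zeroˡ (ι 8 * (ι L * ι L) * (inv a * inv a)))))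
    total-variance-≤ a (suc k) = begin
      variance (suc (k ℕ.+ a)) + total-variance a k
        ≤⟨ +-mono-≤ (*-monoˡ-≤ c (0≤-* (0≤ι 8) (0≤-* (0≤ι L) (0≤ι L)))
            (*-mono-≤-nonNeg (0≤inv (suc (k ℕ.+ a))) (0≤inv a) le le)) (total-variance-≤ a k) ⟩
      x + ι k * x
        ≡⟨ solve 2 (λ x i → x :+ i :* x := (con 1ℚ :+ i) :* x) refl x (ι k) ⟩
      (1ℚ + ι k) * x
        ≡⟨ cong (_* x) (sym (ι-suc k)) ⟩
      ι (suc k) * x ∎
      where
      open ≤-Reasoning
      c = ι 8 * (ι L * ι L)
      x = c * (inv a * inv a)
      le : inv (suc (k ℕ.+ a)) ≤ inv a
      le = inv-antimono (ℕ.m≤n⇒m≤1+n (ℕ.m≤n+m a k))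

    -- The cross term vanishes because `mean m` is the exact average; what remains is x² plus the
    -- second moment minus the squared mean, and the last is dropped.
    row-deviation : ∀ m x → suc (suc m) ℕ.≤ L →
      ∑ (rows L m) (λ r → (x + (ι (wait r) - mean m)) * (x + (ι (wait r) - mean m)))
          ≤ w m * (x * x + variance m)
    row-deviation m x m+2≤L = begin
      ∑ (rows L m) (λ r → (x + (ι (wait r) - μ)) * (x + (ι (wait r) - μ)))
        ≡⟨ ∑-cong (rows L m) (λ r → solve 3 (λ x y μ → (x :+ (y :- μ)) :* (x :+ (y :- μ))
            := y :* y :+ (y :* ((x :- μ) :+ (x :- μ)) :+ (x :- μ) :* (x :- μ))) refl x (ι (wait r)) μ) ⟩
      ∑ (rows L m) (λ r → ι (wait r) * ι (wait r) + (ι (wait r) * ((x - μ) + (x - μ)) + (x - μ) * (x - μ)))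
        ≡⟨ ∑-+ (rows L m) (λ r → ι (wait r) * ι (wait r))
            (λ r → ι (wait r) * ((x - μ) + (x - μ)) + (x - μ) * (x - μ)) ⟩
      M₂ + ∑ (rows L m) (λ r → ι (wait r) * ((x - μ) + (x - μ)) + (x - μ) * (x - μ))
        ≡⟨ cong (M₂ +_) (∑-+ (rows L m) (λ r → ι (wait r) * ((x - μ) + (x - μ))) (λ _ → (x - μ) * (x - μ))) ⟩
      M₂ + (∑ (rows L m) (λ r → ι (wait r) * ((x - μ) + (x - μ))) + ∑ (rows L m) (λ _ → (x - μ) * (x - μ)))
        ≡⟨ cong (M₂ +_) (cong₂ _+_
             (trans (∑-*ʳ (rows L m) ((x - μ) + (x - μ)) (ι ∘ wait))
                 (cong (_* ((x - μ) + (x - μ))) (trans (∑-wait m) (sym (w*mean m)))))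
             (trans (∑-const (rows L m) ((x - μ) * (x - μ)))
                 (cong (λ k → ι k * ((x - μ) * (x - μ))) (length-rows L m)))) ⟩
      M₂ + (w m * μ * ((x - μ) + (x - μ)) + w m * ((x - μ) * (x - μ)))
        ≤⟨ ≤-from-gap (0≤-* (0≤ι (L ℕ.^ m)) (0≤-square μ))
             (solve 4 (λ M w μ x → M :+ w :* (x :* x)
                 := (M :+ (w :* μ :* ((x :- μ) :+ (x :- μ)) :+ w :* ((x :- μ) :* (x :- μ)))) :+ w :* (μ :* μ))
                 refl M₂ (w m) μ x) ⟩
      M₂ + w m * (x * x)
        ≤⟨ +-monoˡ-≤ (w m * (x * x)) (second-moment m m+2≤L) ⟩
      w m * variance m + w m * (x * x)
        ≡⟨ solve 3 (λ w v y → w :* v :+ w :* y := w :* (y :+ v)) refl (w m) (variance m) (x * x) ⟩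
      w m * (x * x + variance m) ∎
      where
      open ≤-Reasoning
      μ = mean m
      M₂ = ∑ (rows L m) (λ r → ι (wait r) * ι (wait r))

    -- The shift x makes the induction go through without cross terms between the rows.
    deviation : ∀ a k x → suc (suc (k ℕ.+ a)) ℕ.≤ L →
      ∑ (arrays L (k ℕ.+ a)) (λ ω → (x + (ι (waits k ω) - total-mean a k))
          * (x + (ι (waits k ω) - total-mean a k)))
      ≤ ι (L ℕ.^ triangle (k ℕ.+ a)) * (x * x + total-variance a k)
    deviation a zero    x _ = ≤-reflexive (begin
      ∑ (arrays L a) (λ _ → (x + (ι 0 - 0ℚ)) * (x + (ι 0 - 0ℚ)))
        ≡⟨ ∑-const (arrays L a) _ ⟩
      ι (length (arrays L a)) * ((x + (ι 0 - 0ℚ)) * (x + (ι 0 - 0ℚ)))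
        ≡⟨ cong₂ (λ l z → ι l * ((x + (z - 0ℚ)) * (x + (z - 0ℚ)))) (length-arrays L a) (sym 0≡ι0) ⟩
      ι (L ℕ.^ triangle a) * ((x + (0ℚ - 0ℚ)) * (x + (0ℚ - 0ℚ)))
        ≡⟨ solve 2 (λ l x → l :* ((x :+ (con 0ℚ :- con 0ℚ)) :* (x :+ (con 0ℚ :- con 0ℚ)))
            := l :* (x :* x :+ con 0ℚ)) refl (ι (L ℕ.^ triangle a)) x ⟩
      ι (L ℕ.^ triangle a) * (x * x + 0ℚ) ∎)
      where open ≡-Reasoning
    deviation a (suc k) x bound = begin
      ∑ (arrays L (suc m)) (λ ω → sq (x + (ι (waits (suc k) ω) - (μ + Μ))))
        ≡⟨ ∑-cartesian _,_ (rows L (suc m)) (arrays L m) (λ ω → sq (x + (ι (waits (suc k) ω) - (μ + Μ)))) ⟩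
      ∑ (rows L (suc m)) (λ r → ∑ (arrays L m) (λ ω → sq (x + (ι (wait r ℕ.+ waits k ω) - (μ + Μ)))))
        ≡⟨ ∑-cong (rows L (suc m)) (λ r → ∑-cong (arrays L m)
            (λ ω → cong sq (trans (cong (λ z → x + (z - (μ + Μ))) (ι-+ (wait r) (waits k ω)))
             (solve 5 (λ x y z μ Μ → x :+ ((y :+ z) :- (μ :+ Μ)) := (x :+ (y :- μ)) :+ (z :- Μ)) refl x
                 (ι (wait r)) (ι (waits k ω)) μ Μ)))) ⟩
      ∑ (rows L (suc m)) (λ r → ∑ (arrays L m) (λ ω → sq ((x + (ι (wait r) - μ)) + (ι (waits k ω) - Μ))))
        ≤⟨ ∑-mono (rows L (suc m)) (λ r → deviation a k (x + (ι (wait r) - μ)) (ℕ.≤-trans (ℕ.n≤1+n _) bound)) ⟩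
      ∑ (rows L (suc m)) (λ r → N * (sq (x + (ι (wait r) - μ)) + V))
        ≡⟨ trans (∑-*ˡ (rows L (suc m)) N (λ r → sq (x + (ι (wait r) - μ)) + V))
             (cong (N *_) (trans (∑-+ (rows L (suc m)) (λ r → sq (x + (ι (wait r) - μ))) (λ _ → V))
               (cong (∑ (rows L (suc m)) (λ r → sq (x + (ι (wait r) - μ))) +_)
                 (trans (∑-const (rows L (suc m)) V) (cong (λ l → ι l * V) (length-rows L (suc m))))))) ⟩
      N * (∑ (rows L (suc m)) (λ r → sq (x + (ι (wait r) - μ))) + w (suc m) * V)
        ≤⟨ *-monoˡ-≤ N (0≤ι (L ℕ.^ triangle m)) (+-monoˡ-≤ (w (suc m) * V) (row-deviation (suc m) x bound)) ⟩
      N * (w (suc m) * (sq x + variance (suc m)) + w (suc m) * V)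
        ≡⟨ solve 5 (λ N w y v V → N :* (w :* (y :+ v) :+ w :* V) := (w :* N) :* (y :+ (v :+ V))) refl N
            (w (suc m)) (sq x) (variance (suc m)) V ⟩
      (w (suc m) * N) * (sq x + (variance (suc m) + V))
        ≡⟨ cong (_* (sq x + (variance (suc m) + V)))
            (trans (sym (ι-* (L ℕ.^ suc m) (L ℕ.^ triangle m)))
            (cong ι (sym (ℕ.^-distribˡ-+-* L (suc m) (triangle m))))) ⟩
      ι (L ℕ.^ triangle (suc m)) * (sq x + (variance (suc m) + V)) ∎
      where
      open ≤-Reasoning
      m = k ℕ.+ a
      μ = mean (suc m)
      Μ = total-mean a k
      V = total-variance a k
      N = ι (L ℕ.^ triangle m)
      sq : ℚ → ℚ
      sq z = z * z

-- Chebyshev bounds for the total wait.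

module Tails where

  open Rationals
  open HarmonicSums
  open Moments
  open Arrays
  open import Data.List using (length; filter)
  open import Data.Nat as ℕ using (ℕ; suc)
  import Data.Nat.Properties as ℕ
  open import Data.Nat.Tactic.RingSolver using (solve-∀)
  open import Data.Rational
  open import Data.Rational.Properties
  open import Data.Sum using (_⊎_; inj₁; inj₂)
  open import Relation.Unary using (Decidable)
  open import Relation.Binary.PropositionalEquality
  open import Data.Rational.Solver using (module +-*-Solver)
  open +-*-Solver using (solve; _:+_; _:*_; _:-_; _:=_; con)

  square-mono : ∀ {p q} → 0ℚ ≤ p → p ≤ q → p * p ≤ q * q
  square-mono 0≤p p≤q = *-mono-≤-nonNeg 0≤p (≤-trans 0≤p p≤q) p≤q p≤q

  module Tail {ℓ : ℕ} (a k b R : ℕ) (1≤b : 1 ℕ.≤ b)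
    (n≤6a : suc (k ℕ.+ a) ℕ.≤ 6 ℕ.* suc a) (n≤2Rb : suc (k ℕ.+ a) ℕ.≤ 2 ℕ.* R ℕ.* b)
    (2n²≤L : 2 ℕ.* (suc (k ℕ.+ a) ℕ.* suc (k ℕ.+ a)) ℕ.≤ suc ℓ) where

    private
      L n : ℕ
      L = suc ℓ
      n = suc (k ℕ.+ a)

      v u gap : ℚ
      v = inv (k ℕ.+ a)
      u = inv a
      -- This is L b/n, the margin between L and L σ. A deviation of half of it is all that `far`
      -- asks for; the other half is reserved for the rounding error k of `total-mean-≤`.
      gap = ι L * (ι b * v)

      0≤gap : 0ℚ ≤ gap
      0≤gap = 0≤-* (0≤ι L) (0≤-* (0≤ι b) (0≤inv (k ℕ.+ a)))

      n<L : suc n ℕ.≤ L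
      n<L = ℕ.≤-trans (ℕ.≤-trans (ℕ.m≤m+n (suc n) _) (ℕ.≤-reflexive (ring (k ℕ.+ a)))) 2n²≤L
        where
        ring : ∀ m → suc (suc m) ℕ.+ (m ℕ.* 3 ℕ.+ 2 ℕ.* (m ℕ.* m)) ≡ 2 ℕ.* (suc m ℕ.* suc m)
        ring = solve-∀

    module _ {P : Array L (k ℕ.+ a) → Set} (P? : Decidable P)
      (far : ∀ ω → P ω → gap ≤ (1ℚ + 1ℚ) * (ι (waits k ω) - total-mean {ℓ} a k) ⊎
                         gap ≤ (1ℚ + 1ℚ) * (total-mean {ℓ} a k - ι (waits k ω))) where

      private
        Ω count : ℕ
        Ω = L ℕ.^ triangle (k ℕ.+ a)
        count = length (filter P? (arrays L (k ℕ.+ a)))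

        sq : Array L (k ℕ.+ a) → ℚ
        sq ω = (0ℚ + (ι (waits k ω) - total-mean {ℓ} a k)) * (0ℚ + (ι (waits k ω) - total-mean {ℓ} a k))

        four : ℚ
        four = (1ℚ + 1ℚ) * (1ℚ + 1ℚ)

        0≤four : 0ℚ ≤ four
        0≤four = nonNegative⁻¹ four

        far² : ∀ ω → P ω → gap * gap ≤ four * sq ω
        far² ω Pω with far ω Pω
        ... | inj₁ le = ≤-trans (square-mono 0≤gap le) (≤-reflexive
          (solve 2 (λ s m → (con 1ℚ :+ con 1ℚ) :* (s :- m) :* ((con 1ℚ :+ con 1ℚ) :* (s :- m)) :=
              (con 1ℚ :+ con 1ℚ) :* (con 1ℚ :+ con 1ℚ) :* ((con 0ℚ :+ (s :- m)) :* (con 0ℚ :+ (s :- m)))) refl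
            (ι (waits k ω)) (total-mean {ℓ} a k)))
        ... | inj₂ le = ≤-trans (square-mono 0≤gap le) (≤-reflexive
          (solve 2 (λ s m → (con 1ℚ :+ con 1ℚ) :* (m :- s) :* ((con 1ℚ :+ con 1ℚ) :* (m :- s)) :=
              (con 1ℚ :+ con 1ℚ) :* (con 1ℚ :+ con 1ℚ) :* ((con 0ℚ :+ (s :- m)) :* (con 0ℚ :+ (s :- m)))) refl
            (ι (waits k ω)) (total-mean {ℓ} a k)))

        chebyshev : ι count * (gap * gap) ≤ four * (ι Ω * (ι k * (ι 8 * (ι L * ι L) * (u * u))))
        chebyshev = begin
          ι count * (gap * gap)
            ≤⟨ markov P? (λ ω → 0≤-* 0≤four (0≤-square (0ℚ + (ι (waits k ω) - total-mean {ℓ} a k)))) far²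
                (arrays L (k ℕ.+ a)) ⟩
          ∑ (arrays L (k ℕ.+ a)) (λ ω → four * sq ω)
            ≡⟨ ∑-*ˡ (arrays L (k ℕ.+ a)) four sq ⟩
          four * ∑ (arrays L (k ℕ.+ a)) sq
            ≤⟨ *-monoˡ-≤ four 0≤four (deviation a k 0ℚ n<L) ⟩
          four * (ι Ω * (0ℚ * 0ℚ + total-variance {ℓ} a k))
            ≡⟨ cong (λ z → four * (ι Ω * z)) (+-identityˡ (total-variance {ℓ} a k)) ⟩
          four * (ι Ω * total-variance {ℓ} a k)
            ≤⟨ *-monoˡ-≤ four 0≤four (*-monoˡ-≤ (ι Ω) (0≤ι Ω) (total-variance-≤ {ℓ} a k)) ⟩
          four * (ι Ω * (ι k * (ι 8 * (ι L * ι L) * (u * u)))) ∎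
          where open ≤-Reasoning

        -- Chebyshev's bound with the denominators n and a + 1 cleared, so that the remaining
        -- cancellations take place in ℕ. The 32 is `four` times the 8 of `variance`.
        scaled : count ℕ.* (b ℕ.* b) ℕ.* (suc a ℕ.* suc a) ℕ.* (L ℕ.* L)
            ℕ.≤ 32 ℕ.* (Ω ℕ.* (k ℕ.* (n ℕ.* n))) ℕ.* (L ℕ.* L)
        scaled = ι-cancel-≤ (begin
          ι (count ℕ.* (b ℕ.* b) ℕ.* (suc a ℕ.* suc a) ℕ.* (L ℕ.* L))
            ≡⟨ trans (ι-* (count ℕ.* (b ℕ.* b) ℕ.* (suc a ℕ.* suc a)) (L ℕ.* L)) (cong₂ _*_
                 (trans (ι-* (count ℕ.* (b ℕ.* b)) (suc a ℕ.* suc a))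
                     (cong₂ _*_ (trans (ι-* count (b ℕ.* b)) (cong (ι count *_) (ι-* b b)))
                     (ι-* (suc a) (suc a))))
                 (ι-* L L)) ⟩
          ι count * (B * B) * (A * A) * (Λ * Λ)
            ≡⟨ solve 4 (λ c b a l → c :* (b :* b) :* (a :* a) :* (l :* l)
                := c :* (b :* b) :* (a :* a) :* (l :* l) :* (con 1ℚ :* con 1ℚ)) refl (ι count) B A Λ ⟩
          ι count * (B * B) * (A * A) * (Λ * Λ) * (1ℚ * 1ℚ)
            ≡⟨ cong (λ z → ι count * (B * B) * (A * A) * (Λ * Λ) * (z * z)) (sym (inv-* (k ℕ.+ a))) ⟩
          ι count * (B * B) * (A * A) * (Λ * Λ) * ((v * N) * (v * N))
            ≡⟨ solve 6 (λ c b a l v n → c :* (b :* b) :* (a :* a) :* (l :* l) :* ((v :* n) :* (v :* n))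
                := (c :* (l :* (b :* v) :* (l :* (b :* v)))) :* ((a :* n) :* (a :* n))) refl (ι count) B A
                Λ v N ⟩
          ι count * (gap * gap) * ((A * N) * (A * N))
            ≤⟨ *-monoʳ-≤ ((A * N) * (A * N)) (0≤-square (A * N)) chebyshev ⟩
          four * (ι Ω * (ι k * (ι 8 * (Λ * Λ) * (u * u)))) * ((A * N) * (A * N))
            ≡⟨ solve 8 (λ f w k e l u a n → f :* (w :* (k :* (e :* (l :* l) :* (u :* u))))
                :* ((a :* n) :* (a :* n)) := (f :* e) :* (w :* (k :* (n :* n))) :* (l :* l)
                :* ((u :* a) :* (u :* a))) refl
                 four (ι Ω) (ι k) (ι 8) Λ u A N ⟩
          (four * ι 8) * (ι Ω * (ι k * (N * N))) * (Λ * Λ) * ((u * A) * (u * A))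
            ≡⟨ cong₂ (λ y z → y * (ι Ω * (ι k * (N * N))) * (Λ * Λ) * (z * z)) four*8 (inv-* a) ⟩
          ι 32 * (ι Ω * (ι k * (N * N))) * (Λ * Λ) * (1ℚ * 1ℚ)
            ≡⟨ *-identityʳ _ ⟩
          ι 32 * (ι Ω * (ι k * (N * N))) * (Λ * Λ)
            ≡⟨ trans (ι-* (32 ℕ.* (Ω ℕ.* (k ℕ.* (n ℕ.* n)))) (L ℕ.* L)) (cong₂ _*_
                 (trans (ι-* 32 (Ω ℕ.* (k ℕ.* (n ℕ.* n))))
                     (cong (ι 32 *_) (trans (ι-* Ω (k ℕ.* (n ℕ.* n)))
                     (cong (ι Ω *_) (trans (ι-* k (n ℕ.* n)) (cong (ι k *_) (ι-* n n)))))))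
                 (ι-* L L)) ⟨
          ι (32 ℕ.* (Ω ℕ.* (k ℕ.* (n ℕ.* n))) ℕ.* (L ℕ.* L)) ∎)
          where
          open ≤-Reasoning
          B = ι b
          A = ι (suc a)
          Λ = ι L
          N = ι n
          four*8 : four * ι 8 ≡ ι 32
          four*8 = trans (cong (_* ι 8) (trans (cong₂ _*_ two two) (sym (ι-* 2 2)))) (sym (ι-* 4 8))
            where
            two : 1ℚ + 1ℚ ≡ ι 2
            two = trans (cong₂ _+_ 1≡ι1 1≡ι1) (sym (ι-+ 1 1))

        unscaled : count ℕ.* (b ℕ.* b) ℕ.* (suc a ℕ.* suc a) ℕ.≤ 32 ℕ.* (Ω ℕ.* (k ℕ.* (n ℕ.* n)))
        unscaled = ℕ.*-cancelʳ-≤ _ _ (L ℕ.* L) scaled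

        bound-b² : count ℕ.* (b ℕ.* b) ℕ.≤ 1152 ℕ.* (Ω ℕ.* k)
        bound-b² = ℕ.*-cancelʳ-≤ _ _ (n ℕ.* n) (begin
          count ℕ.* (b ℕ.* b) ℕ.* (n ℕ.* n)
            ≤⟨ ℕ.*-monoʳ-≤ (count ℕ.* (b ℕ.* b)) (ℕ.*-mono-≤ n≤6a n≤6a) ⟩
          count ℕ.* (b ℕ.* b) ℕ.* (6 ℕ.* suc a ℕ.* (6 ℕ.* suc a))
            ≡⟨ ring₁ (count ℕ.* (b ℕ.* b)) (suc a) ⟩
          36 ℕ.* (count ℕ.* (b ℕ.* b) ℕ.* (suc a ℕ.* suc a))
            ≤⟨ ℕ.*-monoʳ-≤ 36 unscaled ⟩
          36 ℕ.* (32 ℕ.* (Ω ℕ.* (k ℕ.* (n ℕ.* n))))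
            ≡⟨ ring₂ Ω k (n ℕ.* n) ⟩
          1152 ℕ.* (Ω ℕ.* k) ℕ.* (n ℕ.* n) ∎)
          where
          open ℕ.≤-Reasoning
          ring₁ : ∀ c a → c ℕ.* (6 ℕ.* a ℕ.* (6 ℕ.* a)) ≡ 36 ℕ.* (c ℕ.* (a ℕ.* a))
          ring₁ = solve-∀
          ring₂ : ∀ w k x → 36 ℕ.* (32 ℕ.* (w ℕ.* (k ℕ.* x))) ≡ 1152 ℕ.* (w ℕ.* k) ℕ.* x
          ring₂ = solve-∀

      -- 2304 = 4 * 8 * 6² * 2: the constant of the second moment, n ≤ 6 (a + 1) and n ≤ 2 R b.
      tail-count : count ℕ.* b ℕ.≤ 2304 ℕ.* R ℕ.* Ω
      tail-count = ℕ.*-cancelʳ-≤ _ _ b {{ℕ.>-nonZero 1≤b}} (begin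
        count ℕ.* b ℕ.* b              ≡⟨ ℕ.*-assoc count b b ⟩
        count ℕ.* (b ℕ.* b)            ≤⟨ bound-b² ⟩
        1152 ℕ.* (Ω ℕ.* k)             ≤⟨ ℕ.*-monoʳ-≤ 1152
            (ℕ.*-monoʳ-≤ Ω (ℕ.≤-trans (ℕ.m≤n⇒m≤1+n (ℕ.m≤m+n k a)) n≤2Rb)) ⟩
        1152 ℕ.* (Ω ℕ.* (2 ℕ.* R ℕ.* b)) ≡⟨ ring Ω R b ⟩
        2304 ℕ.* R ℕ.* Ω ℕ.* b         ∎)
        where
        open ℕ.≤-Reasoning
        ring : ∀ w r b → 1152 ℕ.* (w ℕ.* (2 ℕ.* r ℕ.* b)) ≡ 2304 ℕ.* r ℕ.* w ℕ.* b
        ring = solve-∀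

    late-count : σ (suc a) k + ι b * v ≤ 1ℚ →
      length (filter (λ ω → L ℕ.<? waits k ω) (arrays L (k ℕ.+ a))) ℕ.* b
          ℕ.≤ 2304 ℕ.* R ℕ.* L ℕ.^ triangle (k ℕ.+ a)
    late-count σ+β≤1 = tail-count (λ ω → L ℕ.<? waits k ω) (λ ω L<S → inj₁ (begin
      gap
        ≡⟨ solve 3 (λ g s k → g := (con 1ℚ :+ con 1ℚ) :* ((s :+ g) :- (s :+ k)) :- g :+ (k :+ k)) refl gap
            (ι L * σ (suc a) k) (ι k) ⟩
      (1ℚ + 1ℚ) * ((ι L * σ (suc a) k + gap) - (ι L * σ (suc a) k + ι k)) - gap + (ι k + ι k)
        ≤⟨ +-monoʳ-≤ ((1ℚ + 1ℚ) * ((ι L * σ (suc a) k + gap) - (ι L * σ (suc a) k + ι k)) - gap) 2k≤gap ⟩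
      (1ℚ + 1ℚ) * ((ι L * σ (suc a) k + gap) - (ι L * σ (suc a) k + ι k)) - gap + gap
        ≡⟨ solve 2 (λ x g → x :- g :+ g := x) refl
            ((1ℚ + 1ℚ) * ((ι L * σ (suc a) k + gap) - (ι L * σ (suc a) k + ι k))) gap ⟩
      (1ℚ + 1ℚ) * ((ι L * σ (suc a) k + gap) - (ι L * σ (suc a) k + ι k))
        ≤⟨ *-monoˡ-≤ (1ℚ + 1ℚ) (nonNegative⁻¹ (1ℚ + 1ℚ)) (+-mono-≤
             (≤-trans Lσ+gap≤L (ι-mono-≤ (ℕ.<⇒≤ L<S))) (neg-antimono-≤ (total-mean-≤ {ℓ} a k))) ⟩
      (1ℚ + 1ℚ) * (ι (waits k ω) - total-mean {ℓ} a k) ∎))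
      where
      open ≤-Reasoning
      Lσ+gap≤L : ι L * σ (suc a) k + gap ≤ ι L
      Lσ+gap≤L = begin
        ι L * σ (suc a) k + gap             ≡⟨ *-distribˡ-+ (ι L) (σ (suc a) k) (ι b * v) ⟨
        ι L * (σ (suc a) k + ι b * v)       ≤⟨ *-monoˡ-≤ (ι L) (0≤ι L) σ+β≤1 ⟩
        ι L * 1ℚ                            ≡⟨ *-identityʳ (ι L) ⟩
        ι L                                 ∎
      -- From L ≥ 2 n² and b ≥ 1 it follows that L b/n ≥ 2 n ≥ 2 k: rounding uses up at most half of
      -- the gap.
      2k≤gap : ι k + ι k ≤ gap
      2k≤gap = begin
        ι k + ι k                             ≡⟨ ι-+ k k ⟨
        ι (k ℕ.+ k)                           ≤⟨ ι-mono-≤ (ℕ.+-mono-≤ k≤n k≤n) ⟩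
        ι (n ℕ.+ n)
            ≡⟨ trans (ι-+ n n) (solve 1 (λ n → n :+ n := n :* (con 1ℚ :+ con 1ℚ) :* con 1ℚ) refl (ι n)) ⟩
        ι n * (1ℚ + 1ℚ) * 1ℚ                  ≡⟨ cong (ι n * (1ℚ + 1ℚ) *_) (inv-* (k ℕ.+ a)) ⟨
        ι n * (1ℚ + 1ℚ) * (v * ι n)
            ≡⟨ solve 2 (λ n v → n :* (con 1ℚ :+ con 1ℚ) :* (v :* n) := (n :* n :+ n :* n) :* (con 1ℚ :* v))
            refl (ι n) v ⟩
        (ι n * ι n + ι n * ι n) * (1ℚ * v)
            ≡⟨ cong (_* (1ℚ * v)) (trans (cong₂ _+_ (sym (ι-* n n)) (sym (ι-* n n)))
            (sym (ι-+ (n ℕ.* n) (n ℕ.* n)))) ⟩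
        ι (n ℕ.* n ℕ.+ n ℕ.* n) * (1ℚ * v)
            ≤⟨ *-mono-≤-nonNeg (0≤ι (n ℕ.* n ℕ.+ n ℕ.* n)) (0≤-* (0≤ι b) (0≤inv (k ℕ.+ a)))
                                                  (ι-mono-≤
                                                      (ℕ.≤-trans
                                                      (ℕ.≤-reflexive
                                                      (cong (n ℕ.* n ℕ.+_) (sym (ℕ.+-identityʳ (n ℕ.* n)))))
                                                      2n²≤L))
                                                  (*-monoʳ-≤ v (0≤inv (k ℕ.+ a))
                                                      (subst (_≤ ι b) (sym 1≡ι1) (ι-mono-≤ 1≤b))) ⟩
        gap                                   ∎
        where
        k≤n : k ℕ.≤ n
        k≤n = ℕ.m≤n⇒m≤1+n (ℕ.m≤m+n k a)

    early-count : 1ℚ + ι b * v ≤ σ (suc a) k →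
      length (filter (λ ω → waits k ω ℕ.≤? L) (arrays L (k ℕ.+ a))) ℕ.* b
          ℕ.≤ 2304 ℕ.* R ℕ.* L ℕ.^ triangle (k ℕ.+ a)
    early-count 1+β≤σ = tail-count (λ ω → waits k ω ℕ.≤? L) (λ ω S≤L → inj₂ (begin
      gap
        -- The lower bound on the mean carries no rounding term, so here the whole gap is available
        -- and half of it is given away.
        ≤⟨ ≤-from-gap 0≤gap refl ⟩
      gap + gap
        ≡⟨ solve 2 (λ l g → g :+ g := (con 1ℚ :+ con 1ℚ) :* ((l :+ g) :- l)) refl (ι L) gap ⟩
      (1ℚ + 1ℚ) * ((ι L + gap) - ι L)
        ≤⟨ *-monoˡ-≤ (1ℚ + 1ℚ) (nonNegative⁻¹ (1ℚ + 1ℚ)) (+-mono-≤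
             (≤-trans L+gap≤Lσ (total-mean-≥ {ℓ} a k)) (neg-antimono-≤ (ι-mono-≤ S≤L))) ⟩
      (1ℚ + 1ℚ) * (total-mean {ℓ} a k - ι (waits k ω)) ∎))
      where
      open ≤-Reasoning
      L+gap≤Lσ : ι L + gap ≤ ι L * σ (suc a) k
      L+gap≤Lσ = begin
        ι L + gap                   ≡⟨ solve 2 (λ l g → l :+ l :* g := l :* (con 1ℚ :+ g)) refl (ι L)
            (ι b * v) ⟩
        ι L * (1ℚ + ι b * v)        ≤⟨ *-monoˡ-≤ (ι L) (0≤ι L) 1+β≤σ ⟩
        ι L * σ (suc a) k           ∎

-- Reading a labelling along its greedy path.

module GreedyCode where

  open Arrays
  open import Data.Fin as Fin using (Fin; zero; suc; toℕ; inject₁; fromℕ; punchIn; punchOut)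
  import Data.Fin.Properties as Fin
  open import Data.Nat
  open import Data.Nat.DivMod using (_mod_; _%_; m<n⇒m%n≡m; [m+n]%n≡m%n; m%n<n)
  open import Data.Nat.Properties
  open import Data.Product using (∃-syntax; _,_; _×_; proj₁; proj₂)
  open import Data.Unit using (tt)
  open import Data.Vec using ([]; _∷_; lookup; tabulate)
  open import Data.Vec.Properties using (lookup∘tabulate)
  open import Function using (_∘_; case_of_)
  open import Function.Definitions using (Injective)
  open import Relation.Nullary using (¬_; Dec; yes; no; contradiction)
  open import Relation.Binary.PropositionalEquality

  module _ {ℓ : ℕ} where

    private L = suc ℓ

    -- How far y lies ahead of t, cyclically modulo L.
    distance : ℕ → ℕ → Fin L
    distance t y = (y + (L ∸ t)) mod L

    toℕ-distance : ∀ t y → toℕ (distance t y) ≡ (y + (L ∸ t)) % L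
    toℕ-distance t y = Fin.toℕ-fromℕ< (m%n<n (y + (L ∸ t)) L)

    distance-ahead : ∀ {t y} → t ≤ y → y < L → toℕ (distance t y) ≡ y ∸ t
    distance-ahead {t} {y} t≤y y<L = begin
      toℕ (distance t y)        ≡⟨ toℕ-distance t y ⟩
      (y + (L ∸ t)) % L         ≡⟨ cong (_% L) eq ⟩
      ((y ∸ t) + L) % L         ≡⟨ [m+n]%n≡m%n (y ∸ t) L ⟩
      (y ∸ t) % L               ≡⟨ m<n⇒m%n≡m (≤-<-trans (m∸n≤m y t) y<L) ⟩
      y ∸ t                     ∎
      where
      open ≡-Reasoning
      eq : y + (L ∸ t) ≡ (y ∸ t) + L
      eq = begin
        y + (L ∸ t)               ≡⟨ cong (_+ (L ∸ t)) (m∸n+n≡m t≤y) ⟨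
        (y ∸ t) + t + (L ∸ t)     ≡⟨ +-assoc (y ∸ t) t (L ∸ t) ⟩
        (y ∸ t) + (t + (L ∸ t))   ≡⟨ cong ((y ∸ t) +_) (m+[n∸m]≡n (≤-trans t≤y (<⇒≤ y<L))) ⟩
        (y ∸ t) + L               ∎

    -- A label below t is reached only after wrapping around, which takes the clock past L. Hence
    -- `t + wait r ≤ L` holds exactly when some label of the row is still usable.
    distance-behind : ∀ {t y} → y < t → t ≤ L → t + suc (toℕ (distance t y)) ≡ suc y + L
    distance-behind {t} {y} y<t t≤L = begin
      t + suc (toℕ (distance t y))   ≡⟨ cong (λ z → t + suc z) (trans (toℕ-distance t y) (m<n⇒m%n≡m small)) ⟩
      t + suc (y + (L ∸ t))          ≡⟨ +-comm t _ ⟩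
      suc y + (L ∸ t) + t            ≡⟨ +-assoc (suc y) (L ∸ t) t ⟩
      suc y + (L ∸ t + t)            ≡⟨ cong (suc y +_) (m∸n+n≡m t≤L) ⟩
      suc y + L                      ∎
      where
      open ≡-Reasoning
      small : y + (L ∸ t) < L
      small = subst (y + (L ∸ t) <_) (m+[n∸m]≡n t≤L) (+-monoˡ-< (L ∸ t) y<t)

    distance-ahead′ : ∀ {t y} → t ≤ y → y < L → t + suc (toℕ (distance t y)) ≡ suc y
    distance-ahead′ {t} {y} t≤y y<L = trans (cong (λ z → t + suc z) (distance-ahead t≤y y<L))
      (trans (+-suc t (y ∸ t)) (cong suc (m+[n∸m]≡n t≤y)))

    -- A rotation modulo L. If just one of the two labels is behind t, then `t + suc distance`
    -- exceeds L for it and is at most L for the other.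
    distance-injective : ∀ {t y z} → t ≤ L → y < L → z < L → distance t y ≡ distance t z → y ≡ z
    distance-injective {t} {y} {z} t≤L y<L z<L eq with t ≤? y | t ≤? z
    ... | yes t≤y | yes t≤z = suc-injective
      (trans (sym (distance-ahead′ t≤y y<L)) (trans (cong (λ d → t + suc (toℕ d)) eq)
          (distance-ahead′ t≤z z<L)))
    ... | no  t≰y | no  t≰z = suc-injective (+-cancelʳ-≡ L (suc y) (suc z)
      (trans (sym (distance-behind (≰⇒> t≰y) t≤L))
          (trans (cong (λ d → t + suc (toℕ d)) eq) (distance-behind (≰⇒> t≰z) t≤L))))
    ... | yes t≤y | no  t≰z = contradiction
      (trans (sym (distance-ahead′ t≤y y<L)) (trans (cong (λ d → t + suc (toℕ d)) eq)
          (distance-behind (≰⇒> t≰z) t≤L)))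
      (<⇒≢ (s≤s (≤-trans y<L (m≤n+m L z))))
    ... | no  t≰y | yes t≤z = contradiction
      (trans (sym (distance-ahead′ t≤z z<L)) (trans (cong (λ d → t + suc (toℕ d)) (sym eq))
          (distance-behind (≰⇒> t≰y) t≤L)))
      (<⇒≢ (s≤s (≤-trans z<L (m≤n+m L y))))

    argmin : ∀ {m} → Row L (suc m) → Fin (suc m)
    argmin (y ∷ [])          = zero
    argmin (y ∷ ys@(_ ∷ _)) with toℕ y ≤? minimum ys
    ... | yes _ = zero
    ... | no  _ = suc (argmin ys)

    lookup-argmin : ∀ {m} (r : Row L (suc m)) → toℕ (lookup r (argmin r)) ≡ minimum r
    lookup-argmin (y ∷ [])          = sym (m≤n⇒m⊓n≡m (s≤s⁻¹ (Fin.toℕ<n y)))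
    lookup-argmin (y ∷ ys@(_ ∷ _)) with toℕ y ≤? minimum ys
    ... | yes y≤ = sym (m≤n⇒m⊓n≡m y≤)
    ... | no  y≰ = trans (lookup-argmin ys) (sym (m≥n⇒m⊓n≡n (<⇒≤ (≰⇒> y≰))))

    minimum-≤ : ∀ {m} (r : Row L m) j → minimum r ≤ toℕ (lookup r j)
    minimum-≤ (y ∷ ys) zero    = m⊓n≤m (toℕ y) (minimum ys)
    minimum-≤ (y ∷ ys) (suc j) = ≤-trans (m⊓n≤n (toℕ y) (minimum ys)) (minimum-≤ ys j)

    -- A wait that overshoots L ends the path; the rest of the code may then be read
    -- from any time up to L.
    advance : ℕ → ℕ → ℕ
    advance t w with t + w ≤? L
    ... | yes _ = t + w
    ... | no  _ = 0

    advance-≤ : ∀ t w → advance t w ≤ L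
    advance-≤ t w with t + w ≤? L
    ... | yes t+w≤L = t+w≤L
    ... | no  _     = z≤n

    advance-+ : ∀ t w → t + w ≤ L → advance t w ≡ t + w
    advance-+ t w t+w≤L with t + w ≤? L
    ... | yes _     = refl
    ... | no  t+w≰L = contradiction t+w≤L t+w≰L

    count-if : ∀ {P : Set} → Dec P → ℕ → ℕ
    count-if (yes _) k = suc k
    count-if (no  _) k = 0

    -- Rows after the first overshoot do not count; they are there only so that the array determines
    -- the labelling.
    steps : ℕ → ∀ {m} → Array L m → ℕ
    steps t {zero}  _       = 0
    steps t {suc m} (r , ω) = count-if (t + wait r ≤? L) (steps (advance t (wait r)) ω)

    count-if-yes : ∀ {P : Set} {k} (P? : Dec P) → P → count-if P? k ≡ suc k
    count-if-yes (yes _) p = refl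
    count-if-yes (no ¬p) p = contradiction p ¬p

    count-if-no : ∀ {P : Set} {k} (P? : Dec P) → ¬ P → count-if P? k ≡ 0
    count-if-no (yes p) ¬p = contradiction p ¬p
    count-if-no (no _)  ¬p = refl

    count-if-suc : ∀ {P : Set} {j k} (P? : Dec P) → suc j ≤ count-if P? k → P × j ≤ k
    count-if-suc (yes p) le = p , s≤s⁻¹ le

    -- Together with `≤steps⇒waits≤` this trades the stopping rule for one inequality on a sum of
    -- independent waits. Partial sums increase, so if k waits fit then so do fewer.
    waits≤⇒≤steps : ∀ t k {m} (ω : Array L m) → k ≤ m → t + waits k ω ≤ L → k ≤ steps t ω
    waits≤⇒≤steps t zero    ω _ _ = z≤n
    waits≤⇒≤steps t (suc k) {suc m} (r , ω) (s≤s k≤m) le =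
      ≤-trans (s≤s (waits≤⇒≤steps (advance t (wait r)) k ω k≤m rest))
          (≤-reflexive (sym (count-if-yes (t + wait r ≤? L) fits)))
      where
      fits : t + wait r ≤ L
      fits = ≤-trans (+-monoʳ-≤ t (m≤m+n (wait r) (waits k ω))) le
      rest : advance t (wait r) + waits k ω ≤ L
      rest = subst (_≤ L) (trans (sym (+-assoc t (wait r) (waits k ω)))
        (cong (_+ waits k ω) (sym (advance-+ t (wait r) fits)))) le

    ≤steps⇒waits≤ : ∀ t k {m} (ω : Array L m) → k ≤ m → t ≤ L → k ≤ steps t ω → t + waits k ω ≤ L
    ≤steps⇒waits≤ t zero    ω _ t≤L _ = ≤-trans (≤-reflexive (+-identityʳ t)) t≤L
    ≤steps⇒waits≤ t (suc k) {suc m} (r , ω) (s≤s k≤m) t≤L le with fits , le′ ← count-if-suc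
        (t + wait r ≤? L) le =
      subst (_≤ L) (trans (cong (_+ waits k ω) (advance-+ t (wait r) fits)) (+-assoc t (wait r) (waits k ω)))
        (≤steps⇒waits≤ (advance t (wait r)) k ω k≤m (advance-≤ t (wait r)) le′)

    module _ {n : ℕ} where

      Labelling : Set
      Labelling = Fin n → Fin n → ℕ

      distances : ∀ {m} → Labelling → ℕ → Fin n → (Fin m → Fin n) → Row L m
      distances g t v u = tabulate (λ j → distance t (g v (u j)))

      lookup-distances : ∀ {m} g t v (u : Fin m → Fin n) j → lookup (distances g t v u) j
          ≡ distance t (g v (u j))
      lookup-distances g t v u j = lookup∘tabulate (λ j → distance t (g v (u j))) j

      -- v is the current vertex of the path, entered at time t, and u lists the
      -- unvisited vertices.
      code : Labelling → ∀ m → ℕ → Fin n → (Fin m → Fin n) → Array L m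
      code-after : Labelling → ∀ m → ℕ → (Fin (suc m) → Fin n) → Row L (suc m) → Array L m

      code g zero    t v u = tt
      code g (suc m) t v u = distances g t v u , code-after g m t u (distances g t v u)

      code-after g m t u r = code g m (advance t (wait r)) (u (argmin r)) (u ∘ punchIn (argmin r))

      -- The first row reveals the labels at v, and with them the vertex from which the
      -- remaining rows are read.
      code-determines : ∀ {g g′ : Labelling} →
        (∀ x y → g x y < L) → (∀ x y → g′ x y < L) → (∀ x y → g x y ≡ g y x) → (∀ x y → g′ x y ≡ g′ y x) →
        ∀ m t v (u : Fin m → Fin n) → t ≤ L → code g m t v u ≡ code g′ m t v u →
        (∀ j → g v (u j) ≡ g′ v (u j)) × (∀ i j → i ≢ j → g (u i) (u j) ≡ g′ (u i) (u j))
      code-determines g< g′< g-sym g′-sym zero    t v u t≤L eq = (λ ()) , (λ ())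
      code-determines {g} {g′} g< g′< g-sym g′-sym (suc m) t v u t≤L eq = from-v , among
        where
        r = distances g t v u
        r≡ : r ≡ distances g′ t v u
        r≡ = cong proj₁ eq
        from-v : ∀ j → g v (u j) ≡ g′ v (u j)
        from-v j = distance-injective t≤L (g< v (u j)) (g′< v (u j)) (begin
          distance t (g v (u j))           ≡⟨ lookup-distances g t v u j ⟨
          lookup r j                       ≡⟨ cong (λ r → lookup r j) r≡ ⟩
          lookup (distances g′ t v u) j    ≡⟨ lookup-distances g′ t v u j ⟩
          distance t (g′ v (u j))          ∎)
          where open ≡-Reasoning
        -- As the first rows agree, both tails are read from the same next vertex at the same time,
        -- which is what the induction hypothesis requires.
        rec = code-determines g< g′< g-sym g′-sym m (advance t (wait r)) (u (argmin r)) (u ∘ punchIn (argmin r))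
                (advance-≤ t (wait r)) (trans (cong proj₂ eq) (cong (code-after g′ m t u) (sym r≡)))
        among : ∀ i j → i ≢ j → g (u i) (u j) ≡ g′ (u i) (u j)
        among i j i≢j with argmin r Fin.≟ i | argmin r Fin.≟ j
        ... | yes refl | yes refl = contradiction refl i≢j
        ... | yes refl | no  a≢j  = subst (λ x → g (u (argmin r)) (u x) ≡ g′ (u (argmin r)) (u x))
          (Fin.punchIn-punchOut a≢j) (proj₁ rec (punchOut a≢j))
        ... | no  a≢i  | yes refl = trans (g-sym (u i) (u (argmin r))) (trans
          (subst (λ x → g (u (argmin r)) (u x) ≡ g′ (u (argmin r)) (u x)) (Fin.punchIn-punchOut a≢i)
              (proj₁ rec (punchOut a≢i)))
          (g′-sym (u (argmin r)) (u i)))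
        ... | no  a≢i  | no  a≢j  = subst₂ (λ x y → g (u x) (u y) ≡ g′ (u x) (u y))
          (Fin.punchIn-punchOut a≢i) (Fin.punchIn-punchOut a≢j)
          (proj₂ rec (punchOut a≢i) (punchOut a≢j) (i≢j ∘ Fin.punchOut-injective a≢i a≢j))

      -- The clock on arrival at a vertex. Being one more than the label of the entering edge, it
      -- turns "exceeds that label" into a weak inequality, uniform with the start at time t.
      entry : Labelling → ℕ → ∀ {k} → (Fin (suc k) → Fin n) → Fin (suc k) → ℕ
      entry g t vertex zero    = t
      entry g t vertex (suc i) = suc (g (vertex (inject₁ i)) (vertex (suc i)))

      -- The path starts at v at time t, when labels below t can no longer be used, and then
      -- stays within u.
      record Greedy (g : Labelling) (t : ℕ) (v : Fin n) {m} (u : Fin m → Fin n) (k : ℕ) : Set where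
        field
          vertex   : Fin (suc k) → Fin n
          start    : vertex zero ≡ v
          within   : ∀ i → ∃[ j ] vertex (suc i) ≡ u j
          distinct : Injective _≡_ _≡_ vertex
          rises    : ∀ i → entry g t vertex (inject₁ i) ≤ g (vertex (inject₁ i)) (vertex (suc i))
          lowest   : ∀ i j → (∀ l → l Fin.≤ inject₁ i → vertex l ≢ u j) →
                     entry g t vertex (inject₁ i) ≤ g (vertex (inject₁ i)) (u j) →
                     g (vertex (inject₁ i)) (vertex (suc i)) ≤ g (vertex (inject₁ i)) (u j)
          stuck    : ∀ j → (∀ l → vertex l ≢ u j) → g (vertex (fromℕ k)) (u j) < entry g t vertex (fromℕ k)

      module _ {g : Labelling} {t : ℕ} {v : Fin n} {m : ℕ} {u : Fin (suc m) → Fin n} {k : ℕ} (i₀ : Fin (suc m))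
        (v∉u : ∀ j → v ≢ u j) (t≤y : t ≤ g v (u i₀)) (least : ∀ j → t ≤ g v (u j) → g v (u i₀) ≤ g v (u j))
        (G : Greedy g (suc (g v (u i₀))) (u i₀) (u ∘ punchIn i₀) k) where

        private
          module G = Greedy G

          vertex : Fin (suc (suc k)) → Fin n
          vertex zero    = v
          vertex (suc i) = G.vertex i

          v∉G : ∀ i → v ≢ G.vertex i
          v∉G zero    v≡ = v∉u i₀ (trans v≡ G.start)
          v∉G (suc i) v≡ with j , eq ← G.within i = v∉u (punchIn i₀ j) (trans v≡ eq)

          within : ∀ i → ∃[ j ] vertex (suc i) ≡ u j
          within zero    = i₀ , G.start
          within (suc i) with j , eq ← G.within i = punchIn i₀ j , eq

          distinct : Injective _≡_ _≡_ vertex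
          distinct {zero}  {zero}  eq = refl
          distinct {zero}  {suc j} eq = contradiction eq (v∉G j)
          distinct {suc i} {zero}  eq = contradiction (sym eq) (v∉G i)
          distinct {suc i} {suc j} eq = cong suc (G.distinct eq)

          entry-suc : ∀ i → entry g t vertex (suc i) ≡ entry g (suc (g v (u i₀))) G.vertex i
          entry-suc zero    = cong (suc ∘ g v) G.start
          entry-suc (suc i) = refl

          rises : ∀ i → entry g t vertex (inject₁ i) ≤ g (vertex (inject₁ i)) (vertex (suc i))
          rises zero    = subst (λ x → t ≤ g v x) (sym G.start) t≤y
          rises (suc i) = ≤-trans (≤-reflexive (entry-suc (inject₁ i))) (G.rises i)

          lowest : ∀ i j → (∀ l → l Fin.≤ inject₁ i → vertex l ≢ u j) →
                   entry g t vertex (inject₁ i) ≤ g (vertex (inject₁ i)) (u j) →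
                   g (vertex (inject₁ i)) (vertex (suc i)) ≤ g (vertex (inject₁ i)) (u j)
          lowest zero    j _ t≤ = subst (λ x → g v x ≤ g v (u j)) (sym G.start) (least j t≤)
          lowest (suc i) j fresh t≤ with i₀ Fin.≟ j
          ... | yes refl = contradiction G.start (fresh (suc zero) (s≤s z≤n))
          ... | no  i₀≢j = subst (λ x → (∀ l → l Fin.≤ inject₁ (suc i) → vertex l ≢ u x) →
              entry g t vertex (inject₁ (suc i)) ≤ g (vertex (inject₁ (suc i))) (u x) →
              g (vertex (inject₁ (suc i))) (vertex (suc (suc i))) ≤ g (vertex (inject₁ (suc i))) (u x))
            (Fin.punchIn-punchOut i₀≢j)
            (λ fresh t≤ → G.lowest i (punchOut i₀≢j) (λ l l≤i → fresh (suc l) (s≤s l≤i))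
              (≤-trans (≤-reflexive (sym (entry-suc (inject₁ i)))) t≤))
            fresh t≤

          stuck : ∀ j → (∀ l → vertex l ≢ u j) →
              g (vertex (fromℕ (suc k))) (u j) < entry g t vertex (fromℕ (suc k))
          stuck j fresh with i₀ Fin.≟ j
          ... | yes refl = contradiction G.start (fresh (suc zero))
          ... | no  i₀≢j = subst (λ x → (∀ l → vertex l ≢ u x) →
              g (vertex (fromℕ (suc k))) (u x) < entry g t vertex (fromℕ (suc k)))
            (Fin.punchIn-punchOut i₀≢j)
            (λ fresh → ≤-trans (G.stuck (punchOut i₀≢j) (fresh ∘ suc))
                (≤-reflexive (sym (entry-suc (fromℕ k)))))
            fresh

        prepend : Greedy g t v u (suc k)
        prepend = record
          { vertex = vertex ; start = refl ; within = within ; distinct = distinct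
          ; rises = rises ; lowest = lowest ; stuck = stuck }

      halted : ∀ {g : Labelling} {t v m} {u : Fin m → Fin n} → (∀ j → g v (u j) < t) → Greedy g t v u 0
      halted {v = v} below = record
        { vertex = λ _ → v ; start = refl ; within = λ () ; distinct = λ { {zero} {zero} _ → refl }
        ; rises = λ () ; lowest = λ () ; stuck = λ j _ → below j }

      -- If the wait overshoots, no label at v can be t or more, for it would have given a wait that
      -- fits; so the path halts. If the wait fits, the minimising label is not behind t by
      -- `distance-behind`, and among labels not behind t the order of distances is the order of
      -- labels.
      greedy : ∀ {g : Labelling} → (∀ x y → g x y < L) → ∀ m t v (u : Fin m → Fin n) → t ≤ L →
        (∀ j → v ≢ u j) → Injective _≡_ _≡_ u → Greedy g t v u (steps t (code g m t v u))
      greedy g< zero    t v u t≤L v∉u u-inj = halted (λ ())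
      greedy {g} g< (suc m) t v u t≤L v∉u u-inj = case t + wait r ≤? L of λ
        { (yes fits) → subst (Greedy g t v u) (sym (count-if-yes (t + wait r ≤? L) fits)) (continue fits)
        ; (no ¬fits) → subst (Greedy g t v u) (sym (count-if-no (t + wait r ≤? L) ¬fits))
            (halted (below ¬fits)) }
        where
        r = distances g t v u
        i₀ = argmin r
        ω = code-after g m t u r
        t+wait : t + wait r ≡ t + suc (toℕ (distance t (g v (u i₀))))
        t+wait = cong (λ d → t + suc d) (trans (sym (lookup-argmin r)) (cong toℕ (lookup-distances g t v u i₀)))
        wait-≤ : ∀ j → t ≤ g v (u j) → t + wait r ≤ suc (g v (u j))
        wait-≤ j t≤y = begin
          t + suc (minimum r)                        ≤⟨ +-monoʳ-≤ t (s≤s (minimum-≤ r j)) ⟩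
          t + suc (toℕ (lookup r j))
              ≡⟨ cong (λ d → t + suc (toℕ d)) (lookup-distances g t v u j) ⟩
          t + suc (toℕ (distance t (g v (u j))))     ≡⟨ distance-ahead′ t≤y (g< v (u j)) ⟩
          suc (g v (u j))                            ∎
          where open ≤-Reasoning
        below : ¬ t + wait r ≤ L → ∀ j → g v (u j) < t
        below ¬fits j = ≰⇒> (λ t≤y → ¬fits (≤-trans (wait-≤ j t≤y) (g< v (u j))))
        module _ (fits : t + wait r ≤ L) where
          t≤y₀ : t ≤ g v (u i₀)
          t≤y₀ with t ≤? g v (u i₀)
          ... | yes t≤y = t≤y
          ... | no  t≰y = contradiction
            (subst (_≤ L) (trans t+wait (distance-behind (≰⇒> t≰y) t≤L)) fits)
                (<⇒≱ (s≤s (m≤n+m L (g v (u i₀)))))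
          t+wait≡ : t + wait r ≡ suc (g v (u i₀))
          t+wait≡ = trans t+wait (distance-ahead′ t≤y₀ (g< v (u i₀)))
          continue : Greedy g t v u (suc (steps (advance t (wait r)) ω))
          continue = prepend i₀ v∉u t≤y₀ (λ j t≤y → s≤s⁻¹ (≤-trans (≤-reflexive (sym t+wait≡)) (wait-≤ j t≤y)))
            (subst (λ s → Greedy g s (u i₀) (u ∘ punchIn i₀) (steps (advance t (wait r)) ω))
              (trans (advance-+ t (wait r) fits) t+wait≡)
              (greedy g< m (advance t (wait r)) (u i₀) (u ∘ punchIn i₀) (advance-≤ t (wait r))
                (λ j eq → Fin.punchInᵢ≢i i₀ j (sym (u-inj eq)))
                    (λ eq → Fin.punchIn-injective i₀ _ _ (u-inj eq))))

-- Strictly increasing sequences and their number.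

module IncreasingSequences where

  open import Data.Fin as Fin using (Fin; zero; suc; toℕ)
  open import Data.List using (List; []; _∷_; _++_; length)
  import Data.List as List
  import Data.List.Properties as List
  import Data.List.Relation.Unary.All as All
  open All using (All; []; _∷_)
  import Data.List.Relation.Unary.All.Properties as All
  open import Data.List.Membership.Propositional using (_∈_)
  open import Data.List.Membership.Propositional.Properties using (∈-map⁻)
  open import Data.List.Relation.Unary.Unique.Propositional using (Unique)
  open import Data.List.Relation.Unary.AllPairs using ([]; _∷_)
  import Data.List.Relation.Unary.Unique.Propositional.Properties as Unique
  open import Data.Nat
  open import Data.Nat.Properties
  open import Data.Nat.Tactic.RingSolver using (solve-∀)
  open import Data.Product using (_,_; _×_; proj₂)
  open import Data.Vec using (Vec; []; _∷_; lookup; map)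
  open import Data.Vec.Properties using (lookup-map; ∷-injective)
  open import Function using (_∘_)
  open import Relation.Binary.PropositionalEquality

  Increasing : ∀ {M} → Vec ℕ M → Set
  Increasing h = ∀ i j → i Fin.< j → lookup h i < lookup h j

  -- The entries range over 0, …, D + M - 1.
  increasing : (M D : ℕ) → List (Vec ℕ M)
  increasing zero    D       = [] ∷ []
  increasing (suc M) zero    = List.map (λ h → 0 ∷ map suc h) (increasing M zero)
  increasing (suc M) (suc D) = List.map (λ h → 0 ∷ map suc h) (increasing M (suc D)) ++ List.map (map suc)
      (increasing (suc M) D)

  Below : ∀ {M} → ℕ → Vec ℕ M → Set
  Below L h = ∀ i → lookup h i < L

  shift-increasing : ∀ {M} {h : Vec ℕ M} → Increasing h → Increasing (map suc h)
  shift-increasing {h = h} inc i j i<j =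
    subst₂ _<_ (sym (lookup-map i suc h)) (sym (lookup-map j suc h)) (s≤s (inc i j i<j))

  shift-below : ∀ {M L} {h : Vec ℕ M} → Below L h → Below (suc L) (map suc h)
  shift-below {h = h} below i = subst (_< _) (sym (lookup-map i suc h)) (s≤s (below i))

  0∷-increasing : ∀ {M} {h : Vec ℕ M} → Increasing h → Increasing (0 ∷ map suc h)
  0∷-increasing {h = h} inc zero    (suc j) _         = subst (0 <_) (sym (lookup-map j suc h)) z<s
  0∷-increasing {h = h} inc (suc i) (suc j) (s≤s i<j) = shift-increasing {h = h} inc i j i<j

  0∷-below : ∀ {M L} {h : Vec ℕ M} → Below L h → Below (suc L) (0 ∷ map suc h)
  0∷-below below zero    = z<s
  0∷-below {h = h} below (suc i) = shift-below {h = h} below i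

  increasing-sound : ∀ M D → All (λ h → Increasing h × Below (D + M) h) (increasing M D)
  increasing-sound zero    D       = ((λ ()) , (λ ())) ∷ []
  increasing-sound (suc M) zero    = All.map⁺ (All.map
    (λ {h} (inc , below) → 0∷-increasing {h = h} inc , 0∷-below {h = h} below) (increasing-sound M zero))
  increasing-sound (suc M) (suc D) = All.++⁺
    (All.map⁺ (All.map (λ {h} (inc , below) → 0∷-increasing {h = h} inc ,
      subst (λ L → Below L (0 ∷ map suc h)) (sym (+-suc (suc D) M)) (0∷-below {h = h} below))
          (increasing-sound M (suc D))))
    (All.map⁺ (All.map (λ {h} (inc , below) → shift-increasing {h = h} inc , shift-below {h = h} below)
      (increasing-sound (suc M) D)))

  shift-injective : ∀ {M} {h h′ : Vec ℕ M} → map ℕ.suc h ≡ map ℕ.suc h′ → h ≡ h′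
  shift-injective {h = []}    {[]}     eq = refl
  shift-injective {h = x ∷ h} {y ∷ h′} eq with x≡y , eq′ ← ∷-injective eq =
    cong₂ _∷_ (suc-injective x≡y) (shift-injective eq′)

  increasing-unique : ∀ M D → Unique (increasing M D)
  increasing-unique zero    D       = [] ∷ []
  increasing-unique (suc M) zero    = Unique.map⁺ (λ eq → shift-injective (proj₂ (∷-injective eq)))
      (increasing-unique M zero)
  increasing-unique (suc M) (suc D) = Unique.++⁺
    (Unique.map⁺ (λ eq → shift-injective (proj₂ (∷-injective eq))) (increasing-unique M (suc D)))
    (Unique.map⁺ shift-injective (increasing-unique (suc M) D))
    (λ (∈₁ , ∈₂) → disjoint (∈-map⁻ _ ∈₁) (∈-map⁻ _ ∈₂))
    where
    open import Data.Empty using (⊥)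
    open import Data.Product using (∃)
    disjoint : ∀ {x : Vec ℕ (suc M)} → ∃ (λ h → h ∈ increasing M (suc D) × x ≡ 0 ∷ map suc h) →
      ∃ (λ h → h ∈ increasing (suc M) D × x ≡ map suc h) → ⊥
    disjoint (h , _ , refl) (_ ∷ _ , _ , ())

  -- Pascal's rule, according to whether 0 occurs as an entry, with the factorials multiplied up to
  -- avoid division.
  length-increasing : ∀ M D → length (increasing M D) * (M ! * D !) ≡ (D + M) !
  length-increasing zero    D       = trans (*-identityˡ _)
      (trans (*-identityˡ (D !)) (cong _! (sym (+-identityʳ D))))
  length-increasing (suc M) zero    = begin
    length (List.map (λ h → 0 ∷ map suc h) (increasing M zero)) * (suc M ! * 1)
      ≡⟨ cong (_* (suc M ! * 1)) (List.length-map _ (increasing M zero)) ⟩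
    c * (suc M * M ! * 1)
      ≡⟨ ring c M (M !) ⟩
    suc M * (c * (M ! * 1))
      ≡⟨ cong (suc M *_) (length-increasing M zero) ⟩
    suc M ! ∎
    where
    open ≡-Reasoning
    c = length (increasing M zero)
    ring : ∀ c M x → c * (suc M * x * 1) ≡ suc M * (c * (x * 1))
    ring = solve-∀
  length-increasing (suc M) (suc D) = begin
    length (increasing (suc M) (suc D)) * (suc M ! * suc D !)
      ≡⟨ cong (_* (suc M ! * suc D !)) (trans
          (List.length-++ (List.map (λ h → 0 ∷ map suc h) (increasing M (suc D))))
           (cong₂ _+_ (List.length-map _ (increasing M (suc D))) (List.length-map _ (increasing (suc M) D)))) ⟩
    (c₁ + c₂) * (suc M * M ! * (suc D * D !))
      ≡⟨ ring c₁ c₂ M (M !) D (D !) ⟩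
    suc M * (c₁ * (M ! * (suc D * D !))) + suc D * (c₂ * (suc M * M ! * D !))
      ≡⟨ cong₂ (λ x y → suc M * x + suc D * y) (length-increasing M (suc D)) (length-increasing (suc M) D) ⟩
    suc M * (suc D + M) ! + suc D * (D + suc M) !
      ≡⟨ cong (λ k → suc M * (suc D + M) ! + suc D * k !) (+-suc D M) ⟩
    suc M * (suc D + M) ! + suc D * (suc D + M) !
      ≡⟨ *-distribʳ-+ ((suc D + M) !) (suc M) (suc D) ⟨
    (suc M + suc D) * (suc D + M) !
      ≡⟨ cong₂ (λ j k → j * k !) (+-comm (suc M) (suc D)) (sym (+-suc D M)) ⟩
    (suc D + suc M) ! ∎
    where
    open ≡-Reasoning
    c₁ = length (increasing M (suc D))
    c₂ = length (increasing (suc M) D)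
    ring : ∀ c₁ c₂ M x D y → (c₁ + c₂) * (suc M * x * (suc D * y))
        ≡ suc M * (c₁ * (x * (suc D * y))) + suc D * (c₂ * (suc M * x * y))
    ring = solve-∀

  power-!-≤ : ∀ D M → D ^ M * D ! ≤ (D + M) !
  power-!-≤ D zero    = ≤-reflexive (trans (*-identityˡ (D !)) (cong _! (sym (+-identityʳ D))))
  power-!-≤ D (suc M) = begin
    D * D ^ M * D !          ≡⟨ *-assoc D (D ^ M) (D !) ⟩
    D * (D ^ M * D !)        ≤⟨ *-mono-≤ (m≤n⇒m≤1+n (m≤m+n D M)) (power-!-≤ D M) ⟩
    suc (D + M) !            ≡⟨ cong _! (+-suc D M) ⟨
    (D + suc M) !            ∎
    where open ≤-Reasoning

  -- For D > 0, division by D (D + x)ᵏ gives a form of Bernoulli's inequality, (1 + x/D)⁻ᵏ ≥ 1 - k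
  -- x/D.
  bernoulli : ∀ D x k → (D + x) ^ k * D ≤ D * D ^ k + k * x * (D + x) ^ k
  bernoulli D x zero    = ≤-reflexive (ring D)
    where
    ring : ∀ D → 1 * D ≡ D * 1 + 0
    ring = solve-∀
  bernoulli D x (suc k) = begin
    (D + x) * P * D                                  ≡⟨ ring₁ D x P ⟩
    D * (P * D) + x * P * D                          ≤⟨ +-monoˡ-≤ (x * P * D) (*-monoʳ-≤ D (bernoulli D x k)) ⟩
    D * (D * Q + k * x * P) + x * P * D              ≤⟨ m≤m+n _ (suc k * x * (x * P)) ⟩
    D * (D * Q + k * x * P) + x * P * D + suc k * x * (x * P)   ≡⟨ ring₂ D x k P Q ⟩
    D * (D * Q) + suc k * x * ((D + x) * P)          ∎
    where
    open ≤-Reasoning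
    P = (D + x) ^ k
    Q = D ^ k
    ring₁ : ∀ D x P → (D + x) * P * D ≡ D * (P * D) + x * P * D
    ring₁ = solve-∀
    ring₂ : ∀ D x k P Q → D * (D * Q + k * x * P) + x * P * D + suc k * x * (x * P)
        ≡ D * (D * Q) + suc k * x * ((D + x) * P)
    ring₂ = solve-∀

  -- By `bernoulli` with x = k = M the ratio of the two powers D ^ M and (D + M) ^ M is at least 1 -
  -- M²/D, hence at least 1/2. Adding two copies avoids the fraction.
  power-ratio : ∀ D M → .{{_ : NonZero D}} → 2 * (M * M) ≤ D → (D + M) ^ M ≤ 2 * D ^ M
  power-ratio D M 2M²≤D = *-cancelʳ-≤ _ _ D (+-cancelʳ-≤ (P * D) _ _ (begin
    P * D + P * D                                    ≤⟨ +-mono-≤ (bernoulli D M M) (bernoulli D M M) ⟩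
    (D * Q + M * M * P) + (D * Q + M * M * P)        ≡⟨ ring₁ D Q (M * M) P ⟩
    2 * Q * D + 2 * (M * M) * P                      ≤⟨ +-monoʳ-≤ (2 * Q * D) (*-monoˡ-≤ P 2M²≤D) ⟩
    2 * Q * D + D * P                                ≡⟨ cong (2 * Q * D +_) (*-comm D P) ⟩
    2 * Q * D + P * D                                ∎))
    where
    open ≤-Reasoning
    P = (D + M) ^ M
    Q = D ^ M
    ring₁ : ∀ D Q m P → (D * Q + m * P) + (D * Q + m * P) ≡ 2 * Q * D + 2 * m * P
    ring₁ = solve-∀

  -- The product on the right without the 2 counts injective labellings and equals (D + M)!/D!, a
  -- product of M factors above D.
  power-≤-lifts : ∀ D M → .{{_ : NonZero D}} → 2 * (M * M) ≤ D → (D + M) ^ M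
      ≤ 2 * (length (increasing M D) * M !)
  power-≤-lifts D M 2M²≤D = ≤-trans (power-ratio D M 2M²≤D)
      (*-monoʳ-≤ 2 (*-cancelʳ-≤ (D ^ M) (length (increasing M D) * M !) (D !) {{D !≢0}} (begin
    D ^ M * D !                                 ≤⟨ power-!-≤ D M ⟩
    (D + M) !                                   ≡⟨ length-increasing M D ⟨
    length (increasing M D) * (M ! * D !)       ≡⟨ *-assoc (length (increasing M D)) (M !) (D !) ⟨
    length (increasing M D) * M ! * D !         ∎)))
    where open ≤-Reasoning

  strictly-increasing-≥ : ∀ {M} (s : Fin M → ℕ) → (∀ i j → i Fin.< j → s i < s j) →
    ∀ c → (∀ i → c ≤ s i) → ∀ i → c + toℕ i ≤ s i
  strictly-increasing-≥ s inc c c≤ zero    = ≤-trans (≤-reflexive (+-identityʳ c)) (c≤ zero)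
  strictly-increasing-≥ s inc c c≤ (suc i) = ≤-trans (≤-reflexive (+-suc c (toℕ i)))
    (strictly-increasing-≥ (s ∘ suc) (λ i j i<j → inc (suc i) (suc j) (s≤s i<j)) (suc c)
      (λ i → ≤-<-trans (c≤ zero) (inc zero (suc i) z<s)) i)

-- Enumeration of edges and of edge orderings.

module Enumeration where

  open import Data.Fin as Fin using (Fin; zero; suc; punchIn; punchOut; splitAt; _↑ˡ_; _↑ʳ_; combine; remQuot)
  import Data.Fin.Properties as Fin
  open import Data.Fin.Permutation as Perm using (Permutation′; _⟨$⟩ʳ_; _≈_; insert; remove)
  open import Data.Nat
  open import Data.Nat.Combinatorics using (_C_; nC1≡n; nCk+nC[k+1]≡[n+1]C[k+1])
  open import Data.Nat.Properties
  open import Data.Product using (_,_; proj₁; proj₂; uncurry)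
  open import Data.Sum using (inj₁; inj₂; [_,_]′)
  open import Function using (_∘_; id)
  open import Function.Bundles using (_↔_; mk↔ₛ′; Inverse)
  open import Function.Construct.Composition using (_↔-∘_)
  open import Function.Construct.Symmetry using (↔-sym)
  open import Relation.Nullary using (yes; no; contradiction)
  open import Relation.Binary.PropositionalEquality

  edge-count : ℕ → ℕ
  edge-count zero    = 0
  edge-count (suc n) = n + edge-count n

  edge-count-C : ∀ n → edge-count n ≡ n C 2
  edge-count-C zero    = refl
  edge-count-C (suc n) = trans (cong₂ _+_ (sym (nC1≡n n)) (edge-count-C n)) (nCk+nC[k+1]≡[n+1]C[k+1] n 1)

  edge-index : ∀ {n} → Edge n → Fin (edge-count n)
  edge-index {suc n} (mkEdge zero    (suc j) _)  = j ↑ˡ edge-count n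
  edge-index {suc n} (mkEdge (suc i) (suc j) lt) = n ↑ʳ edge-index (mkEdge i j (s≤s⁻¹ lt))

  shift-edge : ∀ {n} → Edge n → Edge (suc n)
  shift-edge (mkEdge i j lt) = mkEdge (suc i) (suc j) (s≤s lt)

  indexed-edge : ∀ n → Fin (edge-count n) → Edge n
  indexed-edge (suc n) k = [ (λ j → mkEdge zero (suc j) z<s) , shift-edge ∘ indexed-edge n ]′ (splitAt n k)

  index-shift : ∀ {n} (e : Edge n) → edge-index (shift-edge e) ≡ n ↑ʳ edge-index e
  index-shift (mkEdge i j _) = refl

  indexed-index : ∀ {n} (e : Edge n) → indexed-edge n (edge-index e) ≡ e
  indexed-index {suc n} (mkEdge zero    (suc j) _)  rewrite Fin.splitAt-↑ˡ n j (edge-count n) = refl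
  indexed-index {suc n} (mkEdge (suc i) (suc j) lt)
    rewrite Fin.splitAt-↑ʳ n (edge-count n) (edge-index (mkEdge i j (s≤s⁻¹ lt)))
          | indexed-index (mkEdge i j (s≤s⁻¹ lt)) = refl

  index-indexed : ∀ n k → edge-index (indexed-edge n k) ≡ k
  index-indexed (suc n) k with splitAt n k in eq
  ... | inj₁ j  = trans (sym (cong (Fin.join n (edge-count n)) eq)) (Fin.join-splitAt n (edge-count n) k)
  ... | inj₂ k′ = trans (index-shift (indexed-edge n k′)) (trans (cong (n ↑ʳ_) (index-indexed n k′))
    (trans (sym (cong (Fin.join n (edge-count n)) eq)) (Fin.join-splitAt n (edge-count n) k)))

  edges : ∀ n → Edge n ↔ Fin (n C 2)
  edges n = subst (λ k → Edge n ↔ Fin k) (edge-count-C n)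
    (mk↔ₛ′ edge-index (indexed-edge n) (index-indexed n) indexed-index)

  insert-cong : ∀ {n} i j {π ρ : Permutation′ n} → π ≈ ρ → insert i j π ≈ insert i j ρ
  insert-cong i j π≈ρ k with i Fin.≟ k
  ... | yes _   = refl
  ... | no  i≢k = cong (punchIn j) (π≈ρ (punchOut i≢k))

  remove-cong : ∀ {n} i {π ρ : Permutation′ (suc n)} → π ≈ ρ → remove i π ≈ remove i ρ
  remove-cong i {π} {ρ} π≈ρ k = punchOut-cong₂ (π≈ρ i) (π≈ρ (punchIn i k))
    where
    punchOut-cong₂ : ∀ {n} {i i′ j j′ : Fin (suc n)} {p : i ≢ j} {q : i′ ≢ j′} → i ≡ i′ → j ≡ j′ → punchOut p
        ≡ punchOut q
    punchOut-cong₂ {i = i} refl eq = Fin.punchOut-cong i eq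

  insert-at : ∀ {n} i j (π : Permutation′ n) → insert i j π ⟨$⟩ʳ i ≡ j
  insert-at i j π with i Fin.≟ i
  ... | yes _   = refl
  ... | no  i≢i = contradiction refl i≢i

  -- Factorial number system: the leading digit of the index is the image of `zero`, and the
  -- remaining digits encode the permutation left when `zero` and its image are removed.
  permutation : ∀ n → Fin (n !) → Permutation′ n
  permutation zero    _ = Perm.id
  permutation (suc n) i = uncurry (λ j k → insert zero j (permutation n k)) (remQuot (n !) i)

  rank : ∀ n → Permutation′ n → Fin (n !)
  rank zero    π = zero
  rank (suc n) π = combine (π ⟨$⟩ʳ zero) (rank n (remove zero π))

  rank-cong : ∀ n {π ρ : Permutation′ n} → π ≈ ρ → rank n π ≡ rank n ρ
  rank-cong zero    π≈ρ = refl
  rank-cong (suc n) {π} {ρ} π≈ρ = cong₂ combine (π≈ρ zero) (rank-cong n (remove-cong zero {π} {ρ} π≈ρ))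

  permutation-rank : ∀ n (π : Permutation′ n) → permutation n (rank n π) ≈ π
  permutation-rank (suc n) π k = begin
    permutation (suc n) (rank (suc n) π) ⟨$⟩ʳ k
      ≡⟨ cong (λ (i , j) → insert zero i (permutation n j) ⟨$⟩ʳ k)
           (Fin.remQuot-combine {suc n} {n !} (π ⟨$⟩ʳ zero) (rank n (remove zero π))) ⟩
    insert zero (π ⟨$⟩ʳ zero) (permutation n (rank n (remove zero π))) ⟨$⟩ʳ k
      ≡⟨ insert-cong zero (π ⟨$⟩ʳ zero) {permutation n (rank n (remove zero π))} {remove zero π}
           (permutation-rank n (remove zero π)) k ⟩
    insert zero (π ⟨$⟩ʳ zero) (remove zero π) ⟨$⟩ʳ k
      ≡⟨ Perm.insert-remove zero π k ⟩
    π ⟨$⟩ʳ k ∎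
    where open ≡-Reasoning

  rank-permutation : ∀ n i → rank n (permutation n i) ≡ i
  rank-permutation zero    zero = refl
  rank-permutation (suc n) i = trans
    (cong₂ combine (insert-at zero q ρ) (trans (rank-cong n (Perm.remove-insert zero q ρ))
        (rank-permutation n r)))
    (Fin.combine-remQuot {suc n} (n !) i)
    where
    q = proj₁ (remQuot {suc n} (n !) i)
    r = proj₂ (remQuot {suc n} (n !) i)
    ρ = permutation n r

  ordering-count : ℕ → ℕ
  ordering-count n = (n C 2) !

  ordering : ∀ n → Fin (ordering-count n) → EdgeOrdering n
  ordering n i = permutation (n C 2) i ↔-∘ edges n

  orderings-enumeration : ∀ n → Inverse (setoid (Fin (ordering-count n))) (edgeOrderings n)
  orderings-enumeration n = record
    { to        = ordering n
    ; from      = λ f → rank (n C 2) (f ↔-∘ ↔-sym (edges n))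
    ; to-cong   = λ { refl _ → refl }
    ; from-cong = λ f≈g → rank-cong (n C 2) (λ k → f≈g (Inverse.from (edges n) k))
    ; inverse   = (λ { {f} refl e → trans (permutation-rank (n C 2) (f ↔-∘ ↔-sym (edges n))
        (Inverse.to (edges n) e))
                                       (cong (Inverse.to f) (Inverse.strictlyInverseʳ (edges n) e)) })
                , (λ {i} f≈ → trans (rank-cong (n C 2) (λ k → trans (f≈ (Inverse.from (edges n) k))
                     (cong (permutation (n C 2) i ⟨$⟩ʳ_) (Inverse.strictlyInverseˡ (edges n) k))))
                         (rank-permutation (n C 2) i))
    }

  ordering-injective : ∀ n {i j} → (∀ e → Inverse.to (ordering n i) e ≡ Inverse.to (ordering n j) e) → i ≡ j
  ordering-injective n {i} {j} eq = trans (sym (Inverse.strictlyInverseʳ (orderings-enumeration n) i))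
    (trans (Inverse.from-cong (orderings-enumeration n) {ordering n i} {ordering n j} eq)
      (Inverse.strictlyInverseʳ (orderings-enumeration n) j))

-- Encoding an ordering together with a lift as an array.

module Encoding where

  open Arrays
  open GreedyCode
  open IncreasingSequences
  open Enumeration
  open import Data.Empty using (⊥-elim-irr)
  open import Data.Fin as Fin using (Fin; zero; suc; toℕ; inject₁; fromℕ; punchIn; punchOut)
  import Data.Fin.Properties as Fin
  open import Data.Nat
  open import Data.Nat.Combinatorics using (_C_)
  open import Data.Nat.Properties
  open import Data.Product using (∃-syntax; Σ-syntax; _,_; _×_; proj₁; proj₂)
  open import Data.Sum using (_⊎_; inj₁; inj₂)
  open import Data.Vec using (Vec; lookup)
  open import Data.Vec.Properties using (tabulate∘lookup; tabulate-cong)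
  open import Function using (_∘_)
  open import Function.Bundles using (Inverse)
  open import Relation.Binary using (tri<; tri≈; tri>)
  open import Relation.Nullary using (yes; no; contradiction)
  open import Relation.Binary.PropositionalEquality

  edge-sym : ∀ {n} {x y : Fin n} .(p : x ≢ y) .(q : y ≢ x) → edge x y p ≡ edge y x q
  edge-sym {x = x} {y} p q with Fin.<-cmp x y | Fin.<-cmp y x
  ... | tri< _ _ _     | tri> _ _ _     = refl
  ... | tri> _ _ _     | tri< _ _ _     = refl
  ... | tri< x<y _ _   | tri< _ _ x≮y   = contradiction x<y x≮y
  ... | tri> _ _ y<x   | tri> y≮x _ _   = contradiction y<x y≮x
  ... | tri≈ _ x≡y _   | _              = ⊥-elim-irr (p x≡y)
  ... | tri< _ x≢y _   | tri≈ _ y≡x _   = contradiction (sym y≡x) x≢y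
  ... | tri> _ x≢y _   | tri≈ _ y≡x _   = contradiction (sym y≡x) x≢y

  edge-< : ∀ {n} {x y : Fin n} .(x<y : x Fin.< y) .(p : x ≢ y) → edge x y p ≡ mkEdge x y x<y
  edge-< {x = x} {y} x<y p with Fin.<-cmp x y
  ... | tri< _ _ _   = refl
  ... | tri≈ x≮y _ _ = ⊥-elim-irr (x≮y x<y)
  ... | tri> x≮y _ _ = ⊥-elim-irr (x≮y x<y)

  -- Serves to tell an edge that leads to an unvisited vertex from the last edge of the path.
  edge-endpoint : ∀ {n} {x y z w : Fin n} .{p : x ≢ y} .{q : z ≢ w} → edge x y p ≡ edge z w q → y ≡ z ⊎ y ≡ w
  edge-endpoint {x = x} {y} {z} {w} {p} {q} eq with Fin.<-cmp x y | Fin.<-cmp z w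
  ... | tri< _ _ _   | tri< _ _ _   = inj₂ (cong Edge.upper eq)
  ... | tri< _ _ _   | tri> _ _ _   = inj₁ (cong Edge.upper eq)
  ... | tri> _ _ _   | tri< _ _ _   = inj₁ (cong Edge.lower eq)
  ... | tri> _ _ _   | tri> _ _ _   = inj₂ (cong Edge.lower eq)
  ... | tri≈ _ x≡y _ | _            = ⊥-elim-irr (p x≡y)
  ... | tri< _ _ _   | tri≈ _ z≡w _ = ⊥-elim-irr (q z≡w)
  ... | tri> _ _ _   | tri≈ _ z≡w _ = ⊥-elim-irr (q z≡w)

  increasing-reflects-< : ∀ {M} {h : Vec ℕ M} → Increasing h → ∀ i j → lookup h i < lookup h j → i Fin.< j
  increasing-reflects-< {h = h} inc i j lt with Fin.<-cmp i j
  ... | tri< i<j _ _  = i<j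
  ... | tri≈ _ refl _ = contradiction lt (<-irrefl refl)
  ... | tri> _ _ j<i  = contradiction (inc j i j<i) (<-asym lt)

  module _ {n : ℕ} where

    -- Junk value 0 when x = y.
    relabel : EdgeOrdering n → Vec ℕ (n C 2) → Fin n → Fin n → ℕ
    relabel f h x y with x Fin.≟ y
    ... | yes _   = 0
    ... | no  x≢y = lookup h (Inverse.to f (edge x y x≢y))

    relabel-edge : ∀ f h x y .(x≢y : x ≢ y) → relabel f h x y ≡ lookup h (Inverse.to f (edge x y x≢y))
    relabel-edge f h x y x≢y with x Fin.≟ y
    ... | yes x≡y = ⊥-elim-irr (x≢y x≡y)
    ... | no  _   = refl

    relabel-< : ∀ f h {L} → 0 < L → Below L h → ∀ x y → relabel f h x y < L
    relabel-< f h 0<L below x y with x Fin.≟ y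
    ... | yes _   = 0<L
    ... | no  x≢y = below (Inverse.to f (edge x y x≢y))

    relabel-sym : ∀ f h x y → relabel f h x y ≡ relabel f h y x
    relabel-sym f h x y with x Fin.≟ y | y Fin.≟ x
    ... | yes _   | yes _   = refl
    ... | yes x≡y | no  y≢x = contradiction (sym x≡y) y≢x
    ... | no  x≢y | yes y≡x = contradiction (sym y≡x) x≢y
    ... | no  x≢y | no  y≢x = cong (lookup h ∘ Inverse.to f) (edge-sym x≢y y≢x)

    -- Since a lift is increasing, the lifted labels order the edges as the ordering does; this
    -- recovers the ordering as the rank of each edge, and then the lift as the list of values.
    relabel-determines : ∀ (f f′ : EdgeOrdering n) {h h′} → Increasing h → Increasing h′ →
      (∀ x y → x ≢ y → relabel f h x y ≡ relabel f′ h′ x y) →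
      (∀ e → Inverse.to f e ≡ Inverse.to f′ e) × h ≡ h′
    relabel-determines f f′ {h} {h′} inc inc′ same = same-order , same-lift
      where
      edges-same : ∀ e → lookup h (Inverse.to f e) ≡ lookup h′ (Inverse.to f′ e)
      edges-same (mkEdge x y x<y) = begin
        lookup h (Inverse.to f (mkEdge x y x<y))      ≡⟨ cong (lookup h ∘ Inverse.to f) (edge-< x<y x≢y) ⟨
        lookup h (Inverse.to f (edge x y x≢y))        ≡⟨ relabel-edge f h x y x≢y ⟨
        relabel f h x y                               ≡⟨ same x y x≢y ⟩
        relabel f′ h′ x y                             ≡⟨ relabel-edge f′ h′ x y x≢y ⟩
        lookup h′ (Inverse.to f′ (edge x y x≢y))      ≡⟨ cong (lookup h′ ∘ Inverse.to f′) (edge-< x<y x≢y) ⟩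
        lookup h′ (Inverse.to f′ (mkEdge x y x<y))    ∎
        where
        open ≡-Reasoning
        x≢y : x ≢ y
        x≢y refl = ⊥-elim-irr (<-irrefl refl x<y)
      -- f′ ∘ f⁻¹ is an increasing self-map of Fin (n C 2), hence inflationary.
      ≤-order : ∀ {f f′ : EdgeOrdering n} {h h′} → Increasing h → Increasing h′ →
        (∀ e → lookup h (Inverse.to f e) ≡ lookup h′ (Inverse.to f′ e)) → ∀ e →
            Inverse.to f e Fin.≤ Inverse.to f′ e
      ≤-order {f} {f′} {h} {h′} inc inc′ eqs e = subst (λ e′ → toℕ (Inverse.to f e) ≤ toℕ (Inverse.to f′ e′))
        (Inverse.strictlyInverseʳ f e)
        (strictly-increasing-≥ (toℕ ∘ s) s-inc 0 (λ _ → z≤n) (Inverse.to f e))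
        where
        s : Fin (n C 2) → Fin (n C 2)
        s i = Inverse.to f′ (Inverse.from f i)
        lookup-s : ∀ i → lookup h i ≡ lookup h′ (s i)
        lookup-s i = trans (cong (lookup h) (sym (Inverse.strictlyInverseˡ f i))) (eqs (Inverse.from f i))
        s-inc : ∀ i j → i Fin.< j → s i Fin.< s j
        s-inc i j i<j = increasing-reflects-< {h = h′} inc′ (s i) (s j)
            (subst₂ _<_ (lookup-s i) (lookup-s j) (inc i j i<j))
      same-order : ∀ e → Inverse.to f e ≡ Inverse.to f′ e
      same-order e = Fin.≤-antisym (≤-order {f} {f′} {h} {h′} inc inc′ edges-same e)
                                   (≤-order {f′} {f} {h′} {h} inc′ inc (sym ∘ edges-same) e)
      same-lift : h ≡ h′
      same-lift = trans (sym (tabulate∘lookup h)) (trans (tabulate-cong (λ i → begin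
        lookup h i                                           ≡⟨ cong (lookup h) (Inverse.strictlyInverseˡ f i) ⟨
        lookup h (Inverse.to f (Inverse.from f i))           ≡⟨ edges-same (Inverse.from f i) ⟩
        lookup h′ (Inverse.to f′ (Inverse.from f i))
            ≡⟨ cong (lookup h′) (same-order (Inverse.from f i)) ⟨
        lookup h′ (Inverse.to f (Inverse.from f i))
            ≡⟨ cong (lookup h′) (Inverse.strictlyInverseˡ f i) ⟩
        lookup h′ i                                          ∎)) (tabulate∘lookup h′))
        where open ≡-Reasoning

  module _ {ℓ m : ℕ} (v₀ : Fin (suc m)) where

    encode : EdgeOrdering (suc m) → Vec ℕ (suc m C 2) → Array (suc ℓ) m
    encode f h = code (relabel f h) m 0 v₀ (punchIn v₀)

    encode-injective : ∀ f f′ {h h′} → Increasing h → Increasing h′ → Below (suc ℓ) h → Below (suc ℓ) h′ →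
      encode f h ≡ encode f′ h′ → (∀ e → Inverse.to f e ≡ Inverse.to f′ e) × h ≡ h′
    encode-injective f f′ {h} {h′} inc inc′ below below′ eq = relabel-determines f f′ inc inc′ same
      where
      determined = code-determines (relabel-< f h z<s below) (relabel-< f′ h′ z<s below′)
        (relabel-sym f h) (relabel-sym f′ h′) m 0 v₀ (punchIn v₀) z≤n eq
      same : ∀ x y → x ≢ y → relabel f h x y ≡ relabel f′ h′ x y
      same x y x≢y with v₀ Fin.≟ x | v₀ Fin.≟ y
      ... | yes refl | yes refl = contradiction refl x≢y
      ... | yes refl | no  v≢y  = subst (λ z → relabel f h v₀ z ≡ relabel f′ h′ v₀ z)
        (Fin.punchIn-punchOut v≢y) (proj₁ determined (punchOut v≢y))
      ... | no  v≢x  | yes refl = trans (relabel-sym f h x v₀) (trans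
        (subst (λ z → relabel f h v₀ z ≡ relabel f′ h′ v₀ z) (Fin.punchIn-punchOut v≢x)
            (proj₁ determined (punchOut v≢x)))
        (relabel-sym f′ h′ v₀ x))
      ... | no  v≢x  | no  v≢y  = subst₂ (λ w z → relabel f h w z ≡ relabel f′ h′ w z)
        (Fin.punchIn-punchOut v≢x) (Fin.punchIn-punchOut v≢y)
        (proj₂ determined (punchOut v≢x) (punchOut v≢y) (x≢y ∘ Fin.punchOut-injective v≢x v≢y))

    module _ (f : EdgeOrdering (suc m)) {h : Vec ℕ (suc m C 2)} (inc : Increasing h) where

      private
        g = relabel f h

        label-≤ : ∀ e e′ → lookup h (Inverse.to f e) ≤ lookup h (Inverse.to f e′) → label f e ≤ label f e′
        label-≤ e e′ le = s≤s (≮⇒≥ (λ lt → <⇒≱ (inc _ _ lt) le))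

        label-< : ∀ e e′ → lookup h (Inverse.to f e) < lookup h (Inverse.to f e′) → label f e < label f e′
        label-< e e′ lt = s≤s (increasing-reflects-< {h = h} inc (Inverse.to f e) (Inverse.to f e′) lt)

        lookup-< : ∀ e e′ → label f e < label f e′ → lookup h (Inverse.to f e) < lookup h (Inverse.to f e′)
        lookup-< e e′ (s≤s lt) = inc _ _ lt

      -- An increasing lift preserves and reflects the order of labels, and being a greedy path
      -- depends on comparisons of labels only.
      greedyPath : ∀ k → Greedy {ℓ} g 0 v₀ (punchIn v₀) (suc k) → Σ[ P ∈ GreedyPath f v₀ ] GreedyPath.length P
          ≡ suc k
      greedyPath k G = record
        { t-1 = k
        ; path = path
        ; start = G.start
        ; first-lowest = λ x v₀≢x → label-≤ (step zero) (edge v₀ x v₀≢x) (first-lowest x v₀≢x)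
        ; increasing = λ i → label-< (step (inject₁ i)) (step (suc i))
            (subst₂ _<_ (g-step (inject₁ i)) (g-step (suc i)) (G.rises (suc i)))
        ; next-lowest = next-lowest
        ; stuck = stuck
        } , refl
        where
        module G = Greedy G
        path : Path (suc m) (suc k)
        path = record { vertex = G.vertex ; distinct = G.distinct }
        open Path path using (step)

        g-step : ∀ i → g (G.vertex (inject₁ i)) (G.vertex (suc i)) ≡ lookup h (Inverse.to f (step i))
        g-step i = relabel-edge f h (G.vertex (inject₁ i)) (G.vertex (suc i))
            (λ eq → inject₁≢suc i (G.distinct eq))

        unvisited : ∀ {x} → v₀ ≢ x → ∃[ j ] punchIn v₀ j ≡ x
        unvisited v₀≢x = punchOut v₀≢x , Fin.punchIn-punchOut v₀≢x

        first-lowest : ∀ x → .(v₀≢x : v₀ ≢ x) → lookup h (Inverse.to f (step zero))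
            ≤ lookup h (Inverse.to f (edge v₀ x v₀≢x))
        first-lowest x v₀≢x with v₀ Fin.≟ x
        ... | yes v₀≡x = ⊥-elim-irr (v₀≢x v₀≡x)
        ... | no  v₀≢x′ with j , refl ← unvisited v₀≢x′ = begin
          lookup h (Inverse.to f (step zero))                 ≡⟨ g-step zero ⟨
          g (G.vertex zero) (G.vertex (suc zero))             ≤⟨ G.lowest zero j fresh z≤n ⟩
          g (G.vertex zero) (punchIn v₀ j)                    ≡⟨ cong (λ v → g v (punchIn v₀ j)) G.start ⟩
          g v₀ (punchIn v₀ j)                                 ≡⟨ relabel-edge f h v₀ (punchIn v₀ j) v₀≢x ⟩
          lookup h (Inverse.to f (edge v₀ (punchIn v₀ j) v₀≢x)) ∎
          where
          open ≤-Reasoning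
          fresh : ∀ l → l Fin.≤ inject₁ (zero {n = k}) → G.vertex l ≢ punchIn v₀ j
          fresh zero _ eq = v₀≢x′ (trans (sym G.start) eq)

        next-lowest : ∀ (i : Fin k) x →
          let k′ = suc (inject₁ i) in
          (x∉ : ∀ j → j Fin.≤ k′ → G.vertex j ≢ x) →
          let xy = edge (G.vertex k′) x (x∉ k′ ≤-refl) in
          label f (step (inject₁ i)) < label f xy → label f (step (suc i)) ≤ label f xy
        next-lowest i x x∉ lt with unvisited (λ v₀≡x → x∉ zero z≤n (trans G.start v₀≡x))
        ... | j , refl = label-≤ (step (suc i)) xy (subst₂ _≤_ (g-step (suc i)) g-xy
          (G.lowest (suc i) j x∉ (subst₂ _<_ (sym (g-step (inject₁ i))) (sym g-xy)
              (lookup-< (step (inject₁ i)) xy lt))))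
          where
          xy = edge (G.vertex (suc (inject₁ i))) (punchIn v₀ j) (x∉ (suc (inject₁ i)) ≤-refl)
          g-xy = relabel-edge f h (G.vertex (suc (inject₁ i))) (punchIn v₀ j) (x∉ (suc (inject₁ i)) ≤-refl)

        stuck : ∀ x → (x∉ : ∀ j → G.vertex j ≢ x) →
          let last = fromℕ (suc k) in
          label f (edge (G.vertex last) x (x∉ last)) < label f (step (fromℕ k))
        stuck x x∉ with unvisited (λ v₀≡x → x∉ zero (trans G.start v₀≡x))
        -- The clock is one more than the last label, so `G.stuck` yields only a weak inequality.
        -- Strictness comes from injectivity of `f`: the two edges differ, as one of them leads off
        -- the path.
        ... | j , refl = s≤s (≤∧≢⇒< (s≤s⁻¹ (label-≤ last (step (fromℕ k)) le)) different)
          where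
          last = edge (G.vertex (suc (fromℕ k))) (punchIn v₀ j) (x∉ (suc (fromℕ k)))
          different : toℕ (Inverse.to f last) ≢ toℕ (Inverse.to f (step (fromℕ k)))
          different eq with edge-endpoint {x = G.vertex (suc (fromℕ k))} {p = x∉ (suc (fromℕ k))}
              {q = λ eq → inject₁≢suc (fromℕ k) (G.distinct eq)} (trans (sym (Inverse.strictlyInverseʳ f last))
            (trans (cong (Inverse.from f) (Fin.toℕ-injective eq))
                (Inverse.strictlyInverseʳ f (step (fromℕ k)))))
          ... | inj₁ x≡ = x∉ (inject₁ (fromℕ k)) (sym x≡)
          ... | inj₂ x≡ = x∉ (suc (fromℕ k)) (sym x≡)
          le : lookup h (Inverse.to f last) ≤ lookup h (Inverse.to f (step (fromℕ k)))
          le = subst₂ _≤_ (relabel-edge f h (G.vertex (suc (fromℕ k))) (punchIn v₀ j) (x∉ (suc (fromℕ k))))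
              (g-step (fromℕ k))
            (s≤s⁻¹ (G.stuck j x∉))

-- Counting exceptional orderings.

module Counting where

  open Arrays
  open GreedyCode
  open IncreasingSequences
  open Enumeration
  open Encoding
  open import Data.Fin as Fin using (Fin; zero; suc; punchIn)
  import Data.Fin.Properties as Fin
  open import Data.Fin.Subset using () renaming (∣_∣ to card)
  open import Data.List using (List; []; _∷_; length; filter; allFin; tabulate; lookup; cartesianProduct)
  import Data.List.Relation.Unary.All as All
  open All using (All; []; _∷_)
  open import Data.List.Relation.Unary.Any as Any using (Any; any?; here; there)
  open import Data.List.Relation.Unary.Any.Properties using (lookup-index)
  open import Data.List.Membership.Propositional using (_∈_; lose)
  open import Data.List.Membership.Propositional.Properties
    using (∈-allFin; ∈-cartesianProduct⁺; ∈-cartesianProduct⁻; ∈-cartesianProductWith⁺; ∈-filter⁺; ∈-filter⁻;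
        ∈-lookup)
  open import Data.List.Relation.Unary.AllPairs using ([]; _∷_)
  open import Data.List.Relation.Unary.Unique.Propositional using (Unique)
  import Data.List.Relation.Unary.Unique.Propositional.Properties as Unique
  open import Data.Nat
  open import Data.Nat.Combinatorics using (_C_)
  open import Data.Nat.Properties
  open import Data.Nat.Tactic.RingSolver using (solve-∀)
  open import Data.Product using (Σ-syntax; _,_; _×_; proj₁; proj₂)
  open import Data.Sum using (_⊎_; inj₁; inj₂)
  open import Data.Unit using (tt)
  import Data.Vec as Vec
  open import Function using (_∘_)
  open import Relation.Nullary using (¬_; yes; no; does; contradiction; _⊎-dec_; ¬?)
  open import Relation.Nullary.Decidable using (decidable-stable)
  open import Relation.Unary using (Decidable)
  open import Relation.Binary.PropositionalEquality

  unique-lookup-injective : ∀ {A : Set} {xs : List A} → Unique xs → ∀ i j → lookup xs i ≡ lookup xs j → i ≡ j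
  unique-lookup-injective (_ ∷ _)   zero    zero    eq = refl
  unique-lookup-injective (x∉ ∷ _)  zero    (suc j) eq = contradiction eq (All.lookup x∉ (∈-lookup j))
  unique-lookup-injective (x∉ ∷ _)  (suc i) zero    eq = contradiction (sym eq) (All.lookup x∉ (∈-lookup i))
  unique-lookup-injective (_ ∷ xs!) (suc i) (suc j) eq = cong suc (unique-lookup-injective xs! i j eq)

  length-≤ : ∀ {A B : Set} {xs : List A} {ys : List B} (f : A → B) → Unique xs →
    (∀ {x} → x ∈ xs → f x ∈ ys) → (∀ {x y} → x ∈ xs → y ∈ xs → f x ≡ f y → x ≡ y) → length xs ≤ length ys
  length-≤ {xs = xs} {ys} f xs! f∈ f-inj = Fin.injective⇒≤ {f = index} index-injective
    where
    index : Fin (length xs) → Fin (length ys)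
    index i = Any.index (f∈ (∈-lookup {xs = xs} i))
    index-injective : ∀ {i j} → index i ≡ index j → i ≡ j
    index-injective {i} {j} eq = unique-lookup-injective xs! i j (f-inj (∈-lookup i) (∈-lookup j) (begin
      f (lookup xs i)       ≡⟨ lookup-index (f∈ (∈-lookup {xs = xs} i)) ⟩
      lookup ys (index i)   ≡⟨ cong (lookup ys) eq ⟩
      lookup ys (index j)   ≡⟨ lookup-index (f∈ (∈-lookup {xs = xs} j)) ⟨
      f (lookup xs j)       ∎))
      where open ≡-Reasoning

  ∈-rows : ∀ L m (r : Row L m) → r ∈ rows L m
  ∈-rows L zero    Vec.[]        = here refl
  ∈-rows L (suc m) (y Vec.∷ r)   = ∈-cartesianProductWith⁺ Vec._∷_ (∈-allFin y) (∈-rows L m r)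

  ∈-arrays : ∀ L m (ω : Array L m) → ω ∈ arrays L m
  ∈-arrays L zero    tt      = here refl
  ∈-arrays L (suc m) (r , ω) = ∈-cartesianProduct⁺ (∈-rows L (suc m) r) (∈-arrays L m ω)

  module _ {A : Set} where

    length-filter-⊎ : ∀ {P Q : A → Set} (P? : Decidable P) (Q? : Decidable Q) xs →
      length (filter (λ x → P? x ⊎-dec Q? x) xs) ≤ length (filter P? xs) + length (filter Q? xs)
    length-filter-⊎ P? Q? []       = z≤n
    length-filter-⊎ P? Q? (x ∷ xs) with P? x | Q? x
    ... | yes _ | yes _ = s≤s (≤-trans (length-filter-⊎ P? Q? xs) (+-monoʳ-≤ (length (filter P? xs)) (n≤1+n _)))
    ... | yes _ | no  _ = s≤s (length-filter-⊎ P? Q? xs)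
    ... | no  _ | yes _ = ≤-trans (s≤s (length-filter-⊎ P? Q? xs))
        (≤-reflexive (sym (+-suc (length (filter P? xs)) _)))
    ... | no  _ | no  _ = length-filter-⊎ P? Q? xs

    card-tabulate : ∀ {P : A → Set} (P? : Decidable P) n (f : Fin n → A) →
      card (Vec.tabulate (does ∘ P? ∘ f)) + length (filter (¬? ∘ P?) (tabulate f)) ≡ n
    card-tabulate P? zero    f = refl
    card-tabulate P? (suc n) f with P? (f zero)
    ... | yes _ = cong suc (card-tabulate P? n (f ∘ suc))
    ... | no  _ = trans (+-suc _ _) (cong suc (card-tabulate P? n (f ∘ suc)))

  triangle≡edge-count : ∀ m → triangle m ≡ edge-count (suc m)
  triangle≡edge-count zero    = refl
  triangle≡edge-count (suc m) = cong (suc m +_) (triangle≡edge-count m)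

  module _ {m : ℕ} (v₀ : Fin (suc m)) (D′ : ℕ) (k₋ k₊ : ℕ) where

    private
      M D ℓ L : ℕ
      M = suc m C 2
      D = suc D′
      ℓ = D′ + M
      L = suc ℓ

    Late Early Off : Array L m → Set
    Late  ω = L < waits k₋ ω
    Early ω = waits k₊ ω ≤ L
    Off   ω = Late ω ⊎ Early ω

    late? : Decidable Late
    late? ω = L <? waits k₋ ω

    early? : Decidable Early
    early? ω = waits k₊ ω ≤? L

    off? : Decidable Off
    off? ω = late? ω ⊎-dec early? ω

    -- One good lift suffices, because the conclusion concerns the path of `f` itself. Asking for no
    -- more makes every lift of an exception off, so each exception is counted once per lift.
    Typical : EdgeOrdering (suc m) → Set
    Typical f = Any (λ h → ¬ Off (encode v₀ f h)) (increasing M D)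

    typical? : Decidable Typical
    typical? f = any? (λ h → ¬? (off? (encode v₀ f h))) (increasing M D)

    exceptions : List (Fin (ordering-count (suc m)))
    exceptions = filter (¬? ∘ typical? ∘ ordering (suc m)) (allFin (ordering-count (suc m)))

    -- Each exceptional ordering yields an off array for each of its lifts, and all these
    -- arrays are distinct.
    exceptions-encode : length exceptions * length (increasing M D) ≤ length (filter off? (arrays L m))
    exceptions-encode = ≤-trans (≤-reflexive (sym (length-cartesianProduct _,_ exceptions (increasing M D))))
      (length-≤ enc
        (Unique.cartesianProduct⁺ (Unique.filter⁺ (¬? ∘ typical? ∘ ordering (suc m)) (Unique.allFin⁺ _))
            (increasing-unique M D))
        (λ {x} x∈ → ∈-filter⁺ off? (∈-arrays L m (enc x)) (enc-off x∈)) enc-injective)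
      where
      enc : Fin (ordering-count (suc m)) × Vec.Vec ℕ M → Array L m
      enc (i , h) = encode v₀ (ordering (suc m) i) h
      exceptional : ∀ {i} → i ∈ exceptions → ¬ Typical (ordering (suc m) i)
      exceptional = proj₂ ∘ ∈-filter⁻ (¬? ∘ typical? ∘ ordering (suc m)) {xs = allFin (ordering-count (suc m))}
      enc-off : ∀ {x} → x ∈ cartesianProduct exceptions (increasing M D) → Off (enc x)
      enc-off {x} x∈ = decidable-stable (off? (enc x)) (λ ¬off →
        exceptional (proj₁ (∈-cartesianProduct⁻ exceptions (increasing M D) x∈))
          (lose (proj₂ (∈-cartesianProduct⁻ exceptions (increasing M D) x∈)) ¬off))
      sound : ∀ {x} → x ∈ cartesianProduct exceptions (increasing M D) →
          Increasing (proj₂ x) × Below L (proj₂ x)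
      sound x∈ = All.lookup (increasing-sound M D) (proj₂ (∈-cartesianProduct⁻ exceptions (increasing M D) x∈))
      enc-injective : ∀ {x y} → x ∈ cartesianProduct exceptions (increasing M D) →
        y ∈ cartesianProduct exceptions (increasing M D) → enc x ≡ enc y → x ≡ y
      enc-injective {x} {y} x∈ y∈ eq = cong₂ _,_ (ordering-injective (suc m) (proj₁ same)) (proj₂ same)
        where
        same = encode-injective v₀ (ordering (suc m) (proj₁ x)) (ordering (suc m) (proj₁ y))
          (proj₁ (sound x∈)) (proj₁ (sound y∈)) (proj₂ (sound x∈)) (proj₂ (sound y∈)) eq

    module _ (b c : ℕ) (2M²≤D : 2 * (M * M) ≤ D)
      (late-count  : length (filter late?  (arrays L m)) * b ≤ c * L ^ triangle m)
      (early-count : length (filter early? (arrays L m)) * b ≤ c * L ^ triangle m) where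

      private
        E H Ω : ℕ
        E = length exceptions
        H = length (increasing M D)
        Ω = L ^ triangle m

        Ω≤ : Ω ≤ 2 * (H * M !)
        Ω≤ = ≤-trans (≤-reflexive (cong (L ^_) (trans (triangle≡edge-count m) (edge-count-C (suc m)))))
                     (power-≤-lifts D M 2M²≤D)

        H≢0 : NonZero H
        H≢0 = ≢-nonZero (λ H≡0 → <⇒≱ (m^n>0 L (triangle m))
            (≤-trans Ω≤ (≤-reflexive (cong (λ h → 2 * (h * M !)) H≡0))))

      -- The 4 is 2 · 2: two tails, and the factor lost in passing from injective labellings to all
      -- labellings. The number of lifts cancels.
      exceptions-rare : length exceptions * b ≤ 4 * c * ordering-count (suc m)
      exceptions-rare = *-cancelʳ-≤ (E * b) (4 * c * M !) H {{H≢0}} (begin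
        E * b * H                              ≡⟨ ring₁ E b H ⟩
        E * H * b
            ≤⟨ *-monoˡ-≤ b (≤-trans exceptions-encode (length-filter-⊎ late? early? (arrays L m))) ⟩
        (x + y) * b                            ≡⟨ *-distribʳ-+ b x y ⟩
        x * b + y * b                          ≤⟨ +-mono-≤ late-count early-count ⟩
        c * Ω + c * Ω                          ≤⟨ +-mono-≤ (*-monoʳ-≤ c Ω≤) (*-monoʳ-≤ c Ω≤) ⟩
        c * (2 * (H * M !)) + c * (2 * (H * M !)) ≡⟨ ring₂ c H (M !) ⟩
        4 * c * M ! * H                        ∎)
        where
        open ≤-Reasoning
        x = length (filter late? (arrays L m))
        y = length (filter early? (arrays L m))
        ring₁ : ∀ E b H → E * b * H ≡ E * H * b
        ring₁ = solve-∀
        ring₂ : ∀ c H x → c * (2 * (H * x)) + c * (2 * (H * x)) ≡ 4 * c * x * H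
        ring₂ = solve-∀

    typical-path : 0 < m → k₋ ≤ m → k₊ ≤ m → ∀ f → Typical f →
      Σ[ P ∈ GreedyPath f v₀ ] (k₋ ≤ GreedyPath.length P × GreedyPath.length P < k₊)
    typical-path 0<m k₋≤m k₊≤m f typical with Any.satisfied (Any-All (increasing-sound M D) typical)
      where
      Any-All : ∀ {A : Set} {P Q : A → Set} {xs} → All P xs → Any Q xs → Any (λ x → P x × Q x) xs
      Any-All (p ∷ _)  (here q)  = here (p , q)
      Any-All (_ ∷ ps) (there q) = there (Any-All ps q)
    ... | h , (inc , below) , ¬off = build (steps 0 ω) lower upper
        (greedy (relabel-< f h z<s below) m 0 v₀ (punchIn v₀) z≤n (λ j eq → Fin.punchInᵢ≢i v₀ j (sym eq))
            (Fin.punchIn-injective v₀ _ _))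
      where
      ω = encode {ℓ} v₀ f h
      lower : k₋ ≤ steps 0 ω
      lower = waits≤⇒≤steps 0 k₋ ω k₋≤m (≮⇒≥ (¬off ∘ inj₁))
      upper : steps 0 ω < k₊
      upper = ≰⇒> (λ le → ¬off (inj₂ (≤steps⇒waits≤ 0 k₊ ω k₊≤m z≤n le)))
      build : ∀ k → k₋ ≤ k → k < k₊ → Greedy {ℓ} (relabel f h) 0 v₀ (punchIn v₀) k →
        Σ[ P ∈ GreedyPath f v₀ ] (k₋ ≤ GreedyPath.length P × GreedyPath.length P < k₊)
      -- At time 0 no label lies below the clock, so a path without edges could not be stuck while
      -- another vertex exists.
      build zero    _  _  G with () ← Greedy.stuck G (Fin.fromℕ< 0<m)
        (λ { zero eq → Fin.punchInᵢ≢i v₀ (Fin.fromℕ< 0<m) (trans (sym eq) (Greedy.start G)) })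
      build (suc k) le lt G with P , refl ← greedyPath {ℓ} v₀ f inc k G = P , le , lt

-- Choice of parameters and the final estimate.

module Threshold where

  open Rationals
  open HarmonicSums
  open Arrays
  open Tails
  open Enumeration
  open Counting
  open import Data.Bool using (true)
  open import Data.Fin using (Fin)
  open import Data.Fin.Subset using (Subset; _∈_) renaming (∣_∣ to card)
  open import Data.Integer using (+_)
  import Data.List as List
  open import Data.Nat as ℕ using (ℕ; suc; z≤n; s≤s)
  open import Data.Nat.Combinatorics using (_C_)
  open import Data.Nat.DivMod using (m/n*n≤m; m≡m%n+[m/n]*n; m%n<n; /-monoˡ-≤; m*n/n≡m)
  import Data.Nat.Properties as ℕ
  open import Data.Nat.Tactic.RingSolver using (solve-∀)
  open import Data.Product using (∃-syntax; Σ-syntax; _,_; _×_; proj₁; proj₂)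
  open import Data.Rational
  open import Data.Rational.Properties
  import Data.Rational.Unnormalised as ℚᵘ
  import Data.Rational.Unnormalised.Properties as ℚᵘ
  import Data.Integer as ℤ
  import Data.Integer.Properties as ℤ
  import Data.Vec as Vec
  open import Data.Vec.Properties using ([]=⇒lookup; lookup∘tabulate)
  open import Function using (_∘_; id)
  open import Relation.Nullary using (Dec; yes; does)
  open import Relation.Binary.PropositionalEquality
  open import Data.Rational.Solver using (module +-*-Solver)
  open +-*-Solver using (solve; _:+_; _:*_; _:-_; :-_; _:=_; con)

  fraction : ∀ c s → (+ c / suc s) ≡ ι c * inv s
  fraction c s = toℚᵘ-injective (begin
    toℚᵘ (+ c / suc s)                      ≈⟨ toℚᵘ-fromℚᵘ (ℚᵘ.mkℚᵘ (+ c) s) ⟩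
    ℚᵘ.mkℚᵘ (+ c) s                         ≈⟨ ℚᵘ.*≡*
        (cong₂ ℤ._*_ (sym (ℤ.*-identityʳ (+ c))) (cong (λ k → + suc k) (ℕ.+-identityʳ s))) ⟩
    ℚᵘ.mkℚᵘ (+ c) 0 ℚᵘ.* ℚᵘ.mkℚᵘ (+ 1) s    ≈⟨ ℚᵘ.*-cong (toℚᵘ-ι c) (toℚᵘ-inv s) ⟨
    toℚᵘ (ι c) ℚᵘ.* toℚᵘ (inv s)            ≈⟨ toℚᵘ-homo-* (ι c) (inv s) ⟨
    toℚᵘ (ι c * inv s)                      ∎)
    where open ℚᵘ.≃-Reasoning

  fraction-≥ : ∀ s .{{_ : ℕ.NonZero s}} good bad D δ → good ℕ.+ bad ≡ s → bad ℕ.* suc D ℕ.≤ s → inv D ≤ δ →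
    1ℚ - δ ≤ + good / s
  fraction-≥ (suc s) good bad D δ total rare inv≤δ = begin
    1ℚ - δ                                    ≤⟨ +-monoʳ-≤ 1ℚ (neg-antimono-≤ (≤-trans bad≤ inv≤δ)) ⟩
    1ℚ - ι bad * i                            ≡⟨ cong (_- ι bad * i) (inv-* s) ⟨
    i * ι (suc s) - ι bad * i
        ≡⟨ cong (λ z → i * z - ι bad * i) (trans (cong ι (sym total)) (ι-+ good bad)) ⟩
    i * (ι good + ι bad) - ι bad * i
        ≡⟨ solve 3 (λ i g b → i :* (g :+ b) :- b :* i := g :* i) refl i (ι good) (ι bad) ⟩
    ι good * i                                ≡⟨ fraction good s ⟨
    + good / suc s                            ∎
    where
    open ≤-Reasoning
    i = inv s
    bad≤ : ι bad * i ≤ inv D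
    bad≤ = begin
      ι bad * i                               ≡⟨ *-identityʳ (ι bad * i) ⟨
      ι bad * i * 1ℚ                          ≡⟨ cong (ι bad * i *_) (inv-* D) ⟨
      ι bad * i * (inv D * ι (suc D))
          ≡⟨ solve 4 (λ b i v d → b :* i :* (v :* d) := i :* (b :* d) :* v) refl (ι bad) i (inv D) (ι (suc D)) ⟩
      i * (ι bad * ι (suc D)) * inv D         ≡⟨ cong (λ z → i * z * inv D) (ι-* bad (suc D)) ⟨
      i * ι (bad ℕ.* suc D) * inv D
          ≤⟨ *-monoʳ-≤ (inv D) (0≤inv D) (*-monoˡ-≤ i (0≤inv s) (ι-mono-≤ rare)) ⟩
      i * ι (suc s) * inv D                   ≡⟨ trans (cong (_* inv D) (inv-* s)) (*-identityˡ (inv D)) ⟩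
      inv D                                   ∎

  small-inv : ∀ ε → 0ℚ < ε → ∃[ k ] inv k ≤ ε
  small-inv ε 0<ε with recip-small ε 0<ε
  ... | N , small = N , subst (_≤ ε) (recip≡inv N) (<⇒≤ (small (suc N) (ℕ.n≤1+n N)))

  -- With the number of rows a variable, the equation can be matched. In `Regime` the truncated
  -- subtractions make it hold only propositionally.
  late-count′ : ∀ {ℓ m} a k b R → k ℕ.+ a ≡ m → 1 ℕ.≤ b → suc m ℕ.≤ 6 ℕ.* suc a → suc m ℕ.≤ 2 ℕ.* R ℕ.* b →
    2 ℕ.* (suc m ℕ.* suc m) ℕ.≤ suc ℓ → σ (suc a) k + ι b * inv m ≤ 1ℚ →
    List.length (List.filter (λ ω → suc ℓ ℕ.<? waits k ω) (arrays (suc ℓ) m)) ℕ.* b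
        ℕ.≤ 2304 ℕ.* R ℕ.* suc ℓ ℕ.^ triangle m
  late-count′ a k b R refl = Tail.late-count a k b R

  early-count′ : ∀ {ℓ m} a k b R → k ℕ.+ a ≡ m → 1 ℕ.≤ b → suc m ℕ.≤ 6 ℕ.* suc a → suc m ℕ.≤ 2 ℕ.* R ℕ.* b →
    2 ℕ.* (suc m ℕ.* suc m) ℕ.≤ suc ℓ → 1ℚ + ι b * inv m ≤ σ (suc a) k →
    List.length (List.filter (λ ω → waits k ω ℕ.≤? suc ℓ) (arrays (suc ℓ) m)) ℕ.* b
        ℕ.≤ 2304 ℕ.* R ℕ.* suc ℓ ℕ.^ triangle m
  early-count′ a k b R refl = Tail.early-count a k b R

  -- The coefficients are the crude bounds 2 and 3 on e, from `e-sum 1` and `e-sum≤3`. They keep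
  -- both the visited and the unvisited part proportional to n.
  e-threshold-ℕ : ∀ {n a} → (∀ m → ι a * e-sum m ≤ ι n) → (∀ m → n ℕ.≤ m → ι n ≤ ι (2 ℕ.+ a) * e-sum m) →
    2 ℕ.* a ℕ.≤ n × n ℕ.≤ 3 ℕ.* (2 ℕ.+ a)
  e-threshold-ℕ {n} {a} lower upper =
    ι-cancel-≤ (subst (_≤ ι n) (trans (*-comm (ι a) (1ℚ + 1ℚ))
        (trans (cong (_* ι a) (trans (cong₂ _+_ 1≡ι1 1≡ι1) (sym (ι-+ 1 1)))) (sym (ι-* 2 a)))) (lower 1)) ,
    ι-cancel-≤ (≤-trans (upper n ℕ.≤-refl) (≤-trans (*-monoˡ-≤ (ι (2 ℕ.+ a)) (0≤ι (2 ℕ.+ a)) (e-sum≤3 n))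
      (≤-reflexive (trans (*-comm (ι (2 ℕ.+ a)) (ι 3)) (sym (ι-* 3 (2 ℕ.+ a)))))))

  module Regime (m a d b R : ℕ) (d+a≡m : d ℕ.+ a ≡ m) (1≤b : 1 ℕ.≤ b) (18b≤n : 18 ℕ.* b ℕ.≤ suc m)
    (n≤2Rb : suc m ℕ.≤ 2 ℕ.* R ℕ.* b) (2a≤n : 2 ℕ.* a ℕ.≤ suc m) (n≤6+3a : suc m ℕ.≤ 3 ℕ.* (2 ℕ.+ a))
    (below : σ (suc a) d ≤ 1ℚ) (above : 1ℚ ≤ σ a (suc d)) where

    n = suc m

    b≤d : b ℕ.≤ d
    b≤d = ℕ.*-cancelˡ-≤ 2 (ℕ.+-cancelʳ-≤ (2 ℕ.* suc a) (2 ℕ.* b) (2 ℕ.* d) (begin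
      2 ℕ.* b ℕ.+ 2 ℕ.* suc a             ≡⟨ ring₁ a b ⟩
      2 ℕ.* b ℕ.+ 2 ℕ.* 1 ℕ.+ 2 ℕ.* a     ≤⟨ ℕ.+-mono-≤ (ℕ.≤-trans (ℕ.+-monoʳ-≤ (2 ℕ.* b) (ℕ.*-monoʳ-≤ 2 1≤b))
                                                (ℕ.≤-trans (ℕ.≤-reflexive (ring₂ b))
                                                    (ℕ.≤-trans (ℕ.*-monoˡ-≤ b (ℕ.m≤m+n 4 14)) 18b≤n))) 2a≤n ⟩
      n ℕ.+ n                             ≡⟨ cong (λ m → suc m ℕ.+ suc m) d+a≡m ⟨
      suc (d ℕ.+ a) ℕ.+ suc (d ℕ.+ a)     ≡⟨ ring₃ d a ⟩
      2 ℕ.* d ℕ.+ 2 ℕ.* suc a             ∎))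
      where
      open ℕ.≤-Reasoning
      ring₁ : ∀ a b → 2 ℕ.* b ℕ.+ 2 ℕ.* suc a ≡ 2 ℕ.* b ℕ.+ 2 ℕ.* 1 ℕ.+ 2 ℕ.* a
      ring₁ = solve-∀
      ring₂ : ∀ b → 2 ℕ.* b ℕ.+ 2 ℕ.* b ≡ 4 ℕ.* b
      ring₂ = solve-∀
      ring₃ : ∀ d a → suc (d ℕ.+ a) ℕ.+ suc (d ℕ.+ a) ≡ 2 ℕ.* d ℕ.+ 2 ℕ.* suc a
      ring₃ = solve-∀

    -- Origin of 6 and 18: twice n ≤ 3 (a + 2) is 2 n ≤ 6 a + 12, and n ≥ 18 b ≥ 6 b + 12. So even
    -- after b + 1 vertices are taken from a, the rest is at least n/6 - 1, which is `n≤6a₊`.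
    n+6b≤6a : n ℕ.+ 6 ℕ.* b ℕ.≤ 6 ℕ.* a
    n+6b≤6a = ℕ.+-cancelʳ-≤ 12 (n ℕ.+ 6 ℕ.* b) (6 ℕ.* a) (begin
      n ℕ.+ 6 ℕ.* b ℕ.+ 12                ≡⟨ ℕ.+-assoc n (6 ℕ.* b) 12 ⟩
      n ℕ.+ (6 ℕ.* b ℕ.+ 12 ℕ.* 1)        ≤⟨ ℕ.+-monoʳ-≤ n
          (ℕ.≤-trans (ℕ.+-monoʳ-≤ (6 ℕ.* b) (ℕ.*-monoʳ-≤ 12 1≤b))
                                                (ℕ.≤-trans (ℕ.≤-reflexive (sym (ℕ.*-distribʳ-+ b 6 12)))
                                                    18b≤n)) ⟩
      n ℕ.+ n                             ≤⟨ ℕ.+-mono-≤ n≤6+3a n≤6+3a ⟩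
      3 ℕ.* (2 ℕ.+ a) ℕ.+ 3 ℕ.* (2 ℕ.+ a) ≡⟨ ring a ⟩
      6 ℕ.* a ℕ.+ 12                      ∎)
      where
      open ℕ.≤-Reasoning
      ring : ∀ a → 3 ℕ.* (2 ℕ.+ a) ℕ.+ 3 ℕ.* (2 ℕ.+ a) ≡ 6 ℕ.* a ℕ.+ 12
      ring = solve-∀

    b<a : suc b ℕ.≤ a
    b<a = ℕ.*-cancelˡ-≤ 6 (begin
      6 ℕ.* suc b            ≡⟨ ℕ.*-suc 6 b ⟩
      6 ℕ.+ 6 ℕ.* b          ≤⟨ ℕ.+-monoˡ-≤ (6 ℕ.* b)
          (ℕ.≤-trans (ℕ.m≤m+n 6 12) (ℕ.≤-trans (ℕ.*-monoʳ-≤ 18 1≤b) 18b≤n)) ⟩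
      n ℕ.+ 6 ℕ.* b          ≤⟨ n+6b≤6a ⟩
      6 ℕ.* a                ∎)
      where open ℕ.≤-Reasoning

    -- Stopping b steps before the crossing, or going b steps beyond it, moves the harmonic sum by b
    -- terms of size at least 1/n. This is the margin b/n asked for by the two tail bounds.
    k₋ k₊ a₊ : ℕ
    k₋ = d ℕ.∸ b
    k₊ = suc d ℕ.+ b
    a₊ = a ℕ.∸ suc b

    a₊-eq : b ℕ.+ suc a₊ ≡ a
    a₊-eq = trans (ℕ.+-suc b a₊) (ℕ.m+[n∸m]≡n b<a)

    k₋-eq : k₋ ℕ.+ (b ℕ.+ a) ≡ m
    k₋-eq = trans (sym (ℕ.+-assoc k₋ b a)) (trans (cong (ℕ._+ a) (ℕ.m∸n+n≡m b≤d)) d+a≡m)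

    k₊-eq : k₊ ℕ.+ a₊ ≡ m
    k₊-eq = begin
      suc d ℕ.+ b ℕ.+ a₊     ≡⟨ ring d b a₊ ⟩
      d ℕ.+ (b ℕ.+ suc a₊)   ≡⟨ cong (d ℕ.+_) a₊-eq ⟩
      d ℕ.+ a                ≡⟨ d+a≡m ⟩
      m                      ∎
      where
      open ≡-Reasoning
      ring : ∀ d b a → suc d ℕ.+ b ℕ.+ a ≡ d ℕ.+ (b ℕ.+ suc a)
      ring = solve-∀

    k₋≤m : k₋ ℕ.≤ m
    k₋≤m = ℕ.≤-trans (ℕ.m≤m+n k₋ (b ℕ.+ a)) (ℕ.≤-reflexive k₋-eq)

    k₊≤m : k₊ ℕ.≤ m
    k₊≤m = ℕ.≤-trans (ℕ.m≤m+n k₊ a₊) (ℕ.≤-reflexive k₊-eq)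

    n≤6a₋ : n ℕ.≤ 6 ℕ.* suc (b ℕ.+ a)
    n≤6a₋ = ℕ.≤-trans n≤6+3a (ℕ.≤-trans (ℕ.m≤m+n _ (6 ℕ.* b ℕ.+ 3 ℕ.* a)) (ℕ.≤-reflexive (ring a b)))
      where
      ring : ∀ a b → 3 ℕ.* (2 ℕ.+ a) ℕ.+ (6 ℕ.* b ℕ.+ 3 ℕ.* a) ≡ 6 ℕ.* suc (b ℕ.+ a)
      ring = solve-∀

    n≤6a₊ : n ℕ.≤ 6 ℕ.* suc a₊
    n≤6a₊ = ℕ.+-cancelˡ-≤ (6 ℕ.* b) n (6 ℕ.* suc a₊) (begin
      6 ℕ.* b ℕ.+ n               ≡⟨ ℕ.+-comm (6 ℕ.* b) n ⟩
      n ℕ.+ 6 ℕ.* b               ≤⟨ n+6b≤6a ⟩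
      6 ℕ.* a                     ≡⟨ cong (6 ℕ.*_) a₊-eq ⟨
      6 ℕ.* (b ℕ.+ suc a₊)        ≡⟨ ℕ.*-distribˡ-+ 6 b (suc a₊) ⟩
      6 ℕ.* b ℕ.+ 6 ℕ.* suc a₊    ∎)
      where open ℕ.≤-Reasoning

    σ₋ : σ (suc (b ℕ.+ a)) k₋ + ι b * inv m ≤ 1ℚ
    σ₋ = begin
      σ (suc (b ℕ.+ a)) k₋ + ι b * inv m    ≤⟨ +-monoʳ-≤ (σ (suc (b ℕ.+ a)) k₋) (σ-lower (suc a) b m b+a≤m) ⟩
      σ (suc (b ℕ.+ a)) k₋ + σ (suc a) b    ≡⟨ cong (λ j → σ j k₋ + σ (suc a) b) (ℕ.+-suc b a) ⟨
      σ (b ℕ.+ suc a) k₋ + σ (suc a) b      ≡⟨ σ-split (suc a) b k₋ ⟨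
      σ (suc a) (k₋ ℕ.+ b)                  ≡⟨ cong (σ (suc a)) (ℕ.m∸n+n≡m b≤d) ⟩
      σ (suc a) d                           ≤⟨ below ⟩
      1ℚ                                    ∎
      where
      open ≤-Reasoning
      b+a≤m : b ℕ.+ suc a ℕ.≤ suc m
      b+a≤m = ℕ.≤-trans (ℕ.+-monoˡ-≤ (suc a) b≤d) (ℕ.≤-reflexive (trans (ℕ.+-suc d a) (cong suc d+a≡m)))

    σ₊ : 1ℚ + ι b * inv m ≤ σ (suc a₊) k₊
    σ₊ = begin
      1ℚ + ι b * inv m                      ≤⟨ +-mono-≤ above (σ-lower (suc a₊) b m b+a≤m) ⟩
      σ a (suc d) + σ (suc a₊) b            ≡⟨ cong (λ j → σ j (suc d) + σ (suc a₊) b) a₊-eq ⟨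
      σ (b ℕ.+ suc a₊) (suc d) + σ (suc a₊) b ≡⟨ σ-split (suc a₊) b (suc d) ⟨
      σ (suc a₊) k₊                         ∎
      where
      open ≤-Reasoning
      b+a≤m : b ℕ.+ suc a₊ ℕ.≤ suc m
      b+a≤m = ℕ.≤-trans (ℕ.≤-reflexive a₊-eq) (ℕ.m≤n⇒m≤1+n (ℕ.≤-trans (ℕ.m≤n+m a d) (ℕ.≤-reflexive d+a≡m)))

    -- The first summand meets the condition of `power-≤-lifts`, the second the condition 2 n² ≤ L
    -- of the tail bounds.
    D′ : ℕ
    D′ = 2 ℕ.* ((suc m C 2) ℕ.* (suc m C 2)) ℕ.+ 2 ℕ.* (suc m ℕ.* suc m)

    module _ (v₀ : Fin (suc m)) where

      rare : List.length (exceptions v₀ D′ k₋ k₊) ℕ.* b ℕ.≤ 4 ℕ.* (2304 ℕ.* R) ℕ.* ordering-count (suc m)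
      rare = exceptions-rare v₀ D′ k₋ k₊ b (2304 ℕ.* R)
        (ℕ.m≤n⇒m≤1+n (ℕ.m≤m+n (2 ℕ.* ((suc m C 2) ℕ.* (suc m C 2))) _))
        (late-count′ (b ℕ.+ a) k₋ b R k₋-eq 1≤b n≤6a₋ n≤2Rb 2n²≤L σ₋)
        (early-count′ a₊ k₊ b R k₊-eq 1≤b n≤6a₊ n≤2Rb 2n²≤L σ₊)
        where
        2n²≤L : 2 ℕ.* (suc m ℕ.* suc m) ℕ.≤ suc (D′ ℕ.+ (suc m C 2))
        2n²≤L = ℕ.m≤n⇒m≤1+n (ℕ.≤-trans (ℕ.m≤n+m _ (2 ℕ.* ((suc m C 2) ℕ.* (suc m C 2))))
            (ℕ.m≤m+n D′ (suc m C 2)))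

      path-length : ∀ f → Typical v₀ D′ k₋ k₊ f →
        Σ[ P ∈ GreedyPath f v₀ ] (k₋ ℕ.≤ GreedyPath.length P × GreedyPath.length P ℕ.< k₊)
      path-length = typical-path v₀ D′ k₋ k₊ (ℕ.≤-trans (s≤s z≤n) k₊≤m) k₋≤m k₊≤m

  module _ {n a d b len : ℕ} {ε E q : ℚ} (n-eq : d ℕ.+ suc a ≡ n) (qE≡1 : q * E ≡ 1ℚ) (0≤q : 0ℚ ≤ q)
    (aE≤n : ι a * E ≤ ι n) (n≤aE : ι n ≤ ι (2 ℕ.+ a) * E)
    (d≤ : d ℕ.≤ len ℕ.+ b) (≤d : len ℕ.≤ d ℕ.+ b) (b≤εn : ι (suc b) ≤ ε * ι n) where

    private
      a≤nq : ι a ≤ ι n * q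
      a≤nq = subst (_≤ ι n * q) (trans (*-assoc (ι a) E q)
          (trans (cong (ι a *_) (trans (*-comm E q) qE≡1)) (*-identityʳ (ι a))))
        (*-monoʳ-≤ q 0≤q aE≤n)

      nq≤a+2 : ι n * q ≤ ι (2 ℕ.+ a)
      nq≤a+2 = subst (ι n * q ≤_) (trans (*-assoc (ι (2 ℕ.+ a)) E q)
          (trans (cong (ι (2 ℕ.+ a) *_) (trans (*-comm E q) qE≡1)) (*-identityʳ (ι (2 ℕ.+ a)))))
        (*-monoʳ-≤ q 0≤q n≤aE)

      nq≤a+1+1 : ι n * q ≤ 1ℚ + (1ℚ + ι a)
      nq≤a+1+1 = ≤-trans nq≤a+2 (≤-reflexive (trans (ι-suc (suc a)) (cong (λ z → 1ℚ + z) (ι-suc a))))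

      n≡ : ι n ≡ ι d + (1ℚ + ι a)
      n≡ = trans (cong ι (sym n-eq)) (trans (ι-+ d (suc a)) (cong (λ z → ι d + z) (ι-suc a)))

      d≤′ : ι d ≤ ι len + ι b
      d≤′ = ≤-trans (ι-mono-≤ d≤) (≤-reflexive (ι-+ len b))

      ≤d′ : ι len ≤ ι d + ι b
      ≤d′ = ≤-trans (ι-mono-≤ ≤d) (≤-reflexive (ι-+ d b))

      b+1≤ : 1ℚ + ι b ≤ ε * ι n
      b+1≤ = ≤-trans (≤-reflexive (sym (ι-suc b))) b≤εn

    -- Since n = d + 1 + a and a ≤ n q ≤ a + 2, the number n (1 - q) lies within 1 of d, and `len`
    -- lies within b of d. Hence the error b + 1.
    length-close : ∣ ι len - ι n * (1ℚ - q) ∣ ≤ ε * ι n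
    length-close = ∣p∣≤
      (begin
        ι len - ι n * (1ℚ - q)
          ≡⟨ solve 3 (λ l n q → l :- n :* (con 1ℚ :- q) := (l :+ n :* q) :- n) refl (ι len) (ι n) q ⟩
        (ι len + ι n * q) - ι n
          ≡⟨ cong (λ z → (ι len + ι n * q) - z) n≡ ⟩
        (ι len + ι n * q) - (ι d + (1ℚ + ι a))
          ≤⟨ +-monoˡ-≤ (- (ι d + (1ℚ + ι a))) (+-mono-≤ ≤d′ nq≤a+1+1) ⟩
        (ι d + ι b) + (1ℚ + (1ℚ + ι a)) - (ι d + (1ℚ + ι a))
          ≡⟨ solve 3 (λ d b a → (d :+ b) :+ (con 1ℚ :+ (con 1ℚ :+ a)) :- (d :+ (con 1ℚ :+ a)) := con 1ℚ :+ b)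
              refl (ι d) (ι b) (ι a) ⟩
        1ℚ + ι b
          ≤⟨ b+1≤ ⟩
        ε * ι n ∎)
      (begin
        - (ι len - ι n * (1ℚ - q))
          ≡⟨ solve 3 (λ l n q → :- (l :- n :* (con 1ℚ :- q)) := n :- (l :+ n :* q)) refl (ι len) (ι n) q ⟩
        ι n - (ι len + ι n * q)
          ≡⟨ cong (_- (ι len + ι n * q)) n≡ ⟩
        ι d + (1ℚ + ι a) - (ι len + ι n * q)
          ≤⟨ +-mono-≤ (+-monoˡ-≤ (1ℚ + ι a) d≤′) (neg-antimono-≤ (+-monoʳ-≤ (ι len) a≤nq)) ⟩
        (ι len + ι b) + (1ℚ + ι a) - (ι len + ι a)
          ≡⟨ solve 3 (λ l b a → (l :+ b) :+ (con 1ℚ :+ a) :- (l :+ a) := con 1ℚ :+ b) refl (ι len) (ι b) (ι a) ⟩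
        1ℚ + ι b
          ≤⟨ b+1≤ ⟩
        ε * ι n ∎)
      where open ≤-Reasoning

  opaque
    -- With R = 18 (R₀ + 1) this is 9216 R (D + 1) times R, so that b = n / R is at least 9216 R (D
    -- + 1). That is what `rare-enough` consumes.
    threshold : ℕ → ℕ → ℕ
    threshold R₀ D = 9216 ℕ.* (18 ℕ.* suc R₀) ℕ.* suc D ℕ.* (18 ℕ.* suc R₀)

    threshold≡ : ∀ R₀ D → threshold R₀ D ≡ 9216 ℕ.* (18 ℕ.* suc R₀) ℕ.* suc D ℕ.* (18 ℕ.* suc R₀)
    threshold≡ R₀ D = refl

  -- b is about n/R, with R ≥ 18 so that n ± b stays in the linear regime, and
  -- 9216 = 4 * 2304 absorbs the constants of the tail bounds.
  module Choice (R₀ D n : ℕ) (N≤n : threshold R₀ D ℕ.≤ n) where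

    R b : ℕ
    R = 18 ℕ.* suc R₀
    b = n ℕ./ R

    b-large : 9216 ℕ.* R ℕ.* suc D ℕ.≤ b
    b-large = ℕ.≤-trans (ℕ.≤-reflexive (sym (m*n/n≡m (9216 ℕ.* R ℕ.* suc D) R)))
        (/-monoˡ-≤ R (subst (ℕ._≤ n) (threshold≡ R₀ D) N≤n))

    bR≤n : b ℕ.* R ℕ.≤ n
    bR≤n = m/n*n≤m n R

    1≤b : 1 ℕ.≤ b
    1≤b = ℕ.≤-trans (ℕ.*-mono-≤ (ℕ.*-mono-≤ (ℕ.m≤m+n 1 9215) (ℕ.*-mono-≤ (ℕ.m≤m+n 1 17) (s≤s (z≤n {R₀}))))
        (s≤s (z≤n {D}))) b-large

    18b≤n : 18 ℕ.* b ℕ.≤ n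
    18b≤n = ℕ.≤-trans (ℕ.≤-trans (ℕ.m≤m*n (18 ℕ.* b) (suc R₀)) (ℕ.≤-reflexive (ring b R₀))) bR≤n
      where
      ring : ∀ b r → 18 ℕ.* b ℕ.* suc r ≡ b ℕ.* (18 ℕ.* suc r)
      ring = solve-∀

    n≤2Rb : n ℕ.≤ 2 ℕ.* R ℕ.* b
    n≤2Rb = begin
      n                                ≡⟨ m≡m%n+[m/n]*n n R ⟩
      n ℕ.% R ℕ.+ b ℕ.* R              ≤⟨ ℕ.+-monoˡ-≤ (b ℕ.* R) (ℕ.<⇒≤ (m%n<n n R)) ⟩
      R ℕ.+ b ℕ.* R                    ≤⟨ ℕ.+-monoˡ-≤ (b ℕ.* R)
          (ℕ.≤-trans (ℕ.≤-reflexive (sym (ℕ.*-identityˡ R))) (ℕ.*-monoˡ-≤ R 1≤b)) ⟩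
      b ℕ.* R ℕ.+ b ℕ.* R              ≡⟨ ring b R ⟩
      2 ℕ.* R ℕ.* b                    ∎
      where
      open ℕ.≤-Reasoning
      ring : ∀ b R → b ℕ.* R ℕ.+ b ℕ.* R ≡ 2 ℕ.* R ℕ.* b
      ring = solve-∀

    b+1≤n/R₀ : suc b ℕ.* suc R₀ ℕ.≤ n
    b+1≤n/R₀ = begin
      suc b ℕ.* suc R₀              ≤⟨ ℕ.*-monoˡ-≤ (suc R₀)
          (ℕ.≤-trans (ℕ.+-monoˡ-≤ b 1≤b) (ℕ.≤-trans (ℕ.m≤m+n (b ℕ.+ b) (16 ℕ.* b)) (ℕ.≤-reflexive (ring₁ b)))) ⟩
      18 ℕ.* b ℕ.* suc R₀           ≡⟨ ring₂ b R₀ ⟩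
      b ℕ.* R                       ≤⟨ bR≤n ⟩
      n                             ∎
      where
      open ℕ.≤-Reasoning
      ring₁ : ∀ b → b ℕ.+ b ℕ.+ 16 ℕ.* b ≡ 18 ℕ.* b
      ring₁ = solve-∀
      ring₂ : ∀ b r → 18 ℕ.* b ℕ.* suc r ≡ b ℕ.* (18 ℕ.* suc r)
      ring₂ = solve-∀

    b+1≤εn : ∀ {ε} → inv R₀ ≤ ε → ι (suc b) ≤ ε * ι n
    b+1≤εn {ε} inv≤ε = begin
      ι (suc b)                            ≡⟨ *-identityʳ (ι (suc b)) ⟨
      ι (suc b) * 1ℚ                       ≡⟨ cong (ι (suc b) *_) (inv-* R₀) ⟨
      ι (suc b) * (inv R₀ * ι (suc R₀))    ≡⟨ solve 3 (λ b v r → b :* (v :* r) := v :* (b :* r)) refl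
          (ι (suc b)) (inv R₀) (ι (suc R₀)) ⟩
      inv R₀ * (ι (suc b) * ι (suc R₀))    ≡⟨ cong (inv R₀ *_) (ι-* (suc b) (suc R₀)) ⟨
      inv R₀ * ι (suc b ℕ.* suc R₀)        ≤⟨ *-mono-≤-nonNeg (0≤inv R₀) (0≤ι n) inv≤ε (ι-mono-≤ b+1≤n/R₀) ⟩
      ε * ι n                              ∎
      where open ≤-Reasoning

    rare-enough : ∀ bad total → bad ℕ.* b ℕ.≤ 4 ℕ.* (2304 ℕ.* R) ℕ.* total → bad ℕ.* suc D ℕ.≤ total
    rare-enough bad total rare = ℕ.*-cancelˡ-≤ (9216 ℕ.* R) (begin
      9216 ℕ.* R ℕ.* (bad ℕ.* suc D)       ≡⟨ ring₁ (9216 ℕ.* R) bad (suc D) ⟩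
      bad ℕ.* (9216 ℕ.* R ℕ.* suc D)       ≤⟨ ℕ.*-monoʳ-≤ bad b-large ⟩
      bad ℕ.* b                            ≤⟨ rare ⟩
      4 ℕ.* (2304 ℕ.* R) ℕ.* total         ≡⟨ cong (ℕ._* total) (ℕ.*-assoc 4 2304 R) ⟨
      9216 ℕ.* R ℕ.* total                 ∎)
      where
      open ℕ.≤-Reasoning
      ring₁ : ∀ c x d → c ℕ.* (x ℕ.* d) ≡ x ℕ.* (c ℕ.* d)
      ring₁ = solve-∀

  Close : ∀ (ε : ℚ) n (v₀ : Fin n) → EdgeOrdering n → Set
  Close ε n v₀ f = Σ[ P ∈ GreedyPath f v₀ ]
    (∣ fromℚ (fromℕℚ (GreedyPath.length P)) -ᴿ (fromℕℚ n ·ᴿ (fromℚ 1ℚ -ᴿ 1/e)) ∣ᴿ ≤ᴿ fromℚ (ε * fromℕℚ n))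

  does-true : ∀ {P : Set} (P? : Dec P) → does P? ≡ true → P
  does-true (yes p) _ = p

  -- Approximants are computed pointwise, so the real inequality unfolds to the rational one. As
  -- that holds exactly from N on, the tolerance in `_≤ᴿ_` is pure slack.
  length-closeᴿ : ∀ (p q r : ℚ) N → (∀ j → N ℕ.≤ j → ∣ p - q * (1ℚ - approx 1/e j) ∣ ≤ r) →
    ∣ fromℚ p -ᴿ (q ·ᴿ (fromℚ 1ℚ -ᴿ 1/e)) ∣ᴿ ≤ᴿ fromℚ r
  length-closeᴿ p q r N le ε 0<ε = N , λ j N≤j → ≤-trans (le j N≤j) (≤-from-gap (<⇒≤ 0<ε) refl)

  module _ (ε δ : ℚ) (m D R b : ℕ) (inv≤δ : inv D ≤ δ) (1≤b : 1 ℕ.≤ b) (18b≤n : 18 ℕ.* b ℕ.≤ suc m)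
    (n≤2Rb : suc m ℕ.≤ 2 ℕ.* R ℕ.* b) (b+1≤εn : ι (suc b) ≤ ε * ι (suc m))
    (rare-enough : ∀ bad total → bad ℕ.* b ℕ.≤ 4 ℕ.* (2304 ℕ.* R) ℕ.* total → bad ℕ.* suc D ℕ.≤ total)
    (v₀ : Fin (suc m)) (a d : ℕ) (d+a≡n : d ℕ.+ suc a ≡ suc m) (below : σ (suc a) d < 1ℚ)
        (above : 1ℚ ≤ σ a (suc d))
    (aE≤n : ∀ j → ι a * e-sum j ≤ ι (suc m)) (n≤aE : ∀ j → suc m ℕ.≤ j → ι (suc m)
        ≤ ι (2 ℕ.+ a) * e-sum j) where

    private
      coarse : 2 ℕ.* a ℕ.≤ suc m × suc m ℕ.≤ 3 ℕ.* (2 ℕ.+ a)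
      coarse = e-threshold-ℕ aE≤n n≤aE

      module W = Regime m a d b R (ℕ.suc-injective (trans (sym (ℕ.+-suc d a)) d+a≡n)) 1≤b 18b≤n n≤2Rb
        (proj₁ coarse) (proj₂ coarse) (<⇒≤ below) above

      typical : ∀ f → Dec (Typical v₀ W.D′ W.k₋ W.k₊ f)
      typical = typical? v₀ W.D′ W.k₋ W.k₊

      approx-close : ∀ len → W.k₋ ℕ.≤ len → len ℕ.< W.k₊ → ∀ j → suc m ℕ.≤ j →
        ∣ fromℕℚ len - fromℕℚ (suc m) * (1ℚ - approx 1/e j) ∣ ≤ ε * fromℕℚ (suc m)
      approx-close len k₋≤ <k₊ j n≤j =
        subst₂ (λ x y → ∣ x - y * (1ℚ - approx 1/e j) ∣ ≤ ε * y) (sym (fromℕℚ≡ι len)) (sym (fromℕℚ≡ι (suc m)))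
          (length-close {d = d} {ε = ε} d+a≡n
              (*-inverseˡ (e-sum j) {{pos⇒nonZero (e-sum j) {{1≤⇒pos (1≤e j)}}}})
            (<⇒≤ (positive⁻¹ (approx 1/e j) {{1/pos⇒pos (e-sum j) {{1≤⇒pos (1≤e j)}}}}))
            (aE≤n j) (n≤aE j n≤j)
            (ℕ.≤-trans (ℕ.≤-reflexive (sym (ℕ.m∸n+n≡m W.b≤d))) (ℕ.+-monoˡ-≤ b k₋≤)) (ℕ.s≤s⁻¹ <k₊) b+1≤εn)

      close : ∀ f → Typical v₀ W.D′ W.k₋ W.k₊ f → Close ε (suc m) v₀ f
      -- The approximants are compared from index n = `suc m` on, where the upper estimate of
      -- `e-threshold` becomes available.
      close f t = P , length-closeᴿ (fromℕℚ (GreedyPath.length P)) (fromℕℚ (suc m)) (ε * fromℕℚ (suc m)) (suc m)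
          (approx-close (GreedyPath.length P) (proj₁ (proj₂ path)) (proj₂ (proj₂ path)))
        where
        path = W.path-length v₀ f t
        P = proj₁ path

      favourable : Subset (ordering-count (suc m))
      favourable = Vec.tabulate (does ∘ typical ∘ ordering (suc m))

    likely : ProbAtLeast (edgeOrderings (suc m)) (Close ε (suc m) v₀) (1ℚ - δ)
    likely = record
      { size        = ordering-count (suc m)
      ; nonEmpty    = (suc m C 2) ℕ.!≢0
      ; enumeration = orderings-enumeration (suc m)
      ; favourable  = favourable
      ; sound       = λ {i} i∈ → close (ordering (suc m) i) (does-true (typical (ordering (suc m) i))
          (trans (sym (lookup∘tabulate (does ∘ typical ∘ ordering (suc m)) i)) ([]=⇒lookup i∈)))
      ; bound       = fraction-≥ (ordering-count (suc m)) {{(suc m C 2) ℕ.!≢0}}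
          (card favourable) (List.length (exceptions v₀ W.D′ W.k₋ W.k₊)) D δ
          (card-tabulate (typical ∘ ordering (suc m)) (ordering-count (suc m)) id)
          (rare-enough (List.length (exceptions v₀ W.D′ W.k₋ W.k₊)) (ordering-count (suc m)) (W.rare v₀)) inv≤δ
      }

open HarmonicSums using (e-threshold)
open Threshold using (small-inv; threshold; module Choice; likely)
open import Data.Fin using (Fin)
open import Data.Nat as ℕ using (ℕ; suc)
open import Data.Product using (∃-syntax; Σ-syntax; _,_)
open import Data.Rational using (ℚ; 0ℚ; 1ℚ; _<_; _-_; _*_)

proposition1 : ∀ (ε δ : ℚ) → 0ℚ < ε → 0ℚ < δ →
    ∃[ N ] (∀ (n : ℕ) → N ℕ.≤ n → (v₀ : Fin n) →
    ProbAtLeast (edgeOrderings n)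
    (λ f → Σ[ P ∈ GreedyPath f v₀ ]
    (∣ fromℚ (fromℕℚ (GreedyPath.length P)) -ᴿ (fromℕℚ n ·ᴿ (fromℚ 1ℚ -ᴿ 1/e)) ∣ᴿ
    ≤ᴿ fromℚ (ε * fromℕℚ n)))
    (1ℚ - δ))
proposition1 ε δ 0<ε 0<δ =
  -- The accuracy ε is met through R₀, which fixes the ratio of n to b; the probability δ is met
  -- through D, as at most a fraction 1/(D + 1) of the orderings is exceptional.
  let R₀ , inv≤ε = small-inv ε 0<ε
      D  , inv≤δ = small-inv δ 0<δ
  in threshold R₀ D , λ where
    (suc m) N≤n v₀ →
      let a , d , d+a≡n , below , above , aE≤n , n≤aE = e-threshold m
          module C = Choice R₀ D (suc m) N≤n
      in likely ε δ m D C.R C.b inv≤δ C.1≤b C.18b≤n C.n≤2Rb (C.b+1≤εn inv≤ε) C.rare-enough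
           v₀ a d d+a≡n below above aE≤n n≤aE
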